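{- Let $T$ be a countable complete first-order theory with monster model $\bar M$ and let $A\subset\bar M$ be countable. Let $\{\mathfrak p_i\mid i\in I\}$ be a countable family of pairwise orthogonal, generically stable global types, each of which is regular over $A$. Assume also that each $\mathfrak p_i\upharpoonright A$ is non-isolated. Then for any function $f:I\to\omega$ there exists a countable elementary submodel $M_f\supseteq A$ of $\bar M$ such that $\dim_{\mathfrak p_i}(M_f/A)=f(i)$ for all $i\in I$.
   Context: $T$ is a complete first-order theory with monster model $\bar M$; "small" means of cardinality less than the saturation of $\bar M$. A global type is a complete type over $\bar M$; $\mathfrak p\upharpoonright A$ is the restriction of $\mathfrak p$ to $A$. For small $A$, $\mathfrak p(x)$ is $A$-invariant if for all $\bar b_1\equiv\bar b_2\,(A)$ and all formulas $\phi(x;\bar y)$ over $A$: $\phi(x,\bar b_1)\in\mathfrak p$ iff $\phi(x,\bar b_2)\in\mathfrak p$. Morley sequence: $(a_i\mid i<\alpha)$ is a Morley sequence in $\mathfrak p$ over $A$ if $a_i\models\mathfrak p\upharpoonright Aa_{<i}$ for all $i<\alpha$. Generic stability: a non-algebraic global type $\mathfrak p$ is generically stable if for some small $A$ it is $A$-invariant and, for every infinite $\alpha$ and every Morley sequence $(a_i\mid i<\alpha)$ in $\mathfrak p$ over $A$, for every formula $\phi(x)$ with parameters from $\bar M$ the set $\{i\mid\ \models\phi(a_i)\}$ is finite or co-finite. Regularity: a non-algebraic global type $\mathfrak p(x)$ in a single variable (possibly of a sort of $\bar M^{eq}$) is regular over a small set $A$ if it is $A$-invariant and for every small $B\supseteq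 A$ and every $a\models\mathfrak p\upharpoonright A$: either $a\models\mathfrak p\upharpoonright B$ or $\mathfrak p\upharpoonright B\vdash\mathfrak p\upharpoonright Ba$. Orthogonality: global types $\mathfrak p,\mathfrak q$ are orthogonal if $\mathfrak p(x)\cup\mathfrak q(y)$ (disjoint variables) determines a complete type over $\bar M$. Dimension: generically stable types are symmetric (Morley sequences are totally indiscernible), and for a symmetric type $\mathfrak p$ that is regular over $A$ the operation $X\mapsto\{b\models\mathfrak p\upharpoonright A\mid b\not\models\mathfrak p\upharpoonright AX\}$ is a pregeometry on the realizations of $\mathfrak p\upharpoonright A$. Hence for $M\supseteq A$ all maximal Morley sequences in $\mathfrak p$ over $A$ consisting of elements of $M$ have the same cardinality; $\dim_{\mathfrak p}(M/A)$ denotes this cardinality. -}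

-- Many-sorted classical first-order logic, monster models, imaginaries, and
-- the notions of stability theory for global types.
--
-- A structure interprets each sort by a setoid, and the equality symbol by
-- the setoid equality; this makes the quotient sorts of M^eq available
-- without quotient types.  Sets of elements are predicates on
-- representatives and stand for the sets of classes they meet.

module Defs where

open import Axiom.ExcludedMiddle using (ExcludedMiddle)
open import Data.Fin.Base using (Fin)
open import Data.List.Base using (List; []; _∷_; _++_; map)
open import Data.List.Membership.Propositional using (_∈_)
import Data.List.Membership.Setoid as SetoidMembership
open import Data.List.Relation.Unary.All as All using (All; []; _∷_)
open import Data.List.Relation.Unary.All.Properties using (++⁺; map⁺; map⁻)
open import Data.List.Relation.Unary.Any using (here; there)
open import Data.Nat.Base using (ℕ)
open import Data.Product.Base using (Σ; ∃; ∃₂; ∃-syntax; _×_; _,_; proj₁; proj₂)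
open import Data.Sum.Base using (_⊎_)
open import Data.Unit.Base using (⊤)
open import Data.Empty using (⊥)
open import Function.Base using (_∘_)
open import Function.Bundles using (_⇔_; _↣_; _↔_; Injection; Inverse)
open import Induction.WellFounded using (WellFounded)
open import Level using (0ℓ; Setω)
open import Relation.Binary.Bundles using (Setoid)
import Relation.Binary.Construct.On as On
open import Relation.Binary.Structures using (IsEquivalence; IsStrictTotalOrder)
open import Relation.Binary.PropositionalEquality.Core using (_≡_; refl)
import Relation.Binary.PropositionalEquality.Properties as ≡
open import Relation.Nullary using (¬_)
open import Relation.Unary using (Pred; _⊆_; _∪_; ｛_｝)

-- The classical metatheory.  As `Dec` is not truncated, excluded middle also
-- selects an element of every inhabited type; without function
-- extensionality or quotients this selection is not extensional, hence the
-- axiom of choice is included in the form of the well-ordering principle.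

record Classical : Setω where
  field
    excludedMiddle : ∀ ℓ → ExcludedMiddle ℓ
    wellOrdering   : (X : Set) → Σ (X → X → Set) λ _<_ →
                     IsStrictTotalOrder _≡_ _<_ × WellFounded _<_

------------------------------------------------------------------------
-- Cardinality

_≼_ _≺_ : Setoid 0ℓ 0ℓ → Setoid 0ℓ 0ℓ → Set
X ≼ Y = Injection X Y
X ≺ Y = X ≼ Y × ¬ (Y ≼ X)

Finite : (X : Setoid 0ℓ 0ℓ) → Pred (Setoid.Carrier X) 0ℓ → Set
Finite X P = ∃[ xs ] (∀ x → P x → x ∈ₓ xs)
  where open SetoidMembership X renaming (_∈_ to _∈ₓ_)

-- Ordinals, as index sets of sequences.

record WellOrder : Set₁ where
  field
    Index              : Set
    _<_                : Index → Index → Set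
    isStrictTotalOrder : IsStrictTotalOrder _≡_ _<_
    wellFounded        : WellFounded _<_

  FinitelyMany : Pred Index 0ℓ → Set
  FinitelyMany = Finite (≡.setoid Index)

  Infinite : Set
  Infinite = ¬ FinitelyMany (λ _ → ⊤)

------------------------------------------------------------------------
-- Syntax

record Language : Set₁ where
  field
    Sort : Set
    Func : List Sort → Sort → Set
    Rel  : List Sort → Set

open Language public using (Sort)

CountableLanguage : Language → Set
CountableLanguage L = (Sort L ↣ ℕ) × (∃₂ Func ↣ ℕ) × (∃ Rel ↣ ℕ)
  where open Language L using (Func; Rel)

module _ (L : Language) where
  open Language L using (Func; Rel)

  infixr 6 _⇒_

  data Term (Γ : List (Sort L)) : Sort L → Set where
    var : ∀ {s} → s ∈ Γ → Term Γ s
    app : ∀ {Δ s} → Func Δ s → All (Term Γ) Δ → Term Γ s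

  data Formula (Γ : List (Sort L)) : Set where
    _≐_ : ∀ {s} → Term Γ s → Term Γ s → Formula Γ
    rel : ∀ {Δ} → Rel Δ → All (Term Γ) Δ → Formula Γ
    ⊥′  : Formula Γ
    _⇒_ : Formula Γ → Formula Γ → Formula Γ
    ∀′  : ∀ s → Formula (s ∷ Γ) → Formula Γ

¬′_ : ∀ {L Γ} → Formula L Γ → Formula L Γ
¬′ φ = φ ⇒ ⊥′

------------------------------------------------------------------------
-- Structures and satisfaction

module _ {S : Set} (C : S → Setoid 0ℓ 0ℓ) where

  data TupleEq : ∀ {Γ} → All (Setoid.Carrier ∘ C) Γ →
                 All (Setoid.Carrier ∘ C) Γ → Set where
    []  : TupleEq [] []
    _∷_ : ∀ {s Γ} {x y : Setoid.Carrier (C s)} {a b : All (Setoid.Carrier ∘ C) Γ} →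
          Setoid._≈_ (C s) x y → TupleEq a b → TupleEq (x ∷ a) (y ∷ b)

  data ElemEq : ∃ (Setoid.Carrier ∘ C) → ∃ (Setoid.Carrier ∘ C) → Set where
    elemEq : ∀ {s} {x y : Setoid.Carrier (C s)} →
             Setoid._≈_ (C s) x y → ElemEq (s , x) (s , y)

  elemSetoid : Setoid 0ℓ 0ℓ
  elemSetoid = record
    { Carrier       = ∃ (Setoid.Carrier ∘ C)
    ; _≈_           = ElemEq
    ; isEquivalence = record
      { refl  = λ { {s , _} → elemEq (Setoid.refl (C s)) }
      ; sym   = λ { (elemEq {s} p) → elemEq (Setoid.sym (C s) p) }
      ; trans = λ { (elemEq {s} p) (elemEq q) → elemEq (Setoid.trans (C s) p q) }
      }
    }

record Structure (L : Language) : Set₁ where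
  open Language L using (Func; Rel)
  field
    setoid : Sort L → Setoid 0ℓ 0ℓ

  Carrier : Sort L → Set
  Carrier s = Setoid.Carrier (setoid s)

  _≈_ : ∀ {s} → Carrier s → Carrier s → Set
  _≈_ {s} = Setoid._≈_ (setoid s)

  Tuple : List (Sort L) → Set
  Tuple = All Carrier

  _≈*_ : ∀ {Γ} → Tuple Γ → Tuple Γ → Set
  _≈*_ = TupleEq setoid

  field
    func      : ∀ {Δ s} → Func Δ s → Tuple Δ → Carrier s
    func-cong : ∀ {Δ s} (f : Func Δ s) {a b : Tuple Δ} → a ≈* b → func f a ≈ func f b
    relation  : ∀ {Δ} → Rel Δ → Tuple Δ → Set
    rel-resp  : ∀ {Δ} (r : Rel Δ) {a b : Tuple Δ} → a ≈* b → relation r a → relation r b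

  Elem : Set
  Elem = ∃ Carrier

Subset : ∀ {L} → Structure L → Set₁
Subset M = Pred (Structure.Elem M) 0ℓ

subsetSetoid : ∀ {L} (M : Structure L) → Subset M → Setoid 0ℓ 0ℓ
subsetSetoid M A = On.setoid {B = Σ _ A} (elemSetoid (Structure.setoid M)) proj₁

Countable : ∀ {L} (M : Structure L) → Subset M → Set
Countable M A = subsetSetoid M A ≼ ≡.setoid ℕ

-- |A| < |κ|

Small : Set → ∀ {L} (M : Structure L) → Subset M → Set
Small κ M A = subsetSetoid M A ≺ ≡.setoid κ

module _ {L : Language} (M : Structure L) where
  open Structure M

  ⟦_⟧  : ∀ {Γ s} → Term L Γ s → Tuple Γ → Carrier s
  ⟦_⟧* : ∀ {Γ Δ} → All (Term L Γ) Δ → Tuple Γ → Tuple Δ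
  ⟦ var v ⟧ a    = All.lookup a v
  ⟦ app f ts ⟧ a = func f (⟦ ts ⟧* a)
  ⟦ [] ⟧* a      = []
  ⟦ t ∷ ts ⟧* a  = ⟦ t ⟧ a ∷ ⟦ ts ⟧* a

  _⊨_[_] : ∀ {Γ} → Formula L Γ → Tuple Γ → Set
  _⊨_[_] (t ≐ u)    a = ⟦ t ⟧ a ≈ ⟦ u ⟧ a
  _⊨_[_] (rel r ts) a = relation r (⟦ ts ⟧* a)
  _⊨_[_] ⊥′         a = ⊥
  _⊨_[_] (φ ⇒ ψ)    a = _⊨_[_] φ a → _⊨_[_] ψ a
  _⊨_[_] (∀′ s φ)   a = (x : Carrier s) → _⊨_[_] φ (x ∷ a)

  ≈*-refl : ∀ {Γ} {a : Tuple Γ} → a ≈* a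
  ≈*-refl {a = []}            = []
  ≈*-refl {a = _∷_ {x = s} x a} = Setoid.refl (setoid s) ∷ ≈*-refl

  ≈*-sym : ∀ {Γ} {a b : Tuple Γ} → a ≈* b → b ≈* a
  ≈*-sym []              = []
  ≈*-sym (_∷_ {s} p ps) = Setoid.sym (setoid s) p ∷ ≈*-sym ps

  ++⁺-cong : ∀ {Γ Δ} {a b : Tuple Γ} {c d : Tuple Δ} →
             a ≈* b → c ≈* d → ++⁺ a c ≈* ++⁺ b d
  ++⁺-cong []       qs = qs
  ++⁺-cong (p ∷ ps) qs = p ∷ ++⁺-cong ps qs

  lookup-cong : ∀ {Γ s} {a b : Tuple Γ} → a ≈* b → (v : s ∈ Γ) →
                All.lookup a v ≈ All.lookup b v
  lookup-cong (p ∷ ps) (here refl) = p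
  lookup-cong (p ∷ ps) (there v)   = lookup-cong ps v

  ⟦⟧-cong  : ∀ {Γ s} (t : Term L Γ s) {a b : Tuple Γ} → a ≈* b → ⟦ t ⟧ a ≈ ⟦ t ⟧ b
  ⟦⟧*-cong : ∀ {Γ Δ} (ts : All (Term L Γ) Δ) {a b : Tuple Γ} → a ≈* b → ⟦ ts ⟧* a ≈* ⟦ ts ⟧* b
  ⟦⟧-cong (var v)    e = lookup-cong e v
  ⟦⟧-cong (app f ts) e = func-cong f (⟦⟧*-cong ts e)
  ⟦⟧*-cong []        e = []
  ⟦⟧*-cong (t ∷ ts)  e = ⟦⟧-cong t e ∷ ⟦⟧*-cong ts e

  ⊨-resp : ∀ {Γ} (φ : Formula L Γ) {a b : Tuple Γ} → a ≈* b → _⊨_[_] φ a → _⊨_[_] φ b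
  ⊨-resp (_≐_ {s} t u) e h =
    trans (⟦⟧-cong t (≈*-sym e)) (trans h (⟦⟧-cong u e))
    where open Setoid (setoid s) using (trans)
  ⊨-resp (rel r ts) e h   = rel-resp r (⟦⟧*-cong ts e) h
  ⊨-resp (φ ⇒ ψ)    e h g = ⊨-resp ψ e (h (⊨-resp φ (≈*-sym e) g))
  ⊨-resp (∀′ s φ)   e h x = ⊨-resp φ (Setoid.refl (setoid s) ∷ e) (h x)

------------------------------------------------------------------------
-- Theories

Theory : Language → Set₁
Theory L = Pred (Formula L []) 0ℓ

Model : ∀ {L} → Theory L → Structure L → Set
Model T M = ∀ σ → T σ → M ⊨ σ [ [] ]

-- Consistency is not included: it is implied by the existence of a monster
-- model of T.

Complete : ∀ {L} → Theory L → Set₁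
Complete {L} T = ∀ σ → (∀ M → Model T M → M ⊨ σ [ [] ])
                     ⊎ (∀ M → Model T M → M ⊨ ¬′ σ [ [] ])

------------------------------------------------------------------------
-- Elementary submodels

module _ {L} (M : Structure L) (U : Subset M) where
  open Structure M
  open Language L using (Func)

  CarrierIn : Sort L → Set
  CarrierIn s = Σ (Carrier s) λ x → U (s , x)

  setoidIn : Sort L → Setoid 0ℓ 0ℓ
  setoidIn s = On.setoid {B = CarrierIn s} (setoid s) proj₁

  forget : ∀ {Γ} → All CarrierIn Γ → Tuple Γ
  forget = All.map proj₁

  forget-cong : ∀ {Γ} {a b : All CarrierIn Γ} → TupleEq setoidIn a b → forget a ≈* forget b
  forget-cong []       = []
  forget-cong (p ∷ ps) = p ∷ forget-cong ps

  Closed : Set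
  Closed = ∀ {Δ s} (f : Func Δ s) (a : All CarrierIn Δ) → U (s , func f (forget a))

  substructure : Closed → Structure L
  substructure closed = record
    { setoid    = setoidIn
    ; func      = λ f a → func f (forget a) , closed f a
    ; func-cong = λ f e → func-cong f (forget-cong e)
    ; relation  = λ r a → relation r (forget a)
    ; rel-resp  = λ r e → rel-resp r (forget-cong e)
    }

  record IsElementarySubmodel : Set where
    field
      closed     : Closed
      elementary : ∀ {Γ} (φ : Formula L Γ) (a : All CarrierIn Γ) →
                   substructure closed ⊨ φ [ a ] ⇔ M ⊨ φ [ forget a ]

------------------------------------------------------------------------
-- Formulas with parameters and global types

module _ {L : Language} (M : Structure L) where
  open Structure M

  record ParamFormula (Γ : List (Sort L)) : Set where
    constructor _⟨_⟩
    field
      {ParamSorts} : List (Sort L)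
      matrix       : Formula L (Γ ++ ParamSorts)
      params       : Tuple ParamSorts

module _ {L : Language} {M : Structure L} where
  open Structure M

  infix 4 _⊩_

  _⊩_ : ∀ {Γ} → Tuple Γ → ParamFormula M Γ → Set
  a ⊩ (φ ⟨ b ⟩) = M ⊨ φ [ ++⁺ a b ]

  neg : ∀ {Γ} → ParamFormula M Γ → ParamFormula M Γ
  neg (φ ⟨ b ⟩) = (¬′ φ) ⟨ b ⟩

  Over : Subset M → ∀ {Γ} → ParamFormula M Γ → Set
  Over A (_⟨_⟩ {Δ} _ b) = ∀ {s} (v : s ∈ Δ) → A (s , All.lookup b v)

  -- φ(x;ȳ) and b̄ ↦ φ(x;b̄)

  instantiate : ∀ {s Δ} → ParamFormula M (s ∷ Δ) → Tuple Δ → ParamFormula M (s ∷ [])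
  instantiate (φ ⟨ c ⟩) b = φ ⟨ ++⁺ b c ⟩

  SameType : Subset M → ∀ {Δ} → Tuple Δ → Tuple Δ → Set
  SameType A {Δ} b₁ b₂ = ∀ (φ : ParamFormula M Δ) → Over A φ → (b₁ ⊩ φ) ⇔ (b₂ ⊩ φ)

  -- Consequence modulo the elementary diagram of M: some finite part of Σ
  -- implies φ in M.

  _⊢_ : ∀ {Γ} → Pred (ParamFormula M Γ) 0ℓ → ParamFormula M Γ → Set
  Φ ⊢ φ = ∃[ φs ] All Φ φs × (∀ a → All (a ⊩_) φs → a ⊩ φ)

  _⊢*_ : ∀ {Γ} → Pred (ParamFormula M Γ) 0ℓ → Pred (ParamFormula M Γ) 0ℓ → Set
  Φ ⊢* Ψ = ∀ ψ → Ψ ψ → Φ ⊢ ψ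

  FinitelySatisfiable : ∀ {Γ} → Pred (ParamFormula M Γ) 0ℓ → Set
  FinitelySatisfiable Φ = ∀ φs → All Φ φs → ∃[ a ] All (a ⊩_) φs

------------------------------------------------------------------------
-- Monster models

record Automorphism {L} (M : Structure L) : Set where
  open Structure M
  open Language L using (Func; Rel)
  field
    perm : ∀ s → Inverse (setoid s) (setoid s)

  apply : ∀ {s} → Carrier s → Carrier s
  apply {s} = Inverse.to (perm s)

  field
    perm-func : ∀ {Δ s} (f : Func Δ s) a → apply (func f a) ≈ func f (All.map apply a)
    perm-rel  : ∀ {Δ} (r : Rel Δ) a → relation r a ⇔ relation r (All.map apply a)

Saturated : Set → ∀ {L} → Structure L → Set₁
Saturated κ {L} M =
  ∀ (A : Subset M) → Small κ M A →
  ∀ (s : Sort L) (Φ : Pred (ParamFormula M (s ∷ [])) 0ℓ) →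
  (∀ φ → Φ φ → Over A φ) → FinitelySatisfiable Φ →
  ∃[ a ] (∀ φ → Φ φ → a ⊩ φ)

StronglyHomogeneous : Set → ∀ {L} → Structure L → Set₁
StronglyHomogeneous κ {L} M =
  ∀ {J : Set} → ≡.setoid J ≺ ≡.setoid κ →
  ∀ (s : J → Sort L) (a b : ∀ j → Carrier (s j)) →
  (∀ (js : List J) (φ : Formula L (map s js)) →
     M ⊨ φ [ map⁺ (All.universal a js) ] ⇔ M ⊨ φ [ map⁺ (All.universal b js) ]) →
  Σ (Automorphism M) λ σ → ∀ j → Automorphism.apply σ (a j) ≈ b j
  where open Structure M

-- The type κ represents the saturation of the monster, an uncountable
-- cardinal (so that countable sets are small).

record IsMonster (κ : Set) {L} (T : Theory L) (M : Structure L) : Set₁ where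
  field
    uncountable         : ≡.setoid ℕ ≺ ≡.setoid κ
    model               : Model T M
    saturated           : Saturated κ M
    stronglyHomogeneous : StronglyHomogeneous κ M

------------------------------------------------------------------------
-- M^eq

module _ {L : Language} (M : Structure L) where
  open Structure M
  open Language L using (Func; Rel)

  record DefinableEquivalence (Γ : List (Sort L)) : Set where
    field
      formula : Formula L (Γ ++ Γ)

    _∼_ : Tuple Γ → Tuple Γ → Set
    a ∼ b = M ⊨ formula [ ++⁺ a b ]

    field
      isEquivalence : IsEquivalence _∼_

  data EqSort : Set where
    home : Sort L → EqSort
    imag : ∀ Γ → DefinableEquivalence Γ → EqSort

  data EqFunc : List EqSort → EqSort → Set where
    old : ∀ {Δ s} → Func Δ s → EqFunc (map home Δ) (home s)
    cls : ∀ {Γ} (E : DefinableEquivalence Γ) → EqFunc (map home Γ) (imag Γ E)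

  data EqRel : List EqSort → Set where
    old : ∀ {Δ} → Rel Δ → EqRel (map home Δ)

  L^eq : Language
  L^eq = record { Sort = EqSort ; Func = EqFunc ; Rel = EqRel }

  eqSetoid : EqSort → Setoid 0ℓ 0ℓ
  eqSetoid (home s)   = setoid s
  eqSetoid (imag Γ E) = record
    { Carrier = Tuple Γ ; isEquivalence = DefinableEquivalence.isEquivalence E }

  map⁻-cong : ∀ {Δ} {a b : All (Setoid.Carrier ∘ eqSetoid) (map home Δ)} →
              TupleEq eqSetoid a b → map⁻ {xs = Δ} a ≈* map⁻ b
  map⁻-cong {[]}    []       = []
  map⁻-cong {_ ∷ _} (p ∷ ps) = p ∷ map⁻-cong ps

  eqFunc : ∀ {Δ s} → EqFunc Δ s → All (Setoid.Carrier ∘ eqSetoid) Δ → Setoid.Carrier (eqSetoid s)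
  eqFunc (old f) a = func f (map⁻ a)
  eqFunc (cls E) a = map⁻ a

  eqFunc-cong : ∀ {Δ s} (f : EqFunc Δ s) {a b : All (Setoid.Carrier ∘ eqSetoid) Δ} →
                TupleEq eqSetoid a b → Setoid._≈_ (eqSetoid s) (eqFunc f a) (eqFunc f b)
  eqFunc-cong (old f) e = func-cong f (map⁻-cong e)
  eqFunc-cong (cls E) {a} e =
    ⊨-resp M (DefinableEquivalence.formula E)
      (++⁺-cong M (≈*-refl M) (map⁻-cong e))
      (IsEquivalence.refl (DefinableEquivalence.isEquivalence E) {map⁻ a})

  eqRelation : ∀ {Δ} → EqRel Δ → All (Setoid.Carrier ∘ eqSetoid) Δ → Set
  eqRelation (old r) a = relation r (map⁻ a)

  eqRel-resp : ∀ {Δ} (r : EqRel Δ) {a b : All (Setoid.Carrier ∘ eqSetoid) Δ} →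
               TupleEq eqSetoid a b → eqRelation r a → eqRelation r b
  eqRel-resp (old r) e = rel-resp r (map⁻-cong e)

  _^eq : Structure L^eq
  _^eq = record
    { setoid    = eqSetoid
    ; func      = eqFunc
    ; func-cong = eqFunc-cong
    ; relation  = eqRelation
    ; rel-resp  = eqRel-resp
    }

  -- A ⊆ M as a subset of M^eq

  data real (A : Subset M) : Subset _^eq where
    real-elem : ∀ {s x} → A (s , x) → real A (home s , x)

  -- U^eq inside M^eq, for an elementary submodel U of M: the imaginary
  -- elements are the classes having a representative in U.

  data eqClosure (U : Subset M) : Subset _^eq where
    home-elem : ∀ {s x} → U (s , x) → eqClosure U (home s , x)
    imag-elem : ∀ {Γ E a b} → (∀ {s} (v : s ∈ Γ) → U (s , All.lookup b v)) →
                DefinableEquivalence._∼_ E a b → eqClosure U (imag Γ E , a)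

------------------------------------------------------------------------
-- Global types (complete types over M in one variable of sort s)

record GlobalType {L} (M : Structure L) (s : Sort L) : Set₁ where
  field
    member     : Pred (ParamFormula M (s ∷ [])) 0ℓ
    consistent : FinitelySatisfiable member
    complete   : ∀ φ → member φ ⊎ member (neg φ)

module _ {L : Language} {M : Structure L} where
  open Structure M
  open GlobalType

  infix 5 _↾_
  infix 4 _realizes_

  _↾_ : ∀ {s} → GlobalType M s → Subset M → Pred (ParamFormula M (s ∷ [])) 0ℓ
  (p ↾ A) φ = member p φ × Over A φ

  _realizes_ : ∀ {s} → Carrier s → Pred (ParamFormula M (s ∷ [])) 0ℓ → Set
  a realizes Φ = ∀ φ → Φ φ → (a ∷ []) ⊩ φ

  NonAlgebraic : ∀ {s} → GlobalType M s → Set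
  NonAlgebraic {s} p = ∀ φ → member p φ → ¬ Finite (setoid s) (λ a → (a ∷ []) ⊩ φ)

  Isolated : ∀ {s} → Pred (ParamFormula M (s ∷ [])) 0ℓ → Set
  Isolated Φ = ∃[ φ ] Φ φ × (∀ a → (a ∷ []) ⊩ φ → a realizes Φ)

  Invariant : ∀ {s} → Subset M → GlobalType M s → Set
  Invariant {s} A p =
    ∀ {Δ} (b₁ b₂ : Tuple Δ) → SameType {M = M} A b₁ b₂ →
    ∀ (φ : ParamFormula M (s ∷ Δ)) → Over A φ →
    member p (instantiate φ b₁) ⇔ member p (instantiate φ b₂)

  range : ∀ {s} {J : Set} → (J → Carrier s) → Pred J 0ℓ → Subset M
  range {s} a P e = ∃[ j ] P j × e ≡ (s , a j)

  Morley : ∀ {s} → GlobalType M s → Subset M →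
           (α : WellOrder) → (WellOrder.Index α → Carrier s) → Set
  Morley p A α a = ∀ i → a i realizes p ↾ (A ∪ range a (_< i))
    where open WellOrder α

  GenericallyStable : Set → ∀ {s} → GlobalType M s → Set₁
  GenericallyStable κ {s} p =
    NonAlgebraic p ×
    ∃[ A ] Small κ M A × Invariant A p ×
      (∀ (α : WellOrder) → let open WellOrder α in Infinite →
       ∀ (a : Index → Carrier s) → Morley p A α a →
       ∀ (φ : ParamFormula M (s ∷ [])) →
         FinitelyMany (λ i → (a i ∷ []) ⊩ φ) ⊎
         FinitelyMany (λ i → ¬ ((a i ∷ []) ⊩ φ)))

  Regular : Set → ∀ {s} → Subset M → GlobalType M s → Set₁
  Regular κ {s} A p =
    NonAlgebraic p × Invariant A p ×
    (∀ (B : Subset M) → Small κ M B → A ⊆ B →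
     ∀ (a : Carrier s) → a realizes p ↾ A →
       a realizes p ↾ B ⊎ (p ↾ B) ⊢* (p ↾ (B ∪ ｛ s , a ｝)))

  -- p(x) ∪ q(y) determines a complete type over M: it proves φ or ¬φ for
  -- each φ(x,y).

  JointlyProve : ∀ {s t} → GlobalType M s → GlobalType M t →
                 ParamFormula M (s ∷ t ∷ []) → Set
  JointlyProve p q φ =
    ∃₂ λ θs ψs → All (member p) θs × All (member q) ψs ×
      (∀ a b → All ((a ∷ []) ⊩_) θs → All ((b ∷ []) ⊩_) ψs → (a ∷ b ∷ []) ⊩ φ)

  Orthogonal : ∀ {s t} → GlobalType M s → GlobalType M t → Set
  Orthogonal p q = ∀ φ → JointlyProve p q φ ⊎ JointlyProve p q (neg φ)

  -- Generically stable types are symmetric, so maximality of a Morley sequence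
  -- among those inside U amounts to having no one-term prolongation in U.

  record MaximalMorley {s} (p : GlobalType M s) (A U : Subset M) : Set₁ where
    field
      order    : WellOrder
    open WellOrder order public
    field
      sequence : Index → Carrier s
      inside   : ∀ i → U (s , sequence i)
      morley   : Morley p A order sequence
      maximal  : ∀ c → U (s , c) → ¬ (c realizes p ↾ (A ∪ range sequence (λ _ → ⊤)))

  -- dim_p(U/A) = n.  As p is non-algebraic, Morley sequences do not repeat,
  -- so their cardinality is that of the index set.

  HasDimension : ∀ {s} → GlobalType M s → Subset M → Subset M → ℕ → Set₁
  HasDimension p U A n =
    MaximalMorley p A U ×
    (∀ (m : MaximalMorley p A U) → MaximalMorley.Index m ↔ Fin n)

{-# OPTIONS --safe #-}
-- Generic stability enters through one fact: a definable set in the type is not avoided by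
-- arbitrarily long finite Morley sequences.  It makes the type commute with every invariant type,
-- and makes orthogonal types weakly orthogonal over every countable base of invariance.
-- Let B be A together with independent realizations a(i,j), j < f i, of the p i over A.  By weak
-- orthogonality (for the other types) and regularity (for p i itself) no p i ↾ B is isolated, so
-- omitting types inside the monster gives a countable elementary submodel whose eq-closure contains
-- the a(i,j) and omits every p i ↾ B.  There the a(i,j), j < f i, form a maximal Morley sequence in
-- p i, since what realizes p i over A and these realizes p i ↾ B by weak orthogonality; and exchange
-- for regular types shows that all maximal Morley sequences have the same length.
module Submission where

open import Defs
open import Axiom.ExcludedMiddle using (ExcludedMiddle)
open import Data.Bool.Properties using (T-irrelevant)
open import Data.Empty using (⊥; ⊥-elim)
open import Data.Fin.Base as Fin using (Fin; zero; suc; toℕ)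
import Data.Fin.Induction as Fin
import Data.Fin.Properties as Fin
open import Data.List.Base as List using (List; []; _∷_; _++_; map; concat; replicate)
open import Data.List.Membership.Propositional using (_∈_)
open import Data.List.Membership.Propositional.Properties using (∈-++⁺ˡ; ∈-++⁺ʳ; ∈-lookup; finite)
open import Data.List.Relation.Unary.All as All using (All; []; _∷_)
open import Data.List.Relation.Unary.All.Properties using (++⁺; map⁺; map⁻; lookup-map; map-∘; map-cong; concat⁻)
open import Data.List.Relation.Unary.AllPairs using ([]; _∷_)
open import Data.List.Relation.Unary.Any using (here; there; index)
open import Data.List.Relation.Unary.Any.Properties using (lookup-index)
open import Data.List.Relation.Unary.Unique.Propositional using (Unique)
open import Data.Maybe.Base as Maybe using (Maybe; just; nothing; _>>=_)
open import Data.Maybe.Properties using (just-injective)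
open import Data.Nat.Base as ℕ using (ℕ; zero; suc; _+_)
import Data.Nat.Induction as ℕ
import Data.Nat.Properties as ℕ
open import Data.Product.Base using (Σ; ∃; ∃₂; ∃-syntax; _×_; _,_; proj₁; proj₂)
open import Data.Sum.Base using (_⊎_; inj₁; inj₂; [_,_]′; map₂)
open import Data.Sum.Properties using (inj₁-injective; inj₂-injective)
open import Data.Sum.Relation.Binary.LeftOrder using (_⊎-<_; ₁∼₂; ₁∼₁; ₂∼₂; ⊎-<-wellFounded; ⊎-<-transitive)
open import Data.Unit.Base using (⊤; tt)
open import Function.Base using (_∘_; id)
open import Function.Bundles using (_⇔_; _↣_; _↔_; mk⇔; mk↣; mk↔ₛ′; Equivalence; Injection)
import Function.Construct.Composition as Compose
open import Function.Definitions using (Injective)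
open import Function.Properties.Equivalence using (⇔-isEquivalence)
open import Induction.WellFounded using (WellFounded; Acc; acc)
open import Level using (0ℓ)
open import Relation.Binary.Bundles using (Setoid)
open import Relation.Binary.Definitions using (Tri; tri<; tri≈; tri>)
open import Relation.Binary.PropositionalEquality
  using (_≡_; refl; sym; trans; cong; cong₂; subst)
open import Relation.Binary.PropositionalEquality.Core using (_≢_)
import Relation.Binary.PropositionalEquality.Properties as ≡
open import Relation.Binary.Structures using (IsEquivalence; IsStrictTotalOrder)
open import Relation.Binary.Structures.Biased using (isStrictTotalOrderᶜ)
open import Relation.Nullary using (¬_; Dec; yes; no)
open import Relation.Nullary.Decidable using (True; toWitness; fromWitness; decidable-stable)
open import Relation.Unary using (Pred; _⊆_; _∪_; ｛_｝)
open Equivalence using (to; from)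
open IsEquivalence (⇔-isEquivalence {ℓ = 0ℓ}) using ()
  renaming (refl to ⇔-refl; sym to ⇔-sym; trans to ⇔-trans)

-- Three obstacles shape the proof. The base `A₀` in the definition of generic stability is merely
-- small and unrelated to the countable bases of invariance `C` used elsewhere. The fact about
-- avoiding Morley sequences bridges this: the avoiding sequences are taken over `C`, only their
-- types over `C` matter, and copies of them are found inside a Morley sequence over `A₀ ∪ C`. That
-- `A₀ ∪ C` and its countable extensions are small is itself a statement about an arbitrary type
-- `κ`, settled by cutting well-orders into blocks of type at most ω. The types live on sorts of
-- `M^eq`, whose sorts carry proofs, so that saturation and the countability of formulas (up to
-- equivalence) are brought over from the home structure by passing to representatives. Finally the
-- terms a(i,j) may be imaginary. The model is therefore built as a subset `E` of `M^eq` that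
-- contains them and solves formulas in home variables; its home part is the elementary submodel,
-- and solving for representatives puts the terms into the eq-closure.

≡⇒⇔ : ∀ {P Q : Set} → P ≡ Q → P ⇔ Q
≡⇒⇔ refl = ⇔-refl

-- Tuples, substitution and its semantics

module _ {S : Set} {P : S → Set} where

  lookup-ext : ∀ {Γ} {a b : All P Γ} →
               (∀ {s} (v : s ∈ Γ) → All.lookup a v ≡ All.lookup b v) → a ≡ b
  lookup-ext {a = []}    {[]}    h = refl
  lookup-ext {a = x ∷ a} {y ∷ b} h = cong₂ _∷_ (h (here refl)) (lookup-ext (h ∘ there))

  lookup-++⁺ˡ : ∀ {Γ Δ} (a : All P Γ) (b : All P Δ) {s} (v : s ∈ Γ) →
                All.lookup (++⁺ a b) (∈-++⁺ˡ v) ≡ All.lookup a v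
  lookup-++⁺ˡ (x ∷ a) b (here refl) = refl
  lookup-++⁺ˡ (x ∷ a) b (there v)   = lookup-++⁺ˡ a b v

  lookup-++⁺ʳ : ∀ {Γ Δ} (a : All P Γ) (b : All P Δ) {s} (v : s ∈ Δ) →
                All.lookup (++⁺ a b) (∈-++⁺ʳ Γ v) ≡ All.lookup b v
  lookup-++⁺ʳ []      b v = refl
  lookup-++⁺ʳ (x ∷ a) b v = lookup-++⁺ʳ a b v

  ++⁺-surjective : ∀ Γ {Δ} (a : All P (Γ ++ Δ)) →
                   Σ (All P Γ) λ b → Σ (All P Δ) λ c → ++⁺ b c ≡ a
  ++⁺-surjective []      a       = [] , a , refl
  ++⁺-surjective (s ∷ Γ) (x ∷ a) = let b , c , e = ++⁺-surjective Γ a in x ∷ b , c , cong (x ∷_) e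

  map-++⁺ : ∀ {Q : S → Set} {Γ Δ} (f : ∀ {s} → Q s → P s) (a : All Q Γ) (b : All Q Δ) →
            All.map f (++⁺ a b) ≡ ++⁺ (All.map f a) (All.map f b)
  map-++⁺ f []      b = refl
  map-++⁺ f (x ∷ a) b = cong (f x ∷_) (map-++⁺ f a b)

module _ {L : Language} where

  Sub : List (Sort L) → List (Sort L) → Set
  Sub Γ Δ = ∀ {s} → s ∈ Γ → Term L Δ s

  subT  : ∀ {Γ Δ s} → Sub Γ Δ → Term L Γ s → Term L Δ s
  subT* : ∀ {Γ Δ Θ} → Sub Γ Δ → All (Term L Γ) Θ → All (Term L Δ) Θ
  subT σ (var v)    = σ v
  subT σ (app f ts) = app f (subT* σ ts)
  subT* σ []        = []
  subT* σ (t ∷ ts)  = subT σ t ∷ subT* σ ts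

  liftSub : ∀ {Γ Δ s} → Sub Γ Δ → Sub (s ∷ Γ) (s ∷ Δ)
  liftSub σ (here refl) = var (here refl)
  liftSub σ (there v)   = subT (var ∘ there) (σ v)

  subF : ∀ {Γ Δ} → Sub Γ Δ → Formula L Γ → Formula L Δ
  subF σ (t ≐ u)    = subT σ t ≐ subT σ u
  subF σ (rel r ts) = rel r (subT* σ ts)
  subF σ ⊥′         = ⊥′
  subF σ (φ ⇒ ψ)    = subF σ φ ⇒ subF σ ψ
  subF σ (∀′ s φ)   = ∀′ s (subF (liftSub σ) φ)

module _ {L : Language} (M : Structure L) where
  open Structure M

  Evaluates : ∀ {Γ Δ} → Sub {L} Γ Δ → Tuple Γ → Tuple Δ → Set
  Evaluates {Γ} σ a b = ∀ {s} (v : s ∈ Γ) → ⟦_⟧ M (σ v) b ≡ All.lookup a v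

  ⟦subT⟧  : ∀ {Γ Δ s} (σ : Sub Γ Δ) {a b} → Evaluates σ a b →
            (t : Term L Γ s) → ⟦_⟧ M (subT σ t) b ≡ ⟦_⟧ M t a
  ⟦subT⟧* : ∀ {Γ Δ Θ} (σ : Sub Γ Δ) {a b} → Evaluates σ a b →
            (ts : All (Term L Γ) Θ) → ⟦_⟧* M (subT* σ ts) b ≡ ⟦_⟧* M ts a
  ⟦subT⟧ σ h (var v)    = h v
  ⟦subT⟧ σ h (app f ts) = cong (func f) (⟦subT⟧* σ h ts)
  ⟦subT⟧* σ h []        = refl
  ⟦subT⟧* σ h (t ∷ ts)  = cong₂ _∷_ (⟦subT⟧ σ h t) (⟦subT⟧* σ h ts)

  liftSub-evaluates : ∀ {Γ Δ s} (σ : Sub {L} Γ Δ) {a b} (x : Carrier s) → Evaluates σ a b →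
                      Evaluates (liftSub σ) (x ∷ a) (x ∷ b)
  liftSub-evaluates σ x h (here refl) = refl
  liftSub-evaluates σ x h (there v)   =
    trans (⟦subT⟧ (var ∘ there) (λ _ → refl) (σ v)) (h v)

  ⊨-subF : ∀ {Γ Δ} (σ : Sub Γ Δ) {a b} → Evaluates σ a b →
           (φ : Formula L Γ) → (M ⊨ subF σ φ [ b ]) ⇔ (M ⊨ φ [ a ])
  ⊨-subF σ h (t ≐ u)    = ≡⇒⇔ (cong₂ _≈_ (⟦subT⟧ σ h t) (⟦subT⟧ σ h u))
  ⊨-subF σ h (rel r ts) = ≡⇒⇔ (cong (relation r) (⟦subT⟧* σ h ts))
  ⊨-subF σ h ⊥′         = ⇔-refl
  ⊨-subF σ h (φ ⇒ ψ)    = mk⇔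
    (λ g x → to (⊨-subF σ h ψ) (g (from (⊨-subF σ h φ) x)))
    (λ g x → from (⊨-subF σ h ψ) (g (to (⊨-subF σ h φ) x)))
  ⊨-subF σ h (∀′ s φ)   = mk⇔
    (λ g x → to (⊨-subF (liftSub σ) (liftSub-evaluates σ x h) φ) (g x))
    (λ g x → from (⊨-subF (liftSub σ) (liftSub-evaluates σ x h) φ) (g x))

-- The calculus of definable sets

module Definability (em : ExcludedMiddle 0ℓ) {L : Language} (M : Structure L) where
  open Structure M

  dne : ∀ {P : Set} → ¬ ¬ P → P
  dne = decidable-stable em

  -- Later arguments handle sets of tuples instead of formulas. The parameter list is hidden in the
  -- witness, so that Boolean operations, quantifiers and changes of variables compose without
  -- matching contexts.
  record Defn (C : Subset M) {Γ} (X : Tuple Γ → Set) : Set where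
    constructor defn
    field
      formula : ParamFormula M Γ
      over    : Over C formula
      correct : ∀ a → (a ⊩ formula) ⇔ X a

  entries : ∀ {Γ} → Tuple Γ → Subset M
  entries {Γ} a (s , x) = Σ (s ∈ Γ) λ v → All.lookup a v ≡ x

  -- A tuple of entries is a substitution that sends each variable to a variable of `Γ` or to a
  -- constant from `C`. Permuting, identifying and filling in variables are all instances of
  -- `definable` for such substitutions.
  data Entry (C : Subset M) (Γ : List (Sort L)) (s : Sort L) : Set where
    variable′ : s ∈ Γ → Entry C Γ s
    constant  : (x : Carrier s) → C (s , x) → Entry C Γ s

  value : ∀ {C Γ s} → Tuple Γ → Entry C Γ s → Carrier s
  value a (variable′ v)  = All.lookup a v
  value a (constant x _) = x

  values : ∀ {C Γ Δ} → Tuple Γ → All (Entry C Γ) Δ → Tuple Δ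
  values a = All.map (value a)

  private
    ParamsOf : ∀ {C Γ Δ} → All (Entry C Γ) Δ → List (Sort L)
    ParamsOf []                             = []
    ParamsOf (variable′ _ ∷ ρ)              = ParamsOf ρ
    ParamsOf (_∷_ {x = s} (constant _ _) ρ) = s ∷ ParamsOf ρ

    paramsOf : ∀ {C Γ Δ} (ρ : All (Entry C Γ) Δ) → Tuple (ParamsOf ρ)
    paramsOf []                 = []
    paramsOf (variable′ _ ∷ ρ)  = paramsOf ρ
    paramsOf (constant x _ ∷ ρ) = x ∷ paramsOf ρ

    paramsOf-over : ∀ {C Γ Δ} (ρ : All (Entry C Γ) Δ) {s} (v : s ∈ ParamsOf ρ) →
                    C (s , All.lookup (paramsOf ρ) v)
    paramsOf-over (variable′ _ ∷ ρ)  v           = paramsOf-over ρ v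
    paramsOf-over (constant x c ∷ ρ) (here refl) = c
    paramsOf-over (constant x c ∷ ρ) (there v)   = paramsOf-over ρ v

    position : ∀ {C Γ Δ} (ρ : All (Entry C Γ) Δ) {s} → s ∈ Δ → s ∈ Γ ⊎ s ∈ ParamsOf ρ
    position (variable′ w ∷ ρ)  (here refl) = inj₁ w
    position (constant _ _ ∷ ρ) (here refl) = inj₂ (here refl)
    position (variable′ _ ∷ ρ)  (there v)   = position ρ v
    position (constant _ _ ∷ ρ) (there v)   = map₂ there (position ρ v)

    pick : ∀ {Γ Δ s} → Tuple Γ → Tuple Δ → s ∈ Γ ⊎ s ∈ Δ → Carrier s
    pick a b (inj₁ v) = All.lookup a v
    pick a b (inj₂ v) = All.lookup b v

    position-value : ∀ {C Γ Δ} (ρ : All (Entry C Γ) Δ) (a : Tuple Γ) {s} (v : s ∈ Δ) →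
      pick a (paramsOf ρ) (position ρ v) ≡ All.lookup (values a ρ) v
    position-value (variable′ w ∷ ρ)  a (here refl) = refl
    position-value (constant x _ ∷ ρ) a (here refl) = refl
    position-value (variable′ _ ∷ ρ)  a (there v)   = position-value ρ a v
    position-value (constant _ _ ∷ ρ) a (there v) with position ρ v | position-value ρ a v
    ... | inj₁ _ | e = e
    ... | inj₂ _ | e = e

    append : ∀ {Γ Δ} {s : Sort L} → s ∈ Γ ⊎ s ∈ Δ → s ∈ Γ ++ Δ
    append {Γ} = [ ∈-++⁺ˡ , ∈-++⁺ʳ Γ ]′

    lookup-append : ∀ {Γ Δ} (a : Tuple Γ) (b : Tuple Δ) {s} (v : s ∈ Γ ⊎ s ∈ Δ) →
      All.lookup (++⁺ a b) (append v) ≡ pick a b v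
    lookup-append a b (inj₁ v) = lookup-++⁺ˡ a b v
    lookup-append a b (inj₂ v) = lookup-++⁺ʳ a b v

  abstract
    definable : ∀ {C Γ Γ′} (φ : Formula L Γ′) (ρ : All (Entry C Γ) Γ′) →
                Defn C (λ a → M ⊨ φ [ values a ρ ])
    definable φ ρ =
      defn (subF (var ∘ append ∘ position ρ) φ ⟨ paramsOf ρ ⟩) (paramsOf-over ρ) λ a →
      ⊨-subF M _ (λ v → trans (lookup-append a (paramsOf ρ) (position ρ v))
                              (position-value ρ a v)) φ

    def-⇔ : ∀ {C Γ} {X Y : Tuple Γ → Set} → (∀ a → X a ⇔ Y a) → Defn C X → Defn C Y
    def-⇔ e (defn φ o h) = defn φ o λ a → ⇔-trans (h a) (e a)

    def-⊆ : ∀ {C D Γ} {X : Tuple Γ → Set} → C ⊆ D → Defn C X → Defn D X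
    def-⊆ i (defn φ o h) = defn φ (λ v → i (o v)) h

  def-over : ∀ {C Γ} (φ : ParamFormula M Γ) → Over C φ → Defn C (_⊩ φ)
  def-over φ o = defn φ o λ _ → ⇔-refl

  constants : ∀ {C Γ Δ} (b : Tuple Δ) → entries b ⊆ C → All (Entry C Γ) Δ
  constants []      o = []
  constants (x ∷ b) o = constant x (o (here refl , refl)) ∷ constants b (λ (v , e) → o (there v , e))

  values-constants : ∀ {C Γ Δ} (a : Tuple Γ) (b : Tuple Δ) (o : entries b ⊆ C) →
                     values a (constants b o) ≡ b
  values-constants a []      o = refl
  values-constants a (x ∷ b) o = cong (x ∷_) (values-constants a b _)

  variables : ∀ {C Γ Δ} → All (_∈ Γ) Δ → All (Entry C Γ) Δ
  variables = All.map variable′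

  rearrange : ∀ {Γ Δ} → All (_∈ Γ) Δ → Tuple Γ → Tuple Δ
  rearrange θ a = All.map (All.lookup a) θ

  values-variables : ∀ {C Γ Δ} (a : Tuple Γ) (θ : All (_∈ Γ) Δ) →
                     values {C} a (variables θ) ≡ rearrange θ a
  values-variables a []      = refl
  values-variables a (v ∷ θ) = cong (_ ∷_) (values-variables a θ)

  allVars : ∀ {Γ : List (Sort L)} → All (_∈ Γ) Γ
  allVars = All.tabulate id

  rearrange-allVars : ∀ {Γ} (a : Tuple Γ) → rearrange allVars a ≡ a
  rearrange-allVars a = lookup-ext λ v →
    trans (lookup-map allVars v) (cong (All.lookup a) (lookup-tabulate v))
    where
    lookup-tabulate : ∀ {Γ Δ : List (Sort L)} {f : ∀ {s} → s ∈ Γ → s ∈ Δ} {s} (v : s ∈ Γ) →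
                      All.lookup (All.tabulate {P = _∈ Δ} f) v ≡ f v
    lookup-tabulate (here refl) = refl
    lookup-tabulate (there v)   = lookup-tabulate v

  ⟦vars⟧* : ∀ {Γ Δ} (vs : All (_∈ Γ) Δ) (a : Tuple Γ) →
            ⟦_⟧* M (All.map {Q = Term L Γ} var vs) a ≡ rearrange vs a
  ⟦vars⟧* []       a = refl
  ⟦vars⟧* (v ∷ vs) a = cong (_ ∷_) (⟦vars⟧* vs a)

  def-formula : ∀ {C Γ} (φ : Formula L Γ) → Defn C (M ⊨ φ [_])
  def-formula {C} φ = def-⇔
    (λ a → ≡⇒⇔ (cong (M ⊨ φ [_]) (trans (values-variables {C} a allVars) (rearrange-allVars a))))
    (definable φ (variables allVars))

  rearrange-map : ∀ {Γ Δ} (f : ∀ {s} → s ∈ Δ → s ∈ Γ) (a : Tuple Γ) {b : Tuple Δ} →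
                  (∀ {s} (v : s ∈ Δ) → All.lookup a (f v) ≡ All.lookup b v) →
                  rearrange (All.map f allVars) a ≡ b
  rearrange-map f a h = trans (lookup-ext λ v → trans (lookup-map (All.map f allVars) v) (trans
      (cong (All.lookup a) (lookup-map allVars v)) (trans (h _) (sym (lookup-map allVars v)))))
    (rearrange-allVars _)

  leftVars : ∀ {Γ Δ : List (Sort L)} → All (_∈ Γ ++ Δ) Γ
  leftVars = All.map ∈-++⁺ˡ allVars

  rearrange-leftVars : ∀ {Γ Δ} (a : Tuple Γ) (b : Tuple Δ) → rearrange leftVars (++⁺ a b) ≡ a
  rearrange-leftVars a b = rearrange-map ∈-++⁺ˡ (++⁺ a b) (lookup-++⁺ˡ a b)

  over-entries : ∀ {C : Subset M} {Δ} (b : Tuple Δ) →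
                 (∀ {s} (v : s ∈ Δ) → C (s , All.lookup b v)) → entries b ⊆ C
  over-entries b o (v , refl) = o v

  abstract
    -- Converse of `definable`: a definable set is given by a parameter-free formula and a tuple of
    -- entries, a form in which a formula of `M^eq` can be translated apart from its parameters.
    def-matrix : ∀ {C Γ} {X : Tuple Γ → Set} → Defn C X →
                 Σ (List (Sort L)) λ Δ → Σ (Formula L Δ) λ φ → Σ (All (Entry C Γ) Δ) λ ρ →
                 ∀ a → (M ⊨ φ [ values a ρ ]) ⇔ X a
    def-matrix {C} {Γ} (defn (φ ⟨ b ⟩) o h) =
      _ , φ , ++⁺ (variables allVars) (constants b (over-entries {C} b o)) , λ a → ⇔-trans
        (≡⇒⇔ (cong (M ⊨ φ [_]) (trans (map-++⁺ (value a) (variables allVars) _)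
          (cong₂ ++⁺ (trans (values-variables {C} a allVars) (rearrange-allVars a))
                     (values-constants a b (over-entries {C} b o))))))
        (h a)

    def-plug : ∀ {C Γ Γ′} {X : Tuple Γ′ → Set} → Defn C X → (ρ : All (Entry C Γ) Γ′) →
               Defn C (λ a → X (values a ρ))
    def-plug {C} {X = X} (defn (φ ⟨ b ⟩) o h) ρ =
      def-⇔ (λ a → ⇔-trans (≡⇒⇔ (cong (M ⊨ φ [_])
          (trans (map-++⁺ (value a) ρ _) (cong (++⁺ _) (values-constants a b (over-entries {C} b o))))))
        (h (values a ρ)))
      (definable φ (++⁺ ρ (constants b (over-entries {C} b o))))

    def-inst : ∀ {C Γ Δ} {X : Tuple (Γ ++ Δ) → Set} → Defn C X → (b : Tuple Δ) → entries b ⊆ C →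
               Defn C (λ (a : Tuple Γ) → X (++⁺ a b))
    def-inst {C} {Γ} {X = X} d b o = def-⇔
      (λ a → ≡⇒⇔ (cong X (trans (map-++⁺ (value a) (variables allVars) (constants b o))
        (cong₂ ++⁺ (trans (values-variables {C} a allVars) (rearrange-allVars a))
                   (values-constants a b o)))))
      (def-plug d (++⁺ (variables allVars) (constants b o)))

    def-rearrange : ∀ {C Γ Δ} {X : Tuple Δ → Set} → Defn C X → (θ : All (_∈ Γ) Δ) →
                    Defn C (λ a → X (rearrange θ a))
    def-rearrange {C} {X = X} d θ =
      def-⇔ (λ a → ≡⇒⇔ (cong X (values-variables {C} a θ))) (def-plug d (variables θ))

    -- Turns the parameters `e` into variables, so that `e` can be replaced by another tuple of the
    -- same type over `C`. Every use of invariance of a type goes through such a `Y`.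
    def-abstract : ∀ {C Γ Δ} {X : Tuple Γ → Set} (e : Tuple Δ) → Defn (C ∪ entries e) X →
                   Σ (Tuple (Γ ++ Δ) → Set) λ Y → Defn C Y × (∀ a → X a ⇔ Y (++⁺ a e))
    def-abstract {C} {Γ} {Δ} {X} e (defn (_⟨_⟩ {Θ} φ b) o h) =
      (λ a → M ⊨ φ [ values a ρ ]) , definable φ ρ , λ a → ⇔-trans (⇔-sym (h a))
        (≡⇒⇔ (cong (M ⊨ φ [_]) (sym (eq a))))
      where
      param : ∀ {s} (x : Carrier s) → (C ∪ entries e) (s , x) → Entry C (Γ ++ Δ) s
      param x (inj₁ c)       = constant x c
      param x (inj₂ (v , _)) = variable′ (∈-++⁺ʳ Γ v)
      param-value : ∀ {s} (a : Tuple Γ) (x : Carrier s) c → value (++⁺ a e) (param x c) ≡ x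
      param-value a x (inj₁ c)          = refl
      param-value a x (inj₂ (v , refl)) = lookup-++⁺ʳ a e v
      params : ∀ {Θ} (b : Tuple Θ) → entries b ⊆ C ∪ entries e → All (Entry C (Γ ++ Δ)) Θ
      params []      o = []
      params (x ∷ b) o = param x (o (here refl , refl)) ∷ params b (λ (v , q) → o (there v , q))
      params-value : ∀ {Θ} (a : Tuple Γ) (b : Tuple Θ) (o : entries b ⊆ C ∪ entries e) → values (++⁺ a e) (params b o) ≡ b
      params-value a []      o = refl
      params-value a (x ∷ b) o = cong₂ _∷_ (param-value a x (o (here refl , refl)))
                                            (params-value a b (λ (v , q) → o (there v , q)))
      vs : All (Entry C (Γ ++ Δ)) Γ
      vs = variables leftVars
      ps : All (Entry C (Γ ++ Δ)) Θ
      ps = params b (over-entries {C ∪ entries e} b o)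
      ρ : All (Entry C (Γ ++ Δ)) (Γ ++ Θ)
      ρ = ++⁺ vs ps
      eq : ∀ a → values (++⁺ a e) ρ ≡ ++⁺ a b
      eq a = trans (map-++⁺ (value (++⁺ a e)) vs ps)
        (cong₂ ++⁺ (trans (values-variables {C} (++⁺ a e) leftVars) (rearrange-leftVars a e))
                   (params-value a b (over-entries {C ∪ entries e} b o)))

    def-⊤ : ∀ {C Γ} → Defn C {Γ} (λ _ → ⊤)
    def-⊤ = defn ((⊥′ ⇒ ⊥′) ⟨ [] ⟩) (λ ()) λ _ → mk⇔ _ (λ _ → id)

    -- The two formulas have unrelated parameter lists. They are placed side by side in a doubled
    -- context, and both copies of `Γ` are then filled with the same variables.
    def-→ : ∀ {C Γ} {X Y : Tuple Γ → Set} → Defn C X → Defn C Y → Defn C (λ a → X a → Y a)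
    def-→ {C} {Γ} (defn (_⟨_⟩ {Δ₁} φ b) o h) (defn (_⟨_⟩ {Δ₂} ψ c) o′ h′) = def-⇔ (λ a → mk⇔
        (λ f x → to (h′ a) (to (right a) (f (from (left a) (from (h a) x)))))
        (λ f x → from (right a) (from (h′ a) (f (to (h a) (to (left a) x))))))
      (definable (subF wkˡ φ ⇒ subF wkʳ ψ) (++⁺ (ρ b o) (ρ c o′)))
      where
      wkˡ : Sub {L} (Γ ++ Δ₁) ((Γ ++ Δ₁) ++ (Γ ++ Δ₂))
      wkˡ v = var (∈-++⁺ˡ v)
      wkʳ : Sub {L} (Γ ++ Δ₂) ((Γ ++ Δ₁) ++ (Γ ++ Δ₂))
      wkʳ v = var (∈-++⁺ʳ (Γ ++ Δ₁) v)
      ρ : ∀ {Δ} (b : Tuple Δ) → (∀ {s} (v : s ∈ Δ) → C (s , All.lookup b v)) → All (Entry C Γ) (Γ ++ Δ)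
      ρ b o = ++⁺ (variables allVars) (constants b (over-entries {C} b o))
      eq : ∀ {Δ} a (b : Tuple Δ) (o : ∀ {s} (v : s ∈ Δ) → C (s , All.lookup b v)) →
           values a (ρ b o) ≡ ++⁺ a b
      eq a b o = trans (map-++⁺ (value a) (variables allVars) (constants b (over-entries {C} b o)))
        (cong₂ ++⁺ (trans (values-variables {C} a allVars) (rearrange-allVars a))
                   (values-constants a b (over-entries {C} b o)))
      both : ∀ a → values a (++⁺ (ρ b o) (ρ c o′)) ≡ ++⁺ (++⁺ a b) (++⁺ a c)
      both a = trans (map-++⁺ (value a) (ρ b o) (ρ c o′)) (cong₂ ++⁺ (eq a b o) (eq a c o′))
      left : ∀ a → (M ⊨ subF wkˡ φ [ values a (++⁺ (ρ b o) (ρ c o′)) ]) ⇔ (M ⊨ φ [ ++⁺ a b ])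
      left a rewrite both a = ⊨-subF M wkˡ (lookup-++⁺ˡ (++⁺ a b) (++⁺ a c)) φ
      right : ∀ a → (M ⊨ subF wkʳ ψ [ values a (++⁺ (ρ b o) (ρ c o′)) ]) ⇔ (M ⊨ ψ [ ++⁺ a c ])
      right a rewrite both a = ⊨-subF M wkʳ (lookup-++⁺ʳ (++⁺ a b) (++⁺ a c)) ψ

    def-¬ : ∀ {C Γ} {X : Tuple Γ → Set} → Defn C X → Defn C (λ a → ¬ X a)
    def-¬ (defn (φ ⟨ b ⟩) o h) = defn ((¬′ φ) ⟨ b ⟩) o λ a → mk⇔ (λ f → f ∘ from (h a)) (λ f → f ∘ to (h a))

    def-∀ : ∀ {C Γ s} {X : Tuple (s ∷ Γ) → Set} → Defn C X → Defn C (λ a → ∀ x → X (x ∷ a))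
    def-∀ {s = s} (defn (φ ⟨ b ⟩) o h) = defn (∀′ s φ ⟨ b ⟩) o λ a →
      mk⇔ (λ f x → to (h (x ∷ a)) (f x)) (λ f x → from (h (x ∷ a)) (f x))

    def-× : ∀ {C Γ} {X Y : Tuple Γ → Set} → Defn C X → Defn C Y → Defn C (λ a → X a × Y a)
    def-× dX dY = def-⇔ (λ a → mk⇔
        (λ f → dne (λ k → f λ x y → k (x , y)))
        (λ (x , y) g → g x y))
      (def-¬ (def-→ dX (def-¬ dY)))

    def-∃ : ∀ {C Γ s} {X : Tuple (s ∷ Γ) → Set} → Defn C X → Defn C (λ a → ∃[ x ] X (x ∷ a))
    def-∃ dX = def-⇔ (λ a → mk⇔
        (λ f → dne (λ k → f λ x Xx → k (x , Xx)))
        (λ (x , Xx) f → f x Xx))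
      (def-¬ (def-∀ (def-¬ dX)))

    def-All : ∀ {C Γ} {J : Set} {X : J → Tuple Γ → Set} → (∀ j → Defn C (X j)) →
              (js : List J) → Defn C (λ a → All (λ j → X j a) js)
    def-All d []       = def-⇔ (λ _ → mk⇔ (λ _ → []) _) def-⊤
    def-All d (j ∷ js) = def-⇔ (λ _ → mk⇔ (λ (x , xs) → x ∷ xs) All.uncons)
      (def-× (d j) (def-All d js))

    def-∃* : ∀ {C Γ} Δ {X : Tuple (Δ ++ Γ) → Set} → Defn C X →
             Defn C (λ a → Σ (Tuple Δ) λ b → X (++⁺ b a))
    def-∃* []      d = def-⇔ (λ a → mk⇔ (λ x → [] , x) (λ { ([] , x) → x })) d
    def-∃* (s ∷ Δ) d = def-⇔
      (λ a → mk⇔ (λ (b , x , h) → x ∷ b , h) (λ { (x ∷ b , h) → b , x , h }))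
      (def-∃* Δ (def-∃ d))

-- Pairing of numbers and enumeration of coded types

nextPair : ℕ × ℕ → ℕ × ℕ
nextPair (zero  , b) = suc b , zero
nextPair (suc a , b) = a , suc b

unpair : ℕ → ℕ × ℕ
unpair zero    = zero , zero
unpair (suc n) = nextPair (unpair n)

-- `nextPair` walks along the antidiagonals. The predecessor of (a+1, 0) is (0, a) on the previous
-- diagonal, that of (a, b+1) is (a+1, b) on the same one; hence the recursion on `d` and, within a
-- diagonal, on `b`.
pairOnDiagonal : ∀ d a b → a + b ≡ d → ∃[ n ] unpair n ≡ (a , b)
pairOnDiagonal zero    zero    zero    e = zero , refl
pairOnDiagonal (suc d) (suc a) zero    e =
  let n , h = pairOnDiagonal d zero a (trans (sym (ℕ.+-identityʳ a)) (ℕ.suc-injective e))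
  in suc n , cong nextPair h
pairOnDiagonal d       a       (suc b) e =
  let n , h = pairOnDiagonal d (suc a) b (trans (sym (ℕ.+-suc a b)) e)
  in suc n , cong nextPair h

abstract
  pair : ℕ → ℕ → ℕ
  pair a b = proj₁ (pairOnDiagonal (a + b) a b refl)

  unpair-pair : ∀ a b → unpair (pair a b) ≡ (a , b)
  unpair-pair a b = proj₂ (pairOnDiagonal (a + b) a b refl)

pair-injective : ∀ {a b c d} → pair a b ≡ pair c d → a ≡ c × b ≡ d
pair-injective {a} {b} {c} {d} e
  with refl ← trans (sym (unpair-pair a b)) (trans (cong unpair e) (unpair-pair c d)) = refl , refl

split : ℕ → ℕ ⊎ ℕ
split n with unpair n
... | zero  , m = inj₁ m
... | suc _ , m = inj₂ m

split-left : ∀ m → split (pair 0 m) ≡ inj₁ m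
split-left m rewrite unpair-pair 0 m = refl

split-right : ∀ m → split (pair 1 m) ≡ inj₂ m
split-right m rewrite unpair-pair 1 m = refl

module _ (em : ExcludedMiddle 0ℓ) {X : Set} (code : X → ℕ) where

  private
    decode : ∀ n → Dec (∃[ x ] code x ≡ n) → Maybe X
    decode n (yes (x , _)) = just x
    decode n (no _)        = nothing

  enumeration : ℕ → Maybe X
  enumeration n = decode n em

  -- The coding need not be injective, so only some `y` with the code of `x` is met. This suffices
  -- for elements up to `≈` and for formulas up to equivalence.
  enumeration-complete : ∀ x → ∃₂ λ n y → enumeration n ≡ just y × code y ≡ code x
  enumeration-complete x = code x , go em refl
    where
    go : (d : Dec (∃[ y ] code y ≡ code x)) → d ≡ em → ∃[ y ] enumeration (code x) ≡ just y × code y ≡ code x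
    go (yes (y , e)) h = y , cong (decode (code x)) (sym h) , e
    go (no h)        _ = ⊥-elim (h (x , refl))

-- Well-orders and cardinal arithmetic

module WellOrdered (em : ExcludedMiddle 0ℓ) {W : Set} {_<_ : W → W → Set}
                   (sto : IsStrictTotalOrder _≡_ _<_) (wf : WellFounded _<_) where
  open IsStrictTotalOrder sto using (compare) renaming (trans to <-trans; irrefl to <-irrefl)

  Least : (W → Set) → W → Set
  Least P w = P w × (∀ v → P v → ¬ (v < w))

  least : (P : W → Set) → ∃ P → ∃ (Least P)
  least P (w , p) = go w (wf w) p
    where
    go : ∀ w → Acc _<_ w → P w → ∃ (Least P)
    go w (acc rs) p with em {∃[ v ] P v × v < w}
    ... | yes (v , q , v<w) = go v (rs v<w) q
    ... | no h              = w , p , λ v q v<w → h (v , q , v<w)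

  least-unique : ∀ {P : W → Set} {v w} → Least P v → Least P w → v ≡ w
  least-unique {v = v} {w} (p , m) (q , n) with compare v w
  ... | tri< v<w _ _ = ⊥-elim (n v p v<w)
  ... | tri≈ _ e _   = e
  ... | tri> _ _ w<v = ⊥-elim (m w q w<v)

  Succ : W → W → Set
  Succ v = Least (v <_)

  -- Writes `w` as the n-th successor of some `ℓ` without immediate predecessor (the least element
  -- included). This cuts the well-order into blocks of type at most ω.
  data Position : W → W → ℕ → Set where
    limit     : ∀ {w} → ¬ (∃[ v ] Succ v w) → Position w w zero
    successor : ∀ {v w ℓ n} → Succ v w → Position v ℓ n → Position w ℓ (suc n)

  position : ∀ w → ∃₂ (Position w)
  position w = go w (wf w)
    where
    go : ∀ w → Acc _<_ w → ∃₂ (Position w)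
    go w (acc rs) with em {∃[ v ] Succ v w}
    ... | no h        = w , zero , limit h
    ... | yes (v , s) = let ℓ , n , q = go v (rs (proj₁ s)) in ℓ , suc n , successor s q

  position-injective : ∀ {v w ℓ n} → Position v ℓ n → Position w ℓ n → v ≡ w
  position-injective (limit _)       (limit _)         = refl
  position-injective (successor s p) (successor s′ p′)
    with refl ← position-injective p p′ = least-unique s s′

  position-limit : ∀ {w ℓ n} → Position w ℓ n → Position ℓ ℓ zero
  position-limit (limit h)       = limit h
  position-limit (successor _ p) = position-limit p

  Full : W → Set
  Full ℓ = ∀ n → ∃[ w ] Position w ℓ n

  -- The finite successors of `ℓ` exist and stay below `ℓ′`, since the step that reached `ℓ′` would
  -- give it an immediate predecessor.
  full-below-limit : ∀ {ℓ ℓ′} → Position ℓ ℓ zero → Position ℓ′ ℓ′ zero → ℓ < ℓ′ → Full ℓ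
  full-below-limit {ℓ} {ℓ′} p (limit h) ℓ<ℓ′ n = let w , q , _ = go n in w , q
    where
    go : ∀ n → ∃[ w ] Position w ℓ n × w < ℓ′
    go zero    = ℓ , p , ℓ<ℓ′
    go (suc n) with go n
    ... | w , q , w<ℓ′ with least (w <_) (ℓ′ , w<ℓ′)
    ... | v , s with compare v ℓ′
    ... | tri< v<ℓ′ _ _ = v , successor s q , v<ℓ′
    ... | tri≈ _ refl _ = ⊥-elim (h (w , s))
    ... | tri> _ _ ℓ′<v = ⊥-elim (proj₂ s ℓ′ w<ℓ′ ℓ′<v)

  -- All blocks but the last one are full, so either there is a single block or
  -- the elements (ℓ , n) of full blocks can absorb a factor ℕ.
  absorb : ((⊤ ⊎ W) × ℕ) ↣ W ⊎ ((⊤ ⊎ W) × ℕ) ↣ ℕ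
  absorb with em {∃₂ λ ℓ ℓ′ → Position ℓ ℓ zero × Position ℓ′ ℓ′ zero × ℓ ≢ ℓ′}
  ... | no h = inj₂ (mk↣ {to = code} code-injective)
    where
    num : W → ℕ
    num w = proj₁ (proj₂ (position w))
    num-injective : ∀ {v w} → num v ≡ num w → v ≡ w
    num-injective {v} {w} e with position v | position w
    ... | ℓ , n , p | ℓ′ , m , q with refl ← e with em {ℓ ≡ ℓ′}
    ... | yes refl = position-injective p q
    ... | no ne    = ⊥-elim (h (ℓ , ℓ′ , position-limit p , position-limit q , ne))
    code : (⊤ ⊎ W) × ℕ → ℕ
    code (inj₁ _ , n) = pair zero n
    code (inj₂ w , n) = pair (suc (num w)) n
    code-injective : Injective _≡_ _≡_ code
    code-injective {inj₁ _ , _} {inj₁ _ , _} e with refl ← proj₂ (pair-injective e) = refl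
    code-injective {inj₁ _ , _} {inj₂ _ , _} e with () ← proj₁ (pair-injective e)
    code-injective {inj₂ _ , _} {inj₁ _ , _} e with () ← proj₁ (pair-injective e)
    code-injective {inj₂ _ , _} {inj₂ _ , _} e
      with e₁ , refl ← pair-injective e with refl ← num-injective (ℕ.suc-injective e₁) = refl
  ... | yes (ℓ₁ , ℓ₂ , p₁ , p₂ , ℓ₁≢ℓ₂) = inj₁ (mk↣ {to = code} code-injective)
    where
    first : ∃[ ℓ ] Full ℓ
    first with compare ℓ₁ ℓ₂
    ... | tri< lt _ _ = ℓ₁ , full-below-limit p₁ p₂ lt
    ... | tri≈ _ e _  = ⊥-elim (ℓ₁≢ℓ₂ e)
    ... | tri> _ _ gt = ℓ₂ , full-below-limit p₂ p₁ gt

    -- Only the last block can fail to be full. Its elements may therefore be sent to the block of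
    -- `proj₁ first` without recording where they came from; the tags 0, 1, 2 in `Code` keep the
    -- three kinds of elements apart.
    nonfull-unique : ∀ {ℓ ℓ′} → Position ℓ ℓ zero → Position ℓ′ ℓ′ zero → ¬ Full ℓ → ¬ Full ℓ′ → ℓ ≡ ℓ′
    nonfull-unique {ℓ} {ℓ′} p q h h′ with compare ℓ ℓ′
    ... | tri< lt _ _ = ⊥-elim (h (full-below-limit p q lt))
    ... | tri≈ _ e _  = e
    ... | tri> _ _ gt = ⊥-elim (h′ (full-below-limit q p gt))

    -- Code x ℓ m: x is sent to the m-th element of the block of ℓ
    data Code : (⊤ ⊎ W) × ℕ → W → ℕ → Set where
      extra   : ∀ {n} → Code (inj₁ tt , n) (proj₁ first) (pair 0 n)
      full    : ∀ {w ℓ k n} → Position w ℓ k → Full ℓ → Code (inj₂ w , n) ℓ (pair 1 (pair k n))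
      nonfull : ∀ {w ℓ k n} → Position w ℓ k → ¬ Full ℓ →
                Code (inj₂ w , n) (proj₁ first) (pair 2 (pair k n))

    chooseCode : ∀ x → ∃[ w ] ∃₂ λ ℓ m → Code x ℓ m × Position w ℓ m
    chooseCode (inj₁ tt , n) = let w , p = proj₂ first _ in w , _ , _ , extra , p
    chooseCode (inj₂ v , n) with position v
    ... | ℓ , k , q with em {Full ℓ}
    ... | yes f = let w , p = f _ in w , _ , _ , full q f , p
    ... | no f  = let w , p = proj₂ first _ in w , _ , _ , nonfull q f , p

    code-unique : ∀ {x y ℓ m} → Code x ℓ m → ∀ {ℓ′ m′} → Code y ℓ′ m′ → ℓ ≡ ℓ′ → m ≡ m′ → x ≡ y
    code-unique extra extra _ e = cong (inj₁ tt ,_) (proj₂ (pair-injective e))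
    code-unique extra (full _ _) _ e with () ← proj₁ (pair-injective e)
    code-unique extra (nonfull _ _) _ e with () ← proj₁ (pair-injective e)
    code-unique (full _ _) extra _ e with () ← proj₁ (pair-injective e)
    code-unique (full p _) (full q _) refl e
      with refl , refl ← pair-injective (proj₂ (pair-injective e))
      with refl ← position-injective p q = refl
    code-unique (full _ _) (nonfull _ _) _ e with () ← proj₁ (pair-injective e)
    code-unique (nonfull _ _) extra _ e with () ← proj₁ (pair-injective e)
    code-unique (nonfull _ _) (full _ _) _ e with () ← proj₁ (pair-injective e)
    code-unique (nonfull p f) (nonfull q g) _ e
      with refl , refl ← pair-injective (proj₂ (pair-injective e))
      with refl ← nonfull-unique (position-limit p) (position-limit q) f g
      with refl ← position-injective p q = refl

    pred-unique : ∀ {v v′ w} → Succ v w → Succ v′ w → v ≡ v′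
    pred-unique {v} {v′} s s′ with compare v v′
    ... | tri< lt _ _ = ⊥-elim (proj₂ s v′ lt (proj₁ s′))
    ... | tri≈ _ e _  = e
    ... | tri> _ _ gt = ⊥-elim (proj₂ s′ v gt (proj₁ s))

    position-unique : ∀ {w ℓ ℓ′ m m′} → Position w ℓ m → Position w ℓ′ m′ → ℓ ≡ ℓ′ × m ≡ m′
    position-unique (limit _) (limit _) = refl , refl
    position-unique (limit h) (successor s _) = ⊥-elim (h (_ , s))
    position-unique (successor s _) (limit h) = ⊥-elim (h (_ , s))
    position-unique (successor {v} s p) (successor {v′} s′ p′)
      with refl ← pred-unique s s′ with refl , refl ← position-unique p p′ = refl , refl

    code : (⊤ ⊎ W) × ℕ → W
    code x = proj₁ (chooseCode x)
    code-injective : Injective _≡_ _≡_ code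
    code-injective {x} {y} e with chooseCode x | chooseCode y
    ... | w , ℓ , m , c , p | w′ , ℓ′ , m′ , c′ , p′ with refl ← e =
      let e₁ , e₂ = position-unique p p′ in code-unique c c′ e₁ e₂

WellOrdering : Set₁
WellOrdering = (X : Set) → Σ (X → X → Set) λ _<_ → IsStrictTotalOrder _≡_ _<_ × WellFounded _<_

-- Small sets are handled as sets covered up to ≈ by (⊤ ⊎ P) × ℕ with P tiny; these absorb
-- countable sets, and by `absorb` they are small.
Tiny : Set → Set → Set
Tiny κ P = (P ↣ κ) × ¬ (κ ↣ P)

tiny-⊥ : ∀ {κ} → ≡.setoid ℕ ≺ ≡.setoid κ → Tiny κ ⊥
tiny-⊥ (ℕ≼κ , _) = mk↣ {to = λ ()} (λ {}) , λ g → Injection.to g (Injection.to ℕ≼κ 0)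

-- Small and countable sets, saturation for tuples

module Covers (em : ExcludedMiddle 0ℓ) (wellOrdering : WellOrdering)
              {L : Language} (M : Structure L) where
  open Structure M
  open Definability em M
  private module E = Setoid (elemSetoid setoid)

  -- A partial enumeration that may repeat, may leave `C`, and meets elements of `C` only up to `≈`.
  -- Covers are closed under unions and subsets with no choice of injections; `cover-≼` returns to
  -- cardinalities.
  record Cover (J : Set) (C : Subset M) : Set where
    field
      enum   : J → Maybe Elem
      covers : ∀ {x} → C x → ∃₂ λ j y → enum j ≡ just y × x E.≈ y

  open Cover

  -- The set of codes of an element depends only on its `≈`-class. Taking the least code in a
  -- well-order of `W` therefore gives a map that respects `≈` in both directions.
  cover-≼ : ∀ {J W C} → Cover J C → J ↣ W → subsetSetoid M C ≼ ≡.setoid W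
  cover-≼ {J} {W} {C} cov g = record
    { to        = λ (x , c) → proj₁ (code x c)
    ; cong      = λ {(x , c)} {(y , d)} x≈y →
        least-unique (resp x≈y (proj₂ (code x c))) (proj₂ (code y d))
    ; injective = λ {(x , c)} {(y , d)} e → inj e (proj₂ (code x c)) (proj₂ (code y d))
    }
    where
    open WellOrdered em (proj₁ (proj₂ (wellOrdering W))) (proj₂ (proj₂ (wellOrdering W)))
    Codes : Elem → W → Set
    Codes x w = ∃₂ λ j y → Injection.to g j ≡ w × enum cov j ≡ just y × x E.≈ y
    code : ∀ x → C x → ∃ (Least (Codes x))
    code x c = let j , y , e , x≈y = covers cov c in least (Codes x) (_ , j , y , refl , e , x≈y)
    codes-resp : ∀ {x y w} → x E.≈ y → Codes x w → Codes y w
    codes-resp x≈y (j , z , e , e′ , x≈z) = j , z , e , e′ , E.trans (E.sym x≈y) x≈z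
    resp : ∀ {x y w} → x E.≈ y → Least (Codes x) w → Least (Codes y) w
    resp x≈y (p , m) = codes-resp x≈y p , λ v q → m v (codes-resp (E.sym x≈y) q)
    inj : ∀ {x y v w} → v ≡ w → Least (Codes x) v → Least (Codes y) w → x E.≈ y
    inj refl ((j , z , e , f , x≈z) , _) ((j′ , z′ , e′ , f′ , y≈z′) , _)
      with refl ← Injection.injective g (trans e (sym e′))
      with refl ← just-injective (trans (sym f) f′) = E.trans x≈z (E.sym y≈z′)

  module _ {W C} (i : subsetSetoid M C ≼ ≡.setoid W) where

    -- `True` of a decision has at most one proof, which makes the projection to `W` injective while
    -- a preimage can still be read off.
    Image : Set
    Image = Σ W λ w → True (em {∃[ x ] Injection.to i x ≡ w})

    ≼-cover : Cover Image C
    ≼-cover = record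
      { enum   = λ (w , h) → just (proj₁ (proj₁ (toWitness h)))
      ; covers = λ {x} c →
          let h = fromWitness {a? = em {∃[ y ] Injection.to i y ≡ Injection.to i (x , c)}} ((x , c) , refl)
          in (Injection.to i (x , c) , h) , _ , refl ,
             E.sym (Injection.injective i (proj₂ (toWitness h)))
      }

    image-↣ : Image ↣ W
    image-↣ = mk↣ {to = proj₁} λ { {w , h} {w , h′} refl → cong (w ,_) (T-irrelevant h h′) }

    image-tiny : ¬ (≡.setoid W ≼ subsetSetoid M C) → Tiny W Image
    image-tiny h = image-↣ , λ g → h (record
      { to        = λ w → proj₁ (toWitness (proj₂ (Injection.to g w)))
      ; cong      = λ { refl → E.refl }
      ; injective = λ {v} {w} e → Injection.injective g (Injection.injective image-↣
          (trans (sym (proj₂ (toWitness (proj₂ (Injection.to g v)))))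
            (trans (Injection.cong i e) (proj₂ (toWitness (proj₂ (Injection.to g w)))))))
      })

  cover-⊆ : ∀ {J C D} → C ⊆ D → Cover J D → Cover J C
  cover-⊆ i cov = record { enum = enum cov ; covers = covers cov ∘ i }

  countable-cover : ∀ {C} → Countable M C → Cover ℕ C
  countable-cover i = record
    { enum   = λ n → Maybe.map proj₁ (enumeration em (Injection.to i) n)
    ; covers = λ {x} c →
        let n , y , e , h = enumeration-complete em (Injection.to i) (x , c)
        in n , proj₁ y , cong (Maybe.map proj₁) e , E.sym (Injection.injective i h) }

  cover-reindex : ∀ {I J C} (r : I → J) → (∀ j → ∃[ i ] r i ≡ j) → Cover J C → Cover I C
  cover-reindex r surj cov = record
    { enum   = enum cov ∘ r
    ; covers = λ c → let j , y , e , h = covers cov c ; i , q = surj j in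
        i , y , trans (cong (enum cov) q) e , h }

  cover-countable : ∀ {C} → Cover ℕ C → Countable M C
  cover-countable cov = cover-≼ cov (mk↣ {to = id} id)

  Ix : Set → Set
  Ix P = (⊤ ⊎ P) × ℕ

  -- By `absorb`, `Ix P` embeds into `P` or into `ℕ`. An embedding of `κ` into `C` would thus embed
  -- `κ` into one of these two, against the assumptions on them.
  tiny-small : ∀ {κ P C} → ≡.setoid ℕ ≺ ≡.setoid κ → Tiny κ P → Cover (Ix P) C → Small κ M C
  tiny-small {κ} {P} {C} (ℕ≼κ , κ⋠ℕ) (P↣κ , κ⋠P) cov with absorb
    where open WellOrdered em (proj₁ (proj₂ (wellOrdering P))) (proj₂ (proj₂ (wellOrdering P)))
  ... | inj₁ g = Compose.injection (cover-≼ cov g) P↣κ ,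
                 λ h → κ⋠P (Compose.injection h (cover-≼ cov g))
  ... | inj₂ g = Compose.injection (cover-≼ cov g) ℕ≼κ ,
                 λ h → κ⋠ℕ (Compose.injection h (cover-≼ cov g))

  cover-Ix : ∀ {P C} → Cover ℕ C → Cover (Ix P) C
  cover-Ix cov = record
    { enum   = enum cov ∘ proj₂
    ; covers = λ c → let n , h = covers cov c in (inj₁ tt , n) , h }

  cover-Ixʳ : ∀ {P C} → Cover P C → Cover (Ix P) C
  cover-Ixʳ cov = record
    { enum   = λ { (inj₁ _ , _) → nothing ; (inj₂ p , _) → enum cov p }
    ; covers = λ c → let p , h = covers cov c in (inj₂ p , 0) , h }

  countable-small : ∀ {κ C} → ≡.setoid ℕ ≺ ≡.setoid κ → Cover ℕ C → Small κ M C
  countable-small {κ} h cov = tiny-small h (tiny-⊥ h) (cover-Ix cov)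

  cover-∪ : ∀ {C D} → Cover ℕ C → Cover ℕ D → Cover ℕ (C ∪ D)
  cover-∪ {C} {D} c d = record { enum = λ n → pick (split n) ; covers = λ where
      (inj₁ x) → let n , h = covers c x in
        pair 0 n , subst (λ k → ∃ λ y → pick k ≡ just y × _ E.≈ y) (sym (split-left n)) h
      (inj₂ x) → let n , h = covers d x in
        pair 1 n , subst (λ k → ∃ λ y → pick k ≡ just y × _ E.≈ y) (sym (split-right n)) h }
    where
    pick : ℕ ⊎ ℕ → Maybe Elem
    pick (inj₁ n) = enum c n
    pick (inj₂ n) = enum d n

  cover-∪-Ix : ∀ {P C D} → Cover (Ix P) C → Cover ℕ D → Cover (Ix P) (C ∪ D)
  cover-∪-Ix {P} {C} {D} c d = record { enum = λ (j , n) → pick j (split n) ; covers = λ where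
      (inj₁ x) → let (j , n) , h = covers c x in
        (j , pair 0 n) , subst (λ k → ∃ λ y → pick j k ≡ just y × _ E.≈ y) (sym (split-left n)) h
      (inj₂ x) → let n , h = covers d x in
        (inj₁ tt , pair 1 n) ,
        subst (λ k → ∃ λ y → pick (inj₁ tt) k ≡ just y × _ E.≈ y) (sym (split-right n)) h }
    where
    pick : ⊤ ⊎ P → ℕ ⊎ ℕ → Maybe Elem
    pick j (inj₁ n) = enum c (j , n)
    pick j (inj₂ n) = enum d n

  cover-⋃ : {C : ℕ → Subset M} → (∀ n → Cover ℕ (C n)) → Cover ℕ (λ x → ∃[ n ] C n x)
  cover-⋃ c = record
    { enum   = λ k → let n , m = unpair k in enum (c n) m
    ; covers = λ (n , x) → let m , y , e , x≈y = covers (c n) x in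
        pair n m , y , trans (cong (λ k → enum (c (proj₁ k)) (proj₂ k)) (unpair-pair n m)) e , x≈y }

  cover-family : ∀ {J : Set} (x : J → Elem) → Cover J (λ y → ∃[ j ] y ≡ x j)
  cover-family x = record { enum = just ∘ x ; covers = λ { (j , refl) → j , x j , refl , E.refl } }

  cover-subsingleton : ∀ {J : Set} (x : J → Elem) → (∀ i j → x i ≡ x j) → Cover ℕ (λ y → ∃[ j ] y ≡ x j)
  cover-subsingleton {J} x h = record
    { enum   = λ _ → pick em
    ; covers = λ { (j , refl) → 0 , x j , go j em , E.refl } }
    where
    pick : Dec J → Maybe Elem
    pick (yes j) = just (x j)
    pick (no _)  = nothing
    go : ∀ j d → pick d ≡ just (x j)
    go j (yes i) = cong just (h i j)
    go j (no h)  = ⊥-elim (h j)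

  nth : ∀ {Γ} → Tuple Γ → ℕ → Maybe Elem
  nth []      n       = nothing
  nth (x ∷ a) zero    = just (_ , x)
  nth (x ∷ a) (suc n) = nth a n

  nth-lookup : ∀ {Γ} (a : Tuple Γ) {s} (v : s ∈ Γ) → ∃[ n ] nth a n ≡ just (s , All.lookup a v)
  nth-lookup (x ∷ a) (here refl) = zero , refl
  nth-lookup (x ∷ a) (there v)   = let n , h = nth-lookup a v in suc n , h

  cover-entries : ∀ {Γ} (a : Tuple Γ) → Cover ℕ (entries a)
  cover-entries a = record { enum = nth a ; covers = λ { (v , refl) →
    let n , h = nth-lookup a v in n , _ , h , E.refl } }

  Listed : ∀ {J} → (J → Maybe Elem) → Subset M
  Listed e x = ∃[ j ] e j ≡ just x

  -- Definability over C only depends on the ≈-classes met by C.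
  def-listed : ∀ {J C Γ} {X : Tuple Γ → Set} (cov : Cover J C) → Defn C X → Defn (Listed (enum cov)) X
  def-listed {J} {C} {Γ} {X} cov (defn (φ ⟨ b ⟩) o h) =
    let b′ , b≈b′ , o′ = replace b (over-entries {C} b o) in
    defn (φ ⟨ b′ ⟩) (λ v → o′ (v , refl)) λ a → ⇔-trans
      (mk⇔ (⊨-resp M φ (++⁺-cong M (≈*-refl M) (≈*-sym M b≈b′)))
           (⊨-resp M φ (++⁺-cong M (≈*-refl M) b≈b′))) (h a)
    where
    replace : ∀ {Δ} (b : Tuple Δ) → entries b ⊆ C →
              Σ (Tuple Δ) λ b′ → b ≈* b′ × entries b′ ⊆ Listed (enum cov)
    replace []      o = [] , [] , λ { (() , _) }
    replace (x ∷ b) o with covers cov (o (here refl , refl))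
                         | replace b (λ (v , e) → o (there v , e))
    ... | j , (s , y) , e , elemEq x≈y | b′ , b≈b′ , o′ =
      y ∷ b′ , x≈y ∷ b≈b′ , λ { (here refl , refl) → j , e ; (there v , q) → o′ (v , q) }

  SatAt : Subset M → Set₁
  SatAt C = ∀ Γ {J : Set} (X : J → Tuple Γ → Set) → (∀ j → Defn C (X j)) →
            (∀ js → ∃[ a ] All (λ j → X j a) js) → ∃[ a ] ∀ j → X j a

  UnarySatAt : Subset M → Set₁
  UnarySatAt C = ∀ s {J : Set} (X : J → Tuple (s ∷ []) → Set) → (∀ j → Defn C (X j)) →
                 (∀ js → ∃[ a ] All (λ j → X j a) js) → ∃[ a ] ∀ j → X j a

  saturated-unary : ∀ {κ C} → Saturated κ M → Small κ M C → UnarySatAt C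
  saturated-unary {κ} {C} sat small s {J} X d fip =
    let a , h = sat C small s (λ φ → ∃[ j ] φ ≡ formula j)
          (λ { _ (j , refl) → Defn.over (d j) })
          (λ φs hs → let js , e = indices hs ; a , h = fip js in a , transfer e h)
    in a , λ j → to (Defn.correct (d j) a) (h (formula j) (j , refl))
    where
    formula : J → ParamFormula M (s ∷ [])
    formula j = Defn.formula (d j)
    indices : ∀ {φs} → All (λ φ → ∃[ j ] φ ≡ formula j) φs → ∃[ js ] φs ≡ map formula js
    indices []                  = [] , refl
    indices ((j , refl) ∷ hs) = let js , e = indices hs in j ∷ js , cong (_ ∷_) e
    transfer : ∀ {φs js a} → φs ≡ map formula js → All (λ j → X j a) js → All (a ⊩_) φs
    transfer {js = js} {a} refl h = map⁺ (All.map (λ {j} → from (Defn.correct (d j) a)) h)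

  -- The tail `b` is chosen so that every finite part of the family can be completed by some head;
  -- then the head is realized over `C ∪ entries b`. Since the base grows, unary saturation is
  -- assumed for all bases with a cover by `Ix P`.
  saturated-tuples : ∀ {P} → (∀ {C} → Cover (Ix P) C → UnarySatAt C) →
                     ∀ {C} → Cover (Ix P) C → SatAt C
  saturated-tuples sat cov [] X d fip = [] , λ j → go j (fip (j ∷ []))
    where
    go : ∀ j → ∃[ a ] All (λ j → X j a) (j ∷ []) → X j []
    go j ([] , x ∷ []) = x
  saturated-tuples sat {C} cov (s ∷ Γ) {J} X d fip =
    let b , hb = saturated-tuples sat cov Γ {List J}
          (λ js b → ∃[ x ] All (λ j → X j (x ∷ b)) js)
          (λ js → def-∃ (def-All d js))
          (λ jss → go jss (fip (concat jss)))
        a , ha = sat (cover-∪-Ix cov (cover-entries b)) s (λ j a → X j (++⁺ a b))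
          (λ j → def-inst (def-⊆ inj₁ (d j)) b inj₂)
          (λ js → let x , h = hb js in x ∷ [] , h)
    in ++⁺ a b , ha
    where
    go : ∀ jss → ∃[ a ] All (λ j → X j a) (concat jss) →
         ∃[ b ] All (λ js → ∃[ x ] All (λ j → X j (x ∷ b)) js) jss
    go jss (x ∷ b , h) = b , All.map (x ,_) (concat⁻ {xss = jss} h)

-- Countability of formulas

data Tree : Set where
  leaf : ℕ → Tree
  node : Tree → Tree → Tree

encode : Tree → ℕ
encode (leaf n)   = pair 0 n
encode (node s t) = pair 1 (pair (encode s) (encode t))

encode-injective : ∀ {s t} → encode s ≡ encode t → s ≡ t
encode-injective {leaf _} {leaf _} e = cong leaf (proj₂ (pair-injective e))
encode-injective {leaf _} {node _ _} e with () ← proj₁ (pair-injective e)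
encode-injective {node _ _} {leaf _} e with () ← proj₁ (pair-injective e)
encode-injective {node _ _} {node _ _} e =
  let e₁ , e₂ = pair-injective (proj₂ (pair-injective e))
  in cong₂ node (encode-injective e₁) (encode-injective e₂)

module FormulaCodes {L : Language} (countable : CountableLanguage L) where
  open Language L using (Func; Rel)

  private
    sortCode : Sort L ↣ ℕ
    sortCode = proj₁ countable
    funcCode : ∃₂ Func ↣ ℕ
    funcCode = proj₁ (proj₂ countable)
    relCode : ∃ Rel ↣ ℕ
    relCode = proj₂ (proj₂ countable)

  -- Coding is a relation, so that two derivations with the same code can be matched against each
  -- other. The match also unifies the sorts and argument lists hidden in terms, whence uniqueness
  -- for pairs of a sort and a term.
  data CodesV : ∀ {Γ : List (Sort L)} {s} → s ∈ Γ → ℕ → Set where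
    here  : ∀ {Γ s} → CodesV {s ∷ Γ} (here refl) zero
    there : ∀ {Γ s t n} {v : s ∈ Γ} → CodesV v n → CodesV {t ∷ Γ} (there v) (suc n)

  data CodesT {Γ : List (Sort L)} : ∀ {s} → Term L Γ s → Tree → Set
  data CodesT* {Γ : List (Sort L)} : ∀ {Δ} → All (Term L Γ) Δ → Tree → Set

  data CodesT {Γ} where
    var : ∀ {s n} {v : s ∈ Γ} → CodesV v n → CodesT (var v) (leaf n)
    app : ∀ {Δ s n c} {f : Func Δ s} {ts : All (Term L Γ) Δ} →
          Injection.to funcCode (Δ , s , f) ≡ n → CodesT* ts c → CodesT (app f ts) (node (leaf n) c)

  data CodesT* {Γ} where
    []  : CodesT* [] (leaf 0)
    _∷_ : ∀ {s Δ c d} {t : Term L Γ s} {ts : All (Term L Γ) Δ} →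
          CodesT t c → CodesT* ts d → CodesT* (t ∷ ts) (node c d)

  data CodesF : ∀ {Γ} → Formula L Γ → Tree → Set where
    eq  : ∀ {Γ s c d} {t u : Term L Γ s} → CodesT t c → CodesT u d →
          CodesF (t ≐ u) (node (leaf 0) (node c d))
    rel : ∀ {Γ Δ n c} {r : Rel Δ} {ts : All (Term L Γ) Δ} →
          Injection.to relCode (Δ , r) ≡ n → CodesT* ts c → CodesF (rel r ts) (node (leaf 1) (node (leaf n) c))
    bot : ∀ {Γ} → CodesF {Γ} ⊥′ (leaf 0)
    imp : ∀ {Γ c d} {φ ψ : Formula L Γ} → CodesF φ c → CodesF ψ d →
          CodesF (φ ⇒ ψ) (node (leaf 2) (node c d))
    all : ∀ {Γ s n c} {φ : Formula L (s ∷ Γ)} → Injection.to sortCode s ≡ n → CodesF φ c →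
          CodesF (∀′ s φ) (node (leaf 3) (node (leaf n) c))

  codeV : ∀ {Γ s} (v : s ∈ Γ) → ∃ (CodesV v)
  codeV (here refl) = _ , here
  codeV (there v)   = _ , there (proj₂ (codeV v))

  codeT  : ∀ {Γ s} (t : Term L Γ s) → ∃ (CodesT t)
  codeT* : ∀ {Γ Δ} (ts : All (Term L Γ) Δ) → ∃ (CodesT* ts)
  codeT (var v)    = _ , var (proj₂ (codeV v))
  codeT (app f ts) = _ , app refl (proj₂ (codeT* ts))
  codeT* []        = _ , []
  codeT* (t ∷ ts)  = _ , proj₂ (codeT t) ∷ proj₂ (codeT* ts)

  codeF : ∀ {Γ} (φ : Formula L Γ) → ∃ (CodesF φ)
  codeF (t ≐ u)    = _ , eq (proj₂ (codeT t)) (proj₂ (codeT u))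
  codeF (rel r ts) = _ , rel refl (proj₂ (codeT* ts))
  codeF ⊥′         = _ , bot
  codeF (φ ⇒ ψ)    = _ , imp (proj₂ (codeF φ)) (proj₂ (codeF ψ))
  codeF (∀′ s φ)   = _ , all refl (proj₂ (codeF φ))

  uniqueV : ∀ {Γ : List (Sort L)} {s t n} {v : s ∈ Γ} {w : t ∈ Γ} → CodesV v n → CodesV w n →
            _≡_ {A = Σ (Sort L) (_∈ Γ)} (s , v) (t , w)
  uniqueV here      here      = refl
  uniqueV (there p) (there q) = thereΣ (uniqueV p q)
    where
    thereΣ : ∀ {Γ : List (Sort L)} {s t u} {v : s ∈ Γ} {w : t ∈ Γ} →
             _≡_ {A = Σ (Sort L) (_∈ Γ)} (s , v) (t , w) →
             _≡_ {A = Σ (Sort L) (_∈ (u ∷ Γ))} (s , there v) (t , there w)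
    thereΣ refl = refl

  uniqueT  : ∀ {Γ s s′ c} {t : Term L Γ s} {t′ : Term L Γ s′} → CodesT t c → CodesT t′ c →
             _≡_ {A = Σ (Sort L) (Term L Γ)} (s , t) (s′ , t′)
  uniqueT* : ∀ {Γ Δ c} {ts us : All (Term L Γ) Δ} → CodesT* ts c → CodesT* us c → ts ≡ us
  uniqueT (var p) (var q) with refl ← uniqueV p q = refl
  uniqueT (app e p) (app e′ q)
    with refl ← Injection.injective funcCode (trans e (sym e′))
    with refl ← uniqueT* p q = refl
  uniqueT* []       []       = refl
  uniqueT* (p ∷ ps) (q ∷ qs) with refl ← uniqueT p q with refl ← uniqueT* ps qs = refl

  uniqueF : ∀ {Γ c} {φ ψ : Formula L Γ} → CodesF φ c → CodesF ψ c → φ ≡ ψ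
  uniqueF (eq p q) (eq p′ q′) with refl ← uniqueT p p′ with refl ← uniqueT q q′ = refl
  uniqueF (rel e p) (rel e′ q)
    with refl ← Injection.injective relCode (trans e (sym e′)) with refl ← uniqueT* p q = refl
  uniqueF bot bot = refl
  uniqueF (imp p q) (imp p′ q′) = cong₂ _⇒_ (uniqueF p p′) (uniqueF q q′)
  uniqueF (all e p) (all e′ q)
    with refl ← Injection.injective sortCode (trans e (sym e′)) with refl ← uniqueF p q = refl

  module _ (M : Structure L) (e : ℕ → Maybe (Structure.Elem M)) where
    open Structure M

    data CodesP : ∀ {Δ} → Tuple Δ → Tree → Set where
      []  : CodesP [] (leaf 0)
      _∷_ : ∀ {s Δ n c} {x : Carrier s} {b : Tuple Δ} →
            e n ≡ just (s , x) → CodesP b c → CodesP (x ∷ b) (node (leaf n) c)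

    codeP : ∀ {Δ} (b : Tuple Δ) → (∀ {s} (v : s ∈ Δ) → ∃[ n ] e n ≡ just (s , All.lookup b v)) →
            ∃ (CodesP b)
    codeP []      o = _ , []
    codeP (x ∷ b) o = _ , proj₂ (o (here refl)) ∷ proj₂ (codeP b (o ∘ there))

    uniqueP : ∀ {Δ Θ c} {a : Tuple Δ} {b : Tuple Θ} → CodesP a c → CodesP b c →
              _≡_ {A = Σ _ Tuple} (Δ , a) (Θ , b)
    uniqueP []       []       = refl
    uniqueP (p ∷ ps) (q ∷ qs)
      with refl ← just-injective (trans (sym p) q) with refl ← uniqueP ps qs = refl

    paramFormulaCode : ∀ {Γ} (φ : ParamFormula M Γ) → Over (λ x → ∃[ n ] e n ≡ just x) φ → ℕ
    paramFormulaCode (φ ⟨ b ⟩) o = pair (encode (proj₁ (codeF φ))) (encode (proj₁ (codeP b o)))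

    paramFormulaCode-injective : ∀ {Γ} (φ ψ : ParamFormula M Γ)
      (o : Over (λ x → ∃[ n ] e n ≡ just x) φ) (o′ : Over (λ x → ∃[ n ] e n ≡ just x) ψ) →
      paramFormulaCode φ o ≡ paramFormulaCode ψ o′ → φ ≡ ψ
    paramFormulaCode-injective (φ ⟨ b ⟩) (ψ ⟨ c ⟩) o o′ h
      with e₁ , e₂ ← pair-injective h
      with refl ← uniqueP (proj₂ (codeP b o))
                    (subst (CodesP c) (sym (encode-injective e₂)) (proj₂ (codeP c o′)))
      with refl ← uniqueF (proj₂ (codeF φ))
                    (subst (CodesF ψ) (sym (encode-injective e₁)) (proj₂ (codeF ψ))) = refl

-- Formulas of M^eq as formulas about representatives

module Translation {L : Language} (M : Structure L) where
  open Structure M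
  module N = Structure (M ^eq)
  private K = L^eq M

  flat₁ : EqSort M → List (Sort L)
  flat₁ (home s)   = s ∷ []
  flat₁ (imag Γ _) = Γ

  flat : List (EqSort M) → List (Sort L)
  flat []      = []
  flat (s ∷ Γ) = flat₁ s ++ flat Γ

  flatten₁ : ∀ s → N.Carrier s → Tuple (flat₁ s)
  flatten₁ (home s)   x = x ∷ []
  flatten₁ (imag Γ _) a = a

  flatten : ∀ {Γ} → N.Tuple Γ → Tuple (flat Γ)
  flatten []              = []
  flatten (_∷_ {x = s} x a) = ++⁺ (flatten₁ s x) (flatten a)

  unflatten₁ : ∀ s → Tuple (flat₁ s) → N.Carrier s
  unflatten₁ (home s)   (x ∷ []) = x
  unflatten₁ (imag Γ _) a        = a

  flatten₁-unflatten₁ : ∀ s a → flatten₁ s (unflatten₁ s a) ≡ a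
  flatten₁-unflatten₁ (home s)   (x ∷ []) = refl
  flatten₁-unflatten₁ (imag Γ _) a        = refl

  flatten-surjective : ∀ Γ (a : Tuple (flat Γ)) → ∃[ b ] flatten {Γ} b ≡ a
  flatten-surjective []      [] = [] , refl
  flatten-surjective (s ∷ Γ) a  with c , d , refl ← ++⁺-surjective (flat₁ s) a
                                with b , refl ← flatten-surjective Γ d =
    unflatten₁ s c ∷ b , cong (λ c → ++⁺ c (flatten b)) (flatten₁-unflatten₁ s c)

  varT : ∀ {Γ s} → s ∈ Γ → All (_∈ flat Γ) (flat₁ s)
  varT (here {x = s} refl) = All.tabulate ∈-++⁺ˡ
  varT (there {x = s} v)   = All.map (∈-++⁺ʳ (flat₁ s)) (varT v)

  -- A class is handled through its representative, so the function `cls` becomes the identity on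
  -- tuples. Only equality in an imaginary sort brings in the formula of the equivalence relation.
  trT  : ∀ {Γ s} → Term K Γ s → All (Term L (flat Γ)) (flat₁ s)
  trT* : ∀ {Γ} Δ → All (Term K Γ) (map home Δ) → All (Term L (flat Γ)) Δ
  trT (var v)                = All.map var (varT v)
  trT (app (old {Δ} f) ts)   = app f (trT* Δ ts) ∷ []
  trT (app (cls {Γ} E) ts)   = trT* Γ ts
  trT* []      []       = []
  trT* (s ∷ Δ) (t ∷ ts) = All.head (trT t) ∷ trT* Δ ts

  ∀* : ∀ {Γ} Δ → Formula L (Δ ++ Γ) → Formula L Γ
  ∀* []      φ = φ
  ∀* (s ∷ Δ) φ = ∀* Δ (∀′ s φ)

  trF : ∀ {Γ} → Formula K Γ → Formula L (flat Γ)
  trF (_≐_ {home s} t u)   = All.head (trT t) ≐ All.head (trT u)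
  trF (_≐_ {imag Γ E} t u) =
    subF (All.lookup (++⁺ (trT t) (trT u))) (DefinableEquivalence.formula E)
  trF (rel (old {Δ} r) ts) = rel r (trT* Δ ts)
  trF ⊥′                   = ⊥′
  trF (φ ⇒ ψ)              = trF φ ⇒ trF ψ
  trF (∀′ s φ)             = ∀* (flat₁ s) (trF φ)

  private
    _[_]* : ∀ {Γ Δ} → All (Term L Γ) Δ → Tuple Γ → Tuple Δ
    ts [ a ]* = ⟦_⟧* M ts a

    map-tabulate : ∀ {S : Set} {P Q : S → Set} {Γ} (g : ∀ {s} → P s → Q s) (f : ∀ {s} → s ∈ Γ → P s) →
                   All.map {P = P} {Q = Q} g (All.tabulate {xs = Γ} f) ≡ All.tabulate (λ v → g (f v))
    map-tabulate {Γ = []}    g f = refl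
    map-tabulate {Γ = s ∷ Γ} g f = cong (_ ∷_) (map-tabulate g (f ∘ there))

    ⟦var⟧* : ∀ {Γ Δ} (vs : All (_∈ Γ) Δ) (a : Tuple Γ) →
             All.map {Q = Term L Γ} var vs [ a ]* ≡ All.map (All.lookup a) vs
    ⟦var⟧* []       a = refl
    ⟦var⟧* (v ∷ vs) a = cong (_ ∷_) (⟦var⟧* vs a)

    tabulate-lookup : ∀ {Γ} (a : Tuple Γ) → All.tabulate (λ v → All.lookup a v) ≡ a
    tabulate-lookup []      = refl
    tabulate-lookup (x ∷ a) = cong (x ∷_) (tabulate-lookup a)

    tabulate-cong : ∀ {Γ} {f g : ∀ {s} → s ∈ Γ → Carrier s} → (∀ {s} (v : s ∈ Γ) → f v ≡ g v) →
                    All.tabulate (λ v → f v) ≡ All.tabulate (λ v → g v)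
    tabulate-cong {[]}    h = refl
    tabulate-cong {s ∷ Γ} h = cong₂ _∷_ (h (here refl)) (tabulate-cong (h ∘ there))

    ⟦⟧*-++⁺ : ∀ {Γ Δ Θ} (ts : All (Term L Γ) Δ) (us : All (Term L Γ) Θ) a →
              ++⁺ ts us [ a ]* ≡ ++⁺ (ts [ a ]*) (us [ a ]*)
    ⟦⟧*-++⁺ []       us a = refl
    ⟦⟧*-++⁺ (t ∷ ts) us a = cong (_ ∷_) (⟦⟧*-++⁺ ts us a)

    ⟦lookup⟧ : ∀ {Γ Δ} (ts : All (Term L Γ) Δ) a {s} (v : s ∈ Δ) →
               ⟦_⟧ M (All.lookup ts v) a ≡ All.lookup (ts [ a ]*) v
    ⟦lookup⟧ (t ∷ ts) a (here refl) = refl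
    ⟦lookup⟧ (t ∷ ts) a (there v)   = ⟦lookup⟧ ts a v

    ⟦head⟧ : ∀ {Γ Δ s} (ts : All (Term L Γ) (s ∷ Δ)) a → ⟦_⟧ M (All.head ts) a ≡ All.head (ts [ a ]*)
    ⟦head⟧ (t ∷ ts) a = refl

  lookup-flatten : ∀ {Γ s} (a : N.Tuple Γ) (v : s ∈ Γ) →
                   All.map (All.lookup (flatten a)) (varT v) ≡ flatten₁ s (All.lookup a v)
  lookup-flatten (_∷_ {x = s} x a) (here refl) =
    trans (map-tabulate (All.lookup (++⁺ (flatten₁ s x) (flatten a))) ∈-++⁺ˡ)
      (trans (tabulate-cong (lookup-++⁺ˡ (flatten₁ s x) (flatten a))) (tabulate-lookup (flatten₁ s x)))
  lookup-flatten (_∷_ {x = s} x a) (there v) =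
    trans (map-∘ (varT v)) (trans (map-cong (varT v) (lookup-++⁺ʳ (flatten₁ s x) (flatten a))) (lookup-flatten a v))

  ⟦trT⟧  : ∀ {Γ s} (t : Term K Γ s) (a : N.Tuple Γ) →
           ⟦_⟧* M (trT t) (flatten a) ≡ flatten₁ s (⟦_⟧ (M ^eq) t a)
  ⟦trT*⟧ : ∀ {Γ} Δ (ts : All (Term K Γ) (map home Δ)) (a : N.Tuple Γ) →
           ⟦_⟧* M (trT* Δ ts) (flatten a) ≡ map⁻ (⟦_⟧* (M ^eq) ts a)
  ⟦trT⟧ (var v)              a = trans (⟦var⟧* (varT v) (flatten a)) (lookup-flatten a v)
  ⟦trT⟧ (app (old {Δ} f) ts) a = cong (λ b → func f b ∷ []) (⟦trT*⟧ Δ ts a)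
  ⟦trT⟧ (app (cls {Γ} E) ts) a = ⟦trT*⟧ Γ ts a
  ⟦trT*⟧ []      []       a = refl
  ⟦trT*⟧ (s ∷ Δ) (t ∷ ts) a = cong₂ _∷_
    (trans (⟦head⟧ (trT t) (flatten a)) (cong All.head (⟦trT⟧ t a))) (⟦trT*⟧ Δ ts a)

  ⊨-∀* : ∀ {Γ} Δ (φ : Formula L (Δ ++ Γ)) a →
         (M ⊨ ∀* Δ φ [ a ]) ⇔ (∀ (b : Tuple Δ) → M ⊨ φ [ ++⁺ b a ])
  ⊨-∀* []      φ a = mk⇔ (λ { h [] → h }) (λ h → h [])
  ⊨-∀* (s ∷ Δ) φ a = mk⇔ (λ { h (x ∷ b) → to (⊨-∀* Δ (∀′ s φ) a) h b x })
                          (λ h → from (⊨-∀* Δ (∀′ s φ) a) (λ b x → h (x ∷ b)))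

  ⊨-trF : ∀ {Γ} (φ : Formula K Γ) (a : N.Tuple Γ) → ((M ^eq) ⊨ φ [ a ]) ⇔ (M ⊨ trF φ [ flatten a ])
  ⊨-trF (_≐_ {home s} t u) a = ≡⇒⇔ (cong₂ _≈_
    (sym (trans (⟦head⟧ (trT t) _) (cong All.head (⟦trT⟧ t a))))
    (sym (trans (⟦head⟧ (trT u) _) (cong All.head (⟦trT⟧ u a)))))
  ⊨-trF (_≐_ {imag Γ E} t u) a = ⇔-sym (⊨-subF M _
    (λ v → trans (⟦lookup⟧ (++⁺ (trT t) (trT u)) (flatten a) v) (cong (λ b → All.lookup b v)
      (trans (⟦⟧*-++⁺ (trT t) (trT u) (flatten a)) (cong₂ ++⁺ (⟦trT⟧ t a) (⟦trT⟧ u a)))))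
    (DefinableEquivalence.formula E))
  ⊨-trF (rel (old {Δ} r) ts) a = ≡⇒⇔ (cong (relation r) (sym (⟦trT*⟧ Δ ts a)))
  ⊨-trF ⊥′       a = ⇔-refl
  ⊨-trF (φ ⇒ ψ)  a = mk⇔ (λ f x → to (⊨-trF ψ a) (f (from (⊨-trF φ a) x)))
                          (λ f x → from (⊨-trF ψ a) (f (to (⊨-trF φ a) x)))
  ⊨-trF (∀′ s φ) a = ⇔-trans
    (mk⇔ (λ f b → subst (λ c → M ⊨ trF φ [ ++⁺ c (flatten a) ]) (flatten₁-unflatten₁ s b)
                    (to (⊨-trF φ (unflatten₁ s b ∷ a)) (f (unflatten₁ s b))))
         (λ f x → from (⊨-trF φ (x ∷ a)) (f (flatten₁ s x))))
    (⇔-sym (⊨-∀* (flat₁ s) (trF φ) (flatten a)))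

  homes : List (Sort L) → List (EqSort M)
  homes = map home

  homeVar : ∀ {Γ s} → s ∈ Γ → home {M = M} s ∈ homes Γ
  homeVar (here refl) = here refl
  homeVar (there v)   = there (homeVar v)

  -- The translation in the opposite direction. It lets the Tarski-Vaught criterion for the home
  -- structure be read off from definable sets of `M^eq`.
  embT  : ∀ {Γ s} → Term L Γ s → Term K (homes Γ) (home {M = M} s)
  embT* : ∀ {Γ Δ} → All (Term L Γ) Δ → All (Term K (homes Γ)) (homes Δ)
  embT (var v)    = var (homeVar v)
  embT (app f ts) = app (old f) (embT* ts)
  embT* []        = []
  embT* (t ∷ ts)  = embT t ∷ embT* ts

  embF : ∀ {Γ} → Formula L Γ → Formula K (homes Γ)
  embF (t ≐ u)    = embT t ≐ embT u
  embF (rel r ts) = rel (old r) (embT* ts)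
  embF ⊥′         = ⊥′
  embF (φ ⇒ ψ)    = embF φ ⇒ embF ψ
  embF (∀′ s φ)   = ∀′ (home {M = M} s) (embF φ)

  ⟦embT⟧  : ∀ {Γ s} (t : Term L Γ s) (a : N.Tuple (homes Γ)) →
            ⟦_⟧ (M ^eq) (embT t) a ≡ ⟦_⟧ M t (map⁻ a)
  ⟦embT*⟧ : ∀ {Γ Δ} (ts : All (Term L Γ) Δ) (a : N.Tuple (homes Γ)) →
            map⁻ (⟦_⟧* (M ^eq) (embT* ts) a) ≡ ⟦_⟧* M ts (map⁻ a)
  ⟦embT⟧ (var v)    a = go v a
    where
    go : ∀ {Γ s} (v : s ∈ Γ) (a : N.Tuple (homes Γ)) → All.lookup a (homeVar v) ≡ All.lookup (map⁻ {xs = Γ} a) v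
    go (here refl) (x ∷ a) = refl
    go (there v)   (x ∷ a) = go v a
  ⟦embT⟧ (app f ts) a = cong (func f) (⟦embT*⟧ ts a)
  ⟦embT*⟧ []        a = refl
  ⟦embT*⟧ (t ∷ ts)  a = cong₂ _∷_ (⟦embT⟧ t a) (⟦embT*⟧ ts a)

  ⊨-embF : ∀ {Γ} (φ : Formula L Γ) (a : N.Tuple (homes Γ)) →
           ((M ^eq) ⊨ embF φ [ a ]) ⇔ (M ⊨ φ [ map⁻ a ])
  ⊨-embF (t ≐ u)    a = ≡⇒⇔ (cong₂ _≈_ (⟦embT⟧ t a) (⟦embT⟧ u a))
  ⊨-embF (rel r ts) a = ≡⇒⇔ (cong (relation r) (⟦embT*⟧ ts a))
  ⊨-embF ⊥′         a = ⇔-refl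
  ⊨-embF (φ ⇒ ψ)    a = mk⇔ (λ f x → to (⊨-embF ψ a) (f (from (⊨-embF φ a) x)))
                             (λ f x → from (⊨-embF ψ a) (f (to (⊨-embF φ a) x)))
  ⊨-embF (∀′ s φ)   a = mk⇔ (λ f x → to (⊨-embF φ (x ∷ a)) (f x)) (λ f x → from (⊨-embF φ (x ∷ a)) (f x))

-- Saturation of M^eq and countability of its formulas

module Imaginaries (em : ExcludedMiddle 0ℓ) (wo : WellOrdering) {L : Language} (M : Structure L) where
  open Translation M
  private
    module D  = Definability em M
    module D* = Definability em (M ^eq)
    module C  = Covers em wo M
    module C* = Covers em wo (M ^eq)
    open Structure M using (Tuple; Elem)

  coords : Subset (M ^eq) → Subset M
  coords C x = Σ N.Elem λ y → C y × D.entries (flatten₁ (proj₁ y) (proj₂ y)) x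

  private
    flatEntries : ∀ {C Γ Δ} → All (D*.Entry C Γ) Δ → All (D.Entry (coords C) (flat Γ)) (flat Δ)
    flatEntries []                    = []
    flatEntries (D*.variable′ v ∷ ρ)  = ++⁺ (D.variables (varT v)) (flatEntries ρ)
    flatEntries (_∷_ {x = s} (D*.constant x c) ρ) =
      ++⁺ (D.constants (flatten₁ s x) (λ h → (s , x) , c , h)) (flatEntries ρ)

    values-flatEntries : ∀ {C Γ Δ} (a : N.Tuple Γ) (ρ : All (D*.Entry C Γ) Δ) →
                         D.values (flatten a) (flatEntries ρ) ≡ flatten (D*.values a ρ)
    values-flatEntries a [] = refl
    values-flatEntries {C} a (D*.variable′ v ∷ ρ) =
      trans (map-++⁺ (D.value (flatten a)) (D.variables (varT v)) (flatEntries ρ))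
        (cong₂ ++⁺ (trans (D.values-variables {coords C} (flatten a) (varT v)) (lookup-flatten a v))
                   (values-flatEntries a ρ))
    values-flatEntries {C} a (_∷_ {x = s} (D*.constant x c) ρ) =
      trans (map-++⁺ (D.value (flatten a)) (D.constants (flatten₁ s x) (λ h → (s , x) , c , h)) (flatEntries ρ))
        (cong₂ ++⁺ (D.values-constants (flatten a) (flatten₁ s x) _) (values-flatEntries a ρ))

  def-flatten : ∀ {C Γ} {X : N.Tuple Γ → Set} → D*.Defn C X →
                Σ (Tuple (flat Γ) → Set) λ Y → D.Defn (coords C) Y × (∀ a → X a ⇔ Y (flatten a))
  def-flatten {C} d = let Δ , φ , ρ , h = D*.def-matrix d in
    (λ a → M ⊨ trF φ [ D.values a (flatEntries ρ) ]) ,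
    D.definable (trF φ) (flatEntries ρ) , λ a → ⇔-trans (⇔-sym (h a))
      (⇔-trans (⊨-trF φ (D*.values a ρ)) (≡⇒⇔ (cong (M ⊨ trF φ [_]) (sym (values-flatEntries a ρ)))))

  cover-coords : ∀ {J} (e : J → Maybe N.Elem) → C.Cover (J × ℕ) (coords (C*.Listed e))
  cover-coords e = record
    { enum   = λ (j , n) → e j >>= λ (s , y) → C.nth (flatten₁ s y) n
    ; covers = λ { ((s , y) , (j , h) , (v , refl)) →
        let n , q = C.nth-lookup (flatten₁ s y) v in
        (j , n) , _ , trans (cong (_>>= λ (s , y) → C.nth (flatten₁ s y) n) h) q ,
        Setoid.refl (elemSetoid (Structure.setoid M)) } }

  -- A subset of an imaginary sort that is small up to `≈` may contain too many representatives for
  -- `coords C` to be small. Parameters are therefore first moved to the listed representatives by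
  -- `def-listed`; their coordinates are again covered by `Ix P`.
  saturated-eq : ∀ {κ P} → ≡.setoid ℕ ≺ ≡.setoid κ → Tiny κ P → Saturated κ M →
                 ∀ {C} → C*.Cover (C*.Ix P) C → C*.SatAt C
  saturated-eq {κ} {P} ℕ≺κ tiny sat {C} cov Γ {J} X d fip =
    let a , h = C.saturated-tuples (λ c → C.saturated-unary sat (C.tiny-small ℕ≺κ tiny c))
                  (C.cover-reindex reindex reindex-surjective (cover-coords (C*.Cover.enum cov)))
                  (flat Γ) Y (proj₁ ∘ proj₂ ∘ flattened) fip′
        b , e = flatten-surjective Γ a
    in b , λ j → from (proj₂ (proj₂ (flattened j)) b) (subst (Y j) (sym e) (h j))
    where
    flattened : ∀ j → Σ (Tuple (flat Γ) → Set) λ Y →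
                D.Defn (coords (C*.Listed (C*.Cover.enum cov))) Y × (∀ a → X j a ⇔ Y (flatten a))
    flattened j = def-flatten (C*.def-listed cov (d j))
    Y : J → Tuple (flat Γ) → Set
    Y j = proj₁ (flattened j)
    fip′ : ∀ js → ∃[ a ] All (λ j → Y j a) js
    fip′ js = let a , h = fip js in flatten a , All.map (λ {j} → to (proj₂ (proj₂ (flattened j)) a)) h
    reindex : C.Ix P → C*.Ix P × ℕ
    reindex (p , n) = (p , proj₁ (unpair n)) , proj₂ (unpair n)
    reindex-surjective : ∀ j → ∃[ i ] reindex i ≡ j
    reindex-surjective ((p , n) , m) = (p , pair n m) ,
      cong (λ k → (p , proj₁ k) , proj₂ k) (unpair-pair n m)

  module _ (countable : CountableLanguage L) {C : Subset (M ^eq)} {Γ : List (EqSort M)}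
           (cov : C*.Cover ℕ C) where
    open FormulaCodes countable

    private
      cov′ : C.Cover ℕ (coords (C*.Listed (C*.Cover.enum cov)))
      cov′ = C.cover-reindex unpair (λ (n , m) → pair n m , unpair-pair n m) (cover-coords (C*.Cover.enum cov))

      ListedDef : Set
      ListedDef = Σ (ParamFormula M (flat Γ)) (Over (C.Listed (C.Cover.enum cov′)))

      abstract
        flatFormula : (φ : Σ (ParamFormula (M ^eq) Γ) (Over C)) →
                      Σ ListedDef λ ψ → ∀ a → (a ⊩ proj₁ φ) ⇔ (flatten a ⊩ proj₁ ψ)
        flatFormula (φ , o) =
          let Y , d , h = def-flatten (C*.def-listed cov (D*.def-over φ o))
              D.defn ψ o′ h′ = C.def-listed cov′ d
          in (ψ , o′) , λ a → ⇔-trans (h a) (⇔-sym (h′ (flatten a)))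

      formulaCode : Σ (ParamFormula (M ^eq) Γ) (Over C) → ℕ
      formulaCode φ = let (ψ , o) , _ = flatFormula φ in paramFormulaCode M (C.Cover.enum cov′) ψ o

    -- A formula over `C` is coded by its translation into the countable language `L` over listed
    -- parameters. Formulas with the same translation have the same solutions, so the enumeration is
    -- complete up to equivalence.
    formulas : ℕ → Maybe (Σ (ParamFormula (M ^eq) Γ) (Over C))
    formulas = enumeration em formulaCode

    formulas-complete : ∀ φ → Over C φ →
      ∃₂ λ n ψ → formulas n ≡ just ψ × (∀ a → (a ⊩ φ) ⇔ (a ⊩ proj₁ ψ))
    formulas-complete φ o = let n , ψ , e , h = enumeration-complete em formulaCode (φ , o) in
      n , ψ , e , λ a → same-code ψ h a
      where
      same-code : ∀ ψ → formulaCode ψ ≡ formulaCode (φ , o) → ∀ a → (a ⊩ φ) ⇔ (a ⊩ proj₁ ψ)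
      same-code ψ h a with flatFormula ψ | flatFormula (φ , o)
      ... | (ψ′ , oψ) , hψ | (φ′ , oφ) , hφ
        with refl ← paramFormulaCode-injective M (C.Cover.enum cov′) ψ′ φ′ oψ oφ h =
        ⇔-trans (hφ a) (⇔-sym (hψ a))

-- Global types, equality of types and Morley sequences

module Types (em : ExcludedMiddle 0ℓ) (wo : WellOrdering) {L : Language} (N : Structure L) where
  open Structure N
  open Definability em N
  open Covers em wo N

  -- The filter of sets generated by the formulas of `p`. For a definable set it does not matter
  -- which formula defines it, by completeness and consistency.
  record _∋_ {s} (p : GlobalType N s) (X : Tuple (s ∷ []) → Set) : Set where
    constructor contains
    field
      {formula} : ParamFormula N (s ∷ [])
      isMember  : GlobalType.member p formula
      implies   : ∀ a → a ⊩ formula → X a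

  record Inv {s} (C : Subset N) (p : GlobalType N s) : Set where
    constructor inv
    field invariant : Invariant C p

  infix 4 _⊧_∣_
  record _⊧_∣_ {s} (x : Carrier s) (p : GlobalType N s) (C : Subset N) : Set where
    constructor realizes
    field satisfies : x realizes p ↾ C
  open _⊧_∣_ public

  infix 4 _∼[_]_
  -- One direction is enough, because applying it to negations gives the other.
  record _∼[_]_ {Γ} (a : Tuple Γ) (C : Subset N) (b : Tuple Γ) : Set where
    constructor same
    field transfer : ∀ (φ : ParamFormula N Γ) → Over C φ → a ⊩ φ → b ⊩ φ

  module _ {s} {p : GlobalType N s} where
    open GlobalType p

    ∋-mono : ∀ {X Y : Tuple (s ∷ []) → Set} → (∀ a → X a → Y a) → p ∋ X → p ∋ Y
    ∋-mono h (contains m i) = contains m (λ a → h a ∘ i a)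

    ∋-satisfiable : ∀ {J : Set} {X : J → Tuple (s ∷ []) → Set} {js} → All (λ j → p ∋ X j) js →
                    ∃[ a ] All (λ j → X j a) js
    ∋-satisfiable {X = X} ms = let φs , m , h = go ms ; a , k = consistent φs m in a , h a k
      where
      go : ∀ {js} → All (λ j → p ∋ X j) js →
           ∃[ φs ] All member φs × (∀ a → All (a ⊩_) φs → All (λ j → X j a) js)
      go []                   = [] , [] , λ _ _ → []
      go (contains m i ∷ ms) = let φs , ns , h = go ms in
        _ ∷ φs , m ∷ ns , λ { a (k ∷ ks) → i a k ∷ h a ks }

    ∋-satisfiable₂ : ∀ {X Y : Tuple (s ∷ []) → Set} → p ∋ X → p ∋ Y → ∃[ a ] X a × Y a
    ∋-satisfiable₂ (contains m i) (contains n j) with consistent _ (m ∷ n ∷ [])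
    ... | a , h ∷ k ∷ [] = a , i a h , j a k

    ∋-em : ∀ {C} {X : Tuple (s ∷ []) → Set} → Defn C X → p ∋ X ⊎ p ∋ (λ a → ¬ X a)
    ∋-em (defn φ o h) with complete φ
    ... | inj₁ m = inj₁ (contains m λ a → to (h a))
    ... | inj₂ m = inj₂ (contains m λ a k → k ∘ from (h a))

    ∋-member : ∀ {X : Tuple (s ∷ []) → Set} {φ} → (∀ a → X a → a ⊩ φ) → p ∋ X → member φ
    ∋-member {φ = φ} h d with complete φ
    ... | inj₁ m = m
    ... | inj₂ m with ∋-satisfiable₂ d (contains m (λ _ → id))
    ... | a , x , k = ⊥-elim (k (h a x))

    ∋-All : ∀ {φs} → All member φs → p ∋ (λ a → All (a ⊩_) φs)
    ∋-All {φs} ms with ∋-em {λ _ → ⊤} (def-All (λ φ → def-over φ _) φs)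
    ... | inj₁ d = d
    ... | inj₂ (contains m i) with consistent _ (m ∷ ms)
    ... | a , k ∷ ks = ⊥-elim (i a k ks)

    realizes-def : ∀ {C x} {X : Tuple (s ∷ []) → Set} → x ⊧ p ∣ C → Defn C X → p ∋ X → X (x ∷ [])
    realizes-def {x = x} r (defn φ o h) d =
      to (h (x ∷ [])) (satisfies r φ (∋-member (λ a → from (h a)) d , o))

    realizes-∋ : ∀ {C x} {X : Tuple (s ∷ []) → Set} → x ⊧ p ∣ C → Defn C X → X (x ∷ []) → p ∋ X
    realizes-∋ r dX x with ∋-em dX
    ... | inj₁ d = d
    ... | inj₂ d = ⊥-elim (realizes-def r (def-¬ dX) d x)

    realizes-⊆ : ∀ {C D x} → C ⊆ D → x ⊧ p ∣ D → x ⊧ p ∣ C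
    realizes-⊆ i r = realizes λ φ (m , o) → satisfies r φ (m , λ v → i (o v))

    realization : ∀ {C} → SatAt C → ∃[ x ] x ⊧ p ∣ C
    realization {C} sat with sat (s ∷ []) {∃ (p ↾ C)} (λ (φ , _) → _⊩ φ) (λ (φ , _ , o) → def-over φ o)
                          (λ js → ∋-satisfiable (All.universal (λ (φ , m , o) → contains m (λ _ → id)) js))
    ... | x ∷ [] , h = x , realizes λ φ m → h (φ , m)

  module _ {C : ℕ → Subset N} (increasing : ∀ n → C n ⊆ C (suc n)) where

    increasing-≤ : ∀ {m n} → m ℕ.≤ n → C m ⊆ C n
    increasing-≤ h = go (ℕ.≤⇒≤′ h)
      where
      go : ∀ {m n} → m ℕ.≤′ n → C m ⊆ C n
      go (ℕ.≤′-reflexive refl) c = c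
      go (ℕ.≤′-step h)         c = increasing _ (go h c)

    entries-bound : ∀ {Δ} (b : Tuple Δ) → entries b ⊆ (λ y → ∃[ n ] C n y) → ∃[ n ] entries b ⊆ C n
    entries-bound []      o = 0 , λ { (() , _) }
    entries-bound (x ∷ b) o =
      let m , c = o (here refl , refl)
          n , h = entries-bound b (λ (v , e) → o (there v , e))
      in m ℕ.⊔ n , λ { (here refl , refl) → increasing-≤ (ℕ.m≤m⊔n m n) c
                     ; (there v , e) → increasing-≤ (ℕ.m≤n⊔m m n) (h (v , e)) }

    realizes-limit : ∀ {s} {p : GlobalType N s} {x} →
                     (∀ n → x ⊧ p ∣ C n) → x ⊧ p ∣ (λ y → ∃[ n ] C n y)
    realizes-limit r = realizes λ { (φ ⟨ b ⟩) (m , o) → let n , o′ = entries-bound b (over-entries b o) in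
      satisfies (r n) (φ ⟨ b ⟩) (m , λ v → o′ (v , refl)) }

  sameType-sym : ∀ {C Γ} {a b : Tuple Γ} → a ∼[ C ] b → b ∼[ C ] a
  sameType-sym (same t) = same λ φ o k → dne λ ¬k → t (neg φ) o ¬k k

  sameType-def : ∀ {C Γ} {a b : Tuple Γ} {X : Tuple Γ → Set} → a ∼[ C ] b → Defn C X → X a → X b
  sameType-def (same t) (defn φ o h) x = to (h _) (t φ o (from (h _) x))

  -- The finite form of moving `d` along when `b` is moved to `c`: the existence of `d` with
  -- finitely many properties is part of the type of `b` over `C`. Saturation then supplies a single
  -- `d′` for infinitely many properties.
  sameType-tuple : ∀ {C Γ Δ} {b : Tuple Γ} {c : Tuple Γ} (d : Tuple Δ) → b ∼[ C ] c →
                   ∀ {J : Set} (Z : J → Tuple (Δ ++ Γ) → Set) → (∀ j → Defn C (Z j)) →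
                   ∀ js → All (λ j → Z j (++⁺ d b)) js → ∃[ d′ ] All (λ j → Z j (++⁺ d′ c)) js
  sameType-tuple {Δ = Δ} d t Z dZ js h = sameType-def t (def-∃* Δ (def-All dZ js)) (d , h)

  module _ {s} {p : GlobalType N s} where
    open GlobalType p

    invariant-∋ : ∀ {C Δ} {b c : Tuple Δ} {Y : Tuple (s ∷ Δ) → Set} → Inv C p → b ∼[ C ] c →
                  Defn C Y → p ∋ (λ a → Y (++⁺ a b)) → p ∋ (λ a → Y (++⁺ a c))
    invariant-∋ {b = b} {c} (inv i) t (defn φ o h) d = contains
      (to (i b c (λ ψ o → mk⇔ (_∼[_]_.transfer t ψ o) (_∼[_]_.transfer (sameType-sym t) ψ o)) φ o)
        (∋-member (λ { (x ∷ []) → from (h (x ∷ b)) }) d))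
      (λ { (x ∷ []) → to (h (x ∷ c)) })

    -- Parameters `c` of a formula over `D` are appended to `b₁` and `b₂`. The longer tuples have
    -- the same type over `C`, since `c` lies in `D` and `b₁`, `b₂` have the same type over `D`.
    invariant-⊆ : ∀ {C D} → C ⊆ D → Inv C p → Inv D p
    invariant-⊆ {C} {D} i invC = inv λ b₁ b₂ t (φ ⟨ c ⟩) o →
      mk⇔ (go φ c o (same λ ψ o → to (t ψ o))) (go φ c o (sameType-sym (same λ ψ o → to (t ψ o))))
      where
      go : ∀ {Δ Θ} {b₁ b₂ : Tuple Δ} (φ : Formula L ((s ∷ Δ) ++ Θ)) (c : Tuple Θ) →
           (∀ {t} (v : t ∈ Θ) → D (t , All.lookup c v)) →
           b₁ ∼[ D ] b₂ → member (instantiate (φ ⟨ c ⟩) b₁) → member (instantiate (φ ⟨ c ⟩) b₂)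
      go {b₁ = b₁} {b₂} φ c o t m = ∋-member (λ { (x ∷ []) → id })
        (invariant-∋ {b = ++⁺ b₁ c} {c = ++⁺ b₂ c} invC
          (same λ ψ oψ → sameType-def t (def-inst (def-⊆ i (def-over ψ oψ)) c (over-entries c o)))
          (def-formula φ)
          (contains {formula = instantiate (φ ⟨ c ⟩) b₁} m (λ { (x ∷ []) → id })))

    sameType-∷ : ∀ {C Δ} {b c : Tuple Δ} {x y} → Inv C p → b ∼[ C ] c →
                 x ⊧ p ∣ C ∪ entries b → y ⊧ p ∣ C ∪ entries c →
                 x ∷ b ∼[ C ] y ∷ c
    sameType-∷ {b = b} {c} {x} {y} i t rx ry = same λ φ o k →
      realizes-def ry (def-inst (def-⊆ inj₁ (def-over φ o)) c inj₂)
        (invariant-∋ i t (def-over φ o)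
          (realizes-∋ rx (def-inst (def-⊆ inj₁ (def-over φ o)) b inj₂) k))

    -- The last term of the sequence comes first.
    data Mor (C : Subset N) : ∀ {k} → Tuple (replicate k s) → Set where
      []  : Mor C {zero} []
      _∷_ : ∀ {k x} {e : Tuple (replicate k s)} → x ⊧ p ∣ C ∪ entries e → Mor C e →
            Mor C {suc k} (x ∷ e)

    mor-⊆ : ∀ {C D k} {e : Tuple (replicate k s)} → C ⊆ D → Mor D {k} e → Mor C {k} e
    mor-⊆ i []      = []
    mor-⊆ i (r ∷ m) = realizes-⊆ (λ { (inj₁ c) → inj₁ (i c) ; (inj₂ h) → inj₂ h }) r ∷ mor-⊆ i m

    mor-sameType : ∀ {C} → Inv C p → ∀ {k} {e f : Tuple (replicate k s)} → Mor C {k} e → Mor C {k} f →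
                   e ∼[ C ] f
    mor-sameType i []      []        = same λ φ o → id
    mor-sameType i (r ∷ m) (r′ ∷ m′) = sameType-∷ i (mor-sameType i m m′) r r′

    module ωMorley {C : Subset N} (sat : ∀ {Δ} (e : Tuple Δ) → SatAt (C ∪ entries e)) where

      abstract
        initial : ∀ n → Tuple (replicate n s)
        next : ℕ → Carrier s
        initial zero    = []
        initial (suc n) = next n ∷ initial n
        next n = proj₁ (realization {p = p} (sat (initial n)))

        initial-mor : ∀ n → Mor C {n} (initial n)
        initial-mor zero    = []
        initial-mor (suc n) = proj₂ (realization (sat (initial n))) ∷ initial-mor n

        next-realizes : ∀ n → next n ⊧ p ∣ C ∪ entries (initial n)
        next-realizes n = proj₂ (realization (sat (initial n)))

        next-entry : ∀ {m n} → m ℕ.< n → entries (initial n) (s , next m)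
        next-entry {m} h = go (ℕ.≤⇒≤′ h)
          where
          go : ∀ {n} → suc m ℕ.≤′ n → entries (initial n) (s , next m)
          go (ℕ.≤′-reflexive refl) = here refl , refl
          go (ℕ.≤′-step h)         = let v , e = go h in there v , e

        entry-next : ∀ n → entries (initial n) ⊆ (λ y → ∃[ m ] y ≡ (s , next m))
        entry-next (suc n) (here refl , refl) = n , refl
        entry-next (suc n) (there v , e)      = entry-next n (v , e)

-- Order type of the Morley sequence that refutes generic stability: one infinite half lies outside
-- a definable set, the other inside, so the set of indices is neither finite nor cofinite.
ω+ω : WellOrder
ω+ω = record
  { Index              = ℕ ⊎ ℕ
  ; _<_                = ℕ._<_ ⊎-< ℕ._<_
  ; isStrictTotalOrder = isStrictTotalOrderᶜ record
    { isEquivalence = ≡.isEquivalence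
    ; trans         = ⊎-<-transitive ℕ.<-trans ℕ.<-trans
    ; compare       = compare }
  ; wellFounded        = ⊎-<-wellFounded ℕ.<-wellFounded ℕ.<-wellFounded }
  where
  compare : ∀ x y → Tri ((ℕ._<_ ⊎-< ℕ._<_) x y) (x ≡ y) ((ℕ._<_ ⊎-< ℕ._<_) y x)
  compare (inj₁ _) (inj₂ _) = tri< ₁∼₂ (λ ()) (λ ())
  compare (inj₂ _) (inj₁ _) = tri> (λ ()) (λ ()) ₁∼₂
  compare (inj₁ m) (inj₁ n) with ℕ.<-cmp m n
  ... | tri< a b c = tri< (₁∼₁ a) (b ∘ inj₁-injective) (λ { (₁∼₁ h) → c h })
  ... | tri≈ a b c = tri≈ (λ { (₁∼₁ h) → a h }) (cong inj₁ b) (λ { (₁∼₁ h) → c h })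
  ... | tri> a b c = tri> (λ { (₁∼₁ h) → a h }) (b ∘ inj₁-injective) (₁∼₁ c)
  compare (inj₂ m) (inj₂ n) with ℕ.<-cmp m n
  ... | tri< a b c = tri< (₂∼₂ a) (b ∘ inj₂-injective) (λ { (₂∼₂ h) → c h })
  ... | tri≈ a b c = tri≈ (λ { (₂∼₂ h) → a h }) (cong inj₂ b) (λ { (₂∼₂ h) → c h })
  ... | tri> a b c = tri> (λ { (₂∼₂ h) → a h }) (b ∘ inj₂-injective) (₂∼₂ c)

maximum : ∀ {A : Set} (f : A → ℕ) (xs : List A) → ∃[ n ] All (λ x → f x ℕ.< n) xs
maximum f []       = 0 , []
maximum f (x ∷ xs) = let n , h = maximum f xs in
  suc (f x) ℕ.⊔ n , ℕ.m≤m⊔n (suc (f x)) n ∷ All.map (λ h → ℕ.≤-trans h (ℕ.m≤n⊔m (suc (f x)) n)) h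

-- Generic stability and avoiding Morley sequences

module Stability
  (em : ExcludedMiddle 0ℓ) (wo : WellOrdering) {L : Language} (N : Structure L)
  (κ : Set) (ℕ≺κ : ≡.setoid ℕ ≺ ≡.setoid κ)
  (sat : ∀ {P} → Tiny κ P → ∀ {C} → Covers.Cover em wo N (Covers.Ix em wo N P) C →
         Covers.SatAt em wo N C) where
  open Structure N
  open Definability em N
  open Covers em wo N
  open Types em wo N

  countable-sat : ∀ {C} → Cover ℕ C → SatAt C
  countable-sat cov = sat (tiny-⊥ ℕ≺κ) (cover-Ix cov)

  -- If arbitrarily long Morley sequences avoided a set of q, some Morley sequence of order type
  -- ω + ω would have its first half outside and its second half inside a conjugate of the set.
  module _ {s} {q : GlobalType N s} (stable : GenericallyStable κ q)
           {C} (cov : Cover ℕ C) (invC : Inv C q) where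

    private
      A₀ : Subset N
      A₀ = proj₁ (proj₂ stable)
      small : Small κ N A₀
      small = proj₁ (proj₂ (proj₂ stable))
      P : Set
      P = Image (proj₁ small)
      saturated : ∀ {D} → Cover (Ix P) D → SatAt D
      saturated = sat (image-tiny (proj₁ small) (proj₂ small))
      D : Subset N
      D = A₀ ∪ C
      D-cover : Cover (Ix P) D
      D-cover = cover-∪-Ix (cover-Ixʳ (≼-cover (proj₁ small))) cov
      module b = ωMorley {p = q} {D} (λ e → saturated (cover-∪-Ix D-cover (cover-entries e)))
      b : ℕ → Carrier s
      b = b.next
      D′ : Subset N
      D′ = D ∪ (λ y → ∃[ n ] y ≡ (s , b n))
      D′-cover : Cover (Ix P) D′
      D′-cover = cover-∪-Ix D-cover (cover-family (λ n → s , b n))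

      module _ {Δ} (d : Tuple Δ) {Y : Tuple (s ∷ Δ) → Set} (dY : Defn C Y)
               (avoid : ∀ k → Σ (Tuple (replicate k s)) λ e → Mor {p = q} C {k} e ×
                        (∀ x → entries e (s , x) → ¬ Y (x ∷ d))) where

        -- The conditions on the conjugate `d′` of `d`: it has the type of `d` over `C`, and every
        -- `b n` lies outside Y(·,d′).
        Condition : Set
        Condition = (Σ (ParamFormula N Δ) λ φ → Over C φ × d ⊩ φ) ⊎ ℕ

        Z : Condition → Tuple Δ → Set
        Z (inj₁ (φ , _)) a = a ⊩ φ
        Z (inj₂ n)       a = ¬ Y (b n ∷ a)

        Z-def : ∀ j → Defn D′ (Z j)
        Z-def (inj₁ (φ , o , _)) = def-⊆ (inj₁ ∘ inj₂) (def-over φ o)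
        Z-def (inj₂ n) = def-¬ (def-⇔
          (λ a → ≡⇒⇔ (cong (λ a → Y (b n ∷ a)) (trans (values-variables {D′} a allVars) (rearrange-allVars a))))
          (def-plug (def-⊆ (inj₁ ∘ inj₂) dY) (constant (b n) (inj₂ (n , refl)) ∷ variables allVars)))

        module _ (k : ℕ) where
          Z′ : Condition → Tuple (Δ ++ replicate k s) → Set
          Z′ (inj₁ (φ , _)) a = rearrange leftVars a ⊩ φ
          Z′ (inj₂ n)       a = ∀ (h : n ℕ.< k) →
            ¬ Y (rearrange (∈-++⁺ʳ Δ (proj₁ (b.next-entry h)) ∷ leftVars) a)

          Z′-def : ∀ j → Defn C (Z′ j)
          Z′-def (inj₁ (φ , o , _)) = def-rearrange (def-over φ o) leftVars
          Z′-def (inj₂ n) with n ℕ.<? k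
          ... | no ¬h = def-⇔ (λ _ → mk⇔ (λ _ h → ⊥-elim (¬h h)) _) def-⊤
          ... | yes h = def-⇔
            (λ a → mk⇔ (λ g h′ → subst (λ h → ¬ Y (rearrange (∈-++⁺ʳ Δ (proj₁ (b.next-entry h)) ∷ leftVars) a))
                                    (ℕ.<-irrelevant h h′) g) (λ g → g h))
            (def-¬ (def-rearrange dY _))

          Z′⇒Z : ∀ {a} j → [ (λ _ → 0) , id ]′ j ℕ.< k → Z′ j (++⁺ a (b.initial k)) → Z j a
          Z′⇒Z {a} (inj₁ (φ , _)) _ z = subst (_⊩ φ) (rearrange-leftVars a (b.initial k)) z
          Z′⇒Z {a} (inj₂ n) h z y = z h (subst Y (sym (cong₂ _∷_
            (trans (lookup-++⁺ʳ a (b.initial k) (proj₁ (b.next-entry h))) (proj₂ (b.next-entry h)))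
            (rearrange-leftVars a (b.initial k)))) y)

          Z′-holds : ∀ (e : Tuple (replicate k s)) → (∀ x → entries e (s , x) → ¬ Y (x ∷ d)) →
                     ∀ j → Z′ j (++⁺ d e)
          Z′-holds e h (inj₁ (φ , _ , x)) = subst (_⊩ φ) (sym (rearrange-leftVars d e)) x
          Z′-holds e h (inj₂ n) lt y = h _ (proj₁ (b.next-entry lt) , refl) (subst Y (cong₂ _∷_
            (lookup-++⁺ʳ d e (proj₁ (b.next-entry lt))) (rearrange-leftVars d e)) y)

        -- Finitely many conditions mention only `b n` with n < k. The avoiding sequence of length
        -- `k` and `b.initial k` have the same type over `C`, so `d`, which satisfies the conditions
        -- with the former, can be moved to a tuple that satisfies them with the latter.
        Z-satisfiable : ∀ js → ∃[ a ] All (λ j → Z j a) js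
        Z-satisfiable js =
          let k , bound = maximum [ (λ _ → 0) , id ]′ js
              e , mor , h = avoid k
              a , z = sameType-tuple d (mor-sameType invC mor (mor-⊆ inj₂ (b.initial-mor k))) (Z′ k) (Z′-def k)
                        js (All.universal (Z′-holds k e h) js)
          in a , All.zipWith (λ {j} (h , z) → Z′⇒Z k j h z) (bound , z)

        abstract
          d′∃ : ∃[ a ] ∀ j → Z j a
          d′∃ = saturated D′-cover Δ Z Z-def Z-satisfiable

        d′ : Tuple Δ
        d′ = proj₁ d′∃
        d∼d′ : d ∼[ C ] d′
        d∼d′ = same λ φ o x → proj₂ d′∃ (inj₁ (φ , o , x))

        D″-cover : Cover (Ix P) (D′ ∪ entries d′)
        D″-cover = cover-∪-Ix D′-cover (cover-entries d′)
        module c = ωMorley {p = q} {D′ ∪ entries d′} (λ e → saturated (cover-∪-Ix D″-cover (cover-entries e)))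

        a : ℕ ⊎ ℕ → Carrier s
        a (inj₁ n) = b n
        a (inj₂ n) = c.next n

        terms : ∀ i → a i ⊧ q ∣ A₀ ∪ range {M = N} a (λ j → WellOrder._<_ ω+ω j i)
        terms (inj₁ n) = realizes-⊆
          (λ { (inj₁ h) → inj₁ (inj₁ h) ; (inj₂ (inj₁ m , ₁∼₁ h , refl)) → inj₂ (b.next-entry h) })
          (b.next-realizes n)
        terms (inj₂ n) = realizes-⊆
          (λ { (inj₁ h) → inj₁ (inj₁ (inj₁ (inj₁ h)))
             ; (inj₂ (inj₁ m , _ , refl)) → inj₁ (inj₁ (inj₂ (m , refl)))
             ; (inj₂ (inj₂ m , ₂∼₂ h , refl)) → inj₂ (c.next-entry h) })
          (c.next-realizes n)

        infinite : WellOrder.Infinite ω+ω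
        infinite (xs , h) = finite (mk↣ inj₁-injective) xs (λ n → h (inj₁ n) _)

        abstract
          Y′-def : Defn (D′ ∪ entries d′) {s ∷ []} (λ a → Y (++⁺ a d′))
          Y′-def = def-inst (def-⊆ (inj₁ ∘ inj₁ ∘ inj₂) dY) d′ inj₂

        -- By invariance `q` also contains Y(·,d′), so all terms of the second half, being generic
        -- over `d′`, lie in it, while the choice of `d′` keeps all terms of the first half out.
        contradictory : ¬ (q ∋ (λ a → Y (++⁺ a d)))
        contradictory m with proj₂ (proj₂ (proj₂ (proj₂ stable))) ω+ω infinite a (λ i → satisfies (terms i))
                               (Defn.formula Y′-def)
        ... | inj₁ (xs , h) = finite (mk↣ inj₂-injective) xs λ n →
          h (inj₂ n) (from (Defn.correct Y′-def (c.next n ∷ []))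
            (realizes-def (realizes-⊆ inj₁ (c.next-realizes n)) Y′-def (invariant-∋ invC d∼d′ dY m)))
        ... | inj₂ (xs , h) = finite (mk↣ inj₁-injective) xs λ n →
          h (inj₁ n) (λ y → proj₂ d′∃ (inj₂ n) (to (Defn.correct Y′-def (b n ∷ [])) y))

    stable-avoid : ∀ {X : Tuple (s ∷ []) → Set} → Defn (λ _ → ⊤) X →
      (∀ k → Σ (Tuple (replicate k s)) λ e → Mor {p = q} C {k} e × (∀ x → entries e (s , x) → ¬ X (x ∷ []))) →
      ¬ (q ∋ X)
    stable-avoid (defn (φ ⟨ d ⟩) o h) avoid m =
      -- All parameters become the tuple `d`, even those that happen to lie in `C`; then `Y` is over
      -- `C` and `d` may be replaced by a conjugate.
      let Y , dY , e = def-abstract d (defn (φ ⟨ d ⟩) (λ v → inj₂ (v , refl)) h) in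
      contradictory d dY
        (λ k → let t , mor , k = avoid k in t , mor , λ x i y → k x i (from (e (x ∷ [])) y))
        (∋-mono (λ a → to (e a)) m)

-- Commuting types and weak orthogonality

module Independence
  (em : ExcludedMiddle 0ℓ) (wo : WellOrdering) {L : Language} (N : Structure L)
  (κ : Set) (ℕ≺κ : ≡.setoid ℕ ≺ ≡.setoid κ)
  (sat : ∀ {P} → Tiny κ P → ∀ {C} → Covers.Cover em wo N (Covers.Ix em wo N P) C →
         Covers.SatAt em wo N C) where
  open Structure N
  open Definability em N
  open Covers em wo N
  open Types em wo N
  open Stability em wo N κ ℕ≺κ sat

  private variable
    s t : Sort L
    C D : Subset N

  infixl 6 _∪ₑ_
  _∪ₑ_ : Subset N → ∀ {Γ} → Tuple Γ → Subset N
  C ∪ₑ e = C ∪ entries e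

  cover-∪ₑ : ∀ {Γ} (e : Tuple Γ) → Cover ℕ C → Cover ℕ (C ∪ₑ e)
  cover-∪ₑ e cov = cover-∪ cov (cover-entries e)

  realizes-[] : ∀ {p : GlobalType N s} {x} → x ⊧ p ∣ C → x ⊧ p ∣ C ∪ₑ []
  realizes-[] = realizes-⊆ λ { (inj₁ c) → c ; (inj₂ (() , _)) }

  realization-countable : (p : GlobalType N s) → Cover ℕ C → ∃[ x ] x ⊧ p ∣ C
  realization-countable p cov = realization (countable-sat cov)

  realizations-∼ : ∀ {p : GlobalType N s} {x y} → Inv C p → x ⊧ p ∣ C → y ⊧ p ∣ C →
                   (x ∷ []) ∼[ C ] (y ∷ [])
  realizations-∼ i rx ry = sameType-∷ i (same λ _ _ → id) (realizes-[] rx) (realizes-[] ry)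

  swap : ∀ {s t : Sort L} → All (_∈ s ∷ t ∷ []) (t ∷ s ∷ [])
  swap = there (here refl) ∷ here refl ∷ []

  module _ {r : GlobalType N t} {q : GlobalType N s} (stable : GenericallyStable κ q) where

    -- Suppose Y(·,b) is in `r` but fails at `c`. Then `q`, realized by `b` over `c`, contains the
    -- complement of Y(c,·), hence that of Y(c′,·) for any `c′` realizing `r ↾ C`. Take `c′` generic
    -- over a Morley sequence in `q`: by invariance of `r` all terms of the sequence lie in Y(c′,·),
    -- so they avoid a set belonging to `q`.
    commute : Cover ℕ C → Inv C r → Inv C q → ∀ {c b} → c ⊧ r ∣ C → b ⊧ q ∣ C ∪ₑ (c ∷ []) →
              c ⊧ r ∣ C ∪ₑ (b ∷ [])
    commute {C} cov invr invq {c} {b} rc rb = realizes λ φ (m , o) → dne λ ¬φ →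
      let Y , dY , e = def-abstract (b ∷ []) (def-over φ o)
          dY′ = def-¬ (def-rearrange dY swap)
          c′ , rc′ = realization-countable r (cover-∪ cov (cover-family (λ n → s , B.next n)))
      in stable-avoid stable cov invq (def-⊆ {D = λ _ → ⊤} _ (def-inst (def-⊆ inj₁ dY′) (c′ ∷ []) inj₂))
          (λ k → B.initial k , B.initial-mor k , λ x i → λ ¬y →
            let n , h = B.entry-next k i in
            ¬y (subst (λ x → Y (c′ ∷ x ∷ [])) (sym (cong-elem h))
              (realizes-def rc′ (def-inst (def-⊆ inj₁ dY) (B.next n ∷ []) (λ { (here refl , refl) → inj₂ (n , refl) }))
                (invariant-∋ invr (realizations-∼ invq (realizes-⊆ inj₁ rb)
                    (realizes-⊆ inj₁ (B.next-realizes n))) dY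
                  (contains m (λ a → to (e a)))))))
          (invariant-∋ invq (realizations-∼ invr rc (realizes-⊆ inj₁ rc′)) dY′
            (realizes-∋ rb (def-inst (def-⊆ inj₁ dY′) (c ∷ []) inj₂) (λ y → ¬φ (from (e (c ∷ [])) y))))
      where
      module B = ωMorley {p = q} {C} (λ e → countable-sat (cover-∪ₑ e cov))
      cong-elem : ∀ {x y : Carrier s} → _≡_ {A = Elem} (s , x) (s , y) → x ≡ y
      cong-elem refl = refl

    commute-mor : Cover ℕ C → Inv C r → Inv C q → ∀ {c k} {e : Tuple (replicate k s)} →
                  c ⊧ r ∣ C → Mor {p = q} (C ∪ₑ (c ∷ [])) {k} e → c ⊧ r ∣ C ∪ₑ e
    commute-mor cov invr invq rc [] = realizes-[] rc
    commute-mor cov invr invq rc (_∷_ {e = e} rx m) = realizes-⊆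
      (λ { (inj₁ c) → inj₁ (inj₁ c) ; (inj₂ (here refl , h)) → inj₂ (here refl , h)
         ; (inj₂ (there v , h)) → inj₁ (inj₂ (v , h)) })
      (commute (cover-∪ₑ e cov) (invariant-⊆ inj₁ invr) (invariant-⊆ inj₁ invq)
        (commute-mor cov invr invq rc m)
        (realizes-⊆ (λ { (inj₁ (inj₁ c)) → inj₁ (inj₁ c) ; (inj₁ (inj₂ h)) → inj₂ h
                       ; (inj₂ h) → inj₁ (inj₂ h) }) rx))

  -- `sameType-tuple` shows that the type of `d` over `C` and `u`, moved to `v`, is finitely
  -- satisfiable; saturation over `C ∪ₑ v` realizes it.
  sameType-extend : ∀ {Γ Δ} {u v : Tuple Γ} → Cover ℕ C → u ∼[ C ] v → (d : Tuple Δ) →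
                    Σ (Tuple Δ) λ d′ → ++⁺ d u ∼[ C ] ++⁺ d′ v
  sameType-extend {C} {Γ} {Δ} {u} {v} cov t d =
    let d′ , h = countable-sat (cover-∪ₑ v cov) Δ (λ j a → ++⁺ a v ⊩ proj₁ j)
                   (λ j → def-inst (def-⊆ inj₁ (Z-def j)) v inj₂)
                   (λ js → sameType-tuple d t (λ j → _⊩ proj₁ j) Z-def js
                             (All.universal (λ j → proj₂ (proj₂ j)) js))
    in d′ , same λ φ o k → h (φ , o , k)
    where
    J : Set
    J = Σ (ParamFormula N (Δ ++ Γ)) λ φ → Over C φ × ++⁺ d u ⊩ φ
    Z-def : (j : J) → Defn C (_⊩ proj₁ j)
    Z-def (φ , o , _) = def-over φ o

  def-params : ∀ {Γ} {X : Tuple Γ → Set} → Defn C X →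
               Σ (List (Sort L)) λ Δ → Σ (Tuple Δ) λ d → Defn (entries d) X
  def-params (defn (φ ⟨ d ⟩) o h) = _ , d , defn (φ ⟨ d ⟩) (λ v → v , refl) h

  module _ {p : GlobalType N t} {q : GlobalType N s} (stable : GenericallyStable κ q)
           (orthogonal : Orthogonal p q) where

    -- Otherwise some Y over C has q ∋ Y(·,c) and ¬ Y(b,c), and orthogonality gives Θ in p and Ψ in q
    -- with Θ × Ψ ⊆ Y.  Copies (a,b*) of (c,b) with a generic lie outside Y and in Θ, so that b* avoids Ψ;
    -- this yields arbitrarily long Morley sequences in q avoiding Ψ.
    weakly-orthogonal : Cover ℕ C → Inv C p → Inv C q → ∀ {c b} → c ⊧ p ∣ C → b ⊧ q ∣ C →
                        b ⊧ q ∣ C ∪ₑ (c ∷ [])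
    weakly-orthogonal {C} cov invp invq {c} {b} rc rb = realizes λ φ (m , o) → dne λ ¬φ →
      let Y , dY , e = def-abstract (c ∷ []) (def-over φ o)
      in absurd dY (contains m (λ a → to (e a))) (¬φ ∘ from (e (b ∷ [])))
      where
      module _ {Y : Tuple (s ∷ t ∷ []) → Set} (dY : Defn C Y) (q∋Y : q ∋ (λ a → Y (++⁺ a (c ∷ []))))
               (¬Y : ¬ Y (b ∷ c ∷ [])) where

        module _ {θs ψs} (pθs : All (GlobalType.member p) θs) (qψs : All (GlobalType.member q) ψs) where

          Θ : Tuple (t ∷ []) → Set
          Θ a = All (a ⊩_) θs
          Θ-params : Σ (List (Sort L)) λ Δ → Σ (Tuple Δ) λ d → Defn (entries d) Θ
          Θ-params = def-params {C = λ _ → ⊤} (def-All (λ φ → def-over φ _) θs)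
          d : Tuple (proj₁ Θ-params)
          d = proj₁ (proj₂ Θ-params)

          generic : ∀ {k} (e : Tuple (replicate k s)) → ∃[ x ] x ⊧ p ∣ C ∪ₑ e × Θ (x ∷ [])
          generic e = let x , rx = realization-countable p (cover-∪ₑ d (cover-∪ₑ e cov)) in
            x , realizes-⊆ inj₁ rx , realizes-def rx (def-⊆ inj₂ (proj₂ (proj₂ Θ-params))) (∋-All pθs)

          -- The outcome of orthogonality in which the product of the two sets misses `Y` fails at
          -- once: for `c′` generic in `Θ`, invariance puts Y(·,c′) into `q`, so it meets every set
          -- of `q`.
          negative : ¬ (∀ x y → All ((x ∷ []) ⊩_) θs → All ((y ∷ []) ⊩_) ψs → ¬ Y (y ∷ x ∷ []))
          negative prove with generic []
          ... | c′ , rc′ , θ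
            with ∋-satisfiable₂ (∋-All qψs)
                   (invariant-∋ invq (realizations-∼ invp rc (realizes-⊆ inj₁ rc′)) dY q∋Y)
          ... | y ∷ [] , ψ , k = prove c′ y θ ψ k

          positive : ¬ (∀ x y → All ((x ∷ []) ⊩_) θs → All ((y ∷ []) ⊩_) ψs → Y (y ∷ x ∷ []))
          positive prove = stable-avoid stable cov invq
            (def-All (λ φ → def-over {C = λ _ → ⊤} φ _) ψs) avoid (∋-All qψs)
            where
            module B = ωMorley {p = q} {C ∪ₑ (c ∷ b ∷ [])}
                         (λ e → countable-sat (cover-∪ₑ e (cover-∪ₑ (c ∷ b ∷ []) cov)))
            avoid : ∀ k → Σ (Tuple (replicate k s)) λ e → Mor {p = q} C {k} e ×
                    (∀ x → entries e (s , x) → ¬ All ((x ∷ []) ⊩_) ψs)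
            avoid zero    = [] , [] , λ { _ (() , _) }
            -- `e′` is a Morley sequence over `c` and `b`, so commutation makes each of `c` and `b`
            -- generic over `e′`. Since `e′` has the type of `e`, and `a` is generic over `e`, the
            -- triple (b, c, e′) has a copy (b*, a, e). Its first term continues `e`, and as Y fails
            -- at (b*, a) with `a` in `Θ`, it avoids the set of the `ψs`.
            avoid (suc k) =
              let e , mor , h = avoid k
                  e′ = B.initial k
                  rc′ : c ⊧ p ∣ C ∪ₑ e′
                  rc′ = commute-mor stable cov invp invq rc
                    (mor-⊆ (λ { (inj₁ x) → inj₁ x ; (inj₂ (here refl , r)) → inj₂ (here refl , r) }) (B.initial-mor k))
                  rb′ : b ⊧ q ∣ C ∪ₑ e′
                  rb′ = commute-mor stable cov invq invq rb
                    (mor-⊆ (λ { (inj₁ x) → inj₁ x ; (inj₂ (here refl , r)) → inj₂ (there (here refl) , r) }) (B.initial-mor k))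
                  a , ra , θ = generic e
                  e′∼e : e′ ∼[ C ] e
                  e′∼e = mor-sameType invq (mor-⊆ inj₁ (B.initial-mor k)) mor
                  t = sameType-∷ invp e′∼e rc′ ra
                  b* , t* = sameType-extend cov t (b ∷ [])
              in extend e mor h rb′ ra θ e′∼e b* t*
              where
              extend : ∀ {k} {a} {e′ : Tuple (replicate k s)} e → Mor {p = q} C {k} e →
                (∀ x → entries e (s , x) → ¬ All ((x ∷ []) ⊩_) ψs) → b ⊧ q ∣ C ∪ₑ e′ → a ⊧ p ∣ C ∪ₑ e →
                Θ (a ∷ []) → e′ ∼[ C ] e → (b* : Tuple (s ∷ [])) → (b ∷ c ∷ e′) ∼[ C ] ++⁺ b* (a ∷ e) →
                Σ (Tuple (replicate (suc k) s)) λ e → Mor {p = q} C {suc k} e ×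
                    (∀ x → entries e (s , x) → ¬ All ((x ∷ []) ⊩_) ψs)
              extend {k} {a} {e′} e mor h rb′ ra θ e′∼e (b* ∷ []) t* = b* ∷ e , rb* ∷ mor , λ where
                  x (here refl , refl) ψ → sameType-def t* (def-¬ (def-rearrange dY leftVars))
                    (¬Y ∘ subst Y (rearrange-leftVars (b ∷ c ∷ []) e′))
                    (subst Y (sym (rearrange-leftVars (b* ∷ a ∷ []) e)) (prove a x θ ψ))
                  x (there v , i) → h x (v , i)
                where
                rb* : b* ⊧ q ∣ C ∪ₑ e
                rb* = realizes λ φ (m , o) →
                  let Y₂ , dY₂ , i = def-abstract e (def-over φ o)
                      θ : All (_∈ s ∷ t ∷ replicate k s) (s ∷ replicate k s)
                      θ = here refl ∷ All.map (λ v → there (there v)) allVars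
                  in from (i (b* ∷ [])) (subst Y₂
                       (cong (b* ∷_) (rearrange-map (λ v → there (there v)) (b* ∷ a ∷ e) (λ _ → refl)))
                       (sameType-def t* (def-rearrange dY₂ θ)
                         (subst Y₂ (sym (cong (b ∷_) (rearrange-map (λ v → there (there v)) (b ∷ c ∷ e′) (λ _ → refl))))
                           (realizes-def rb′ (def-inst (def-⊆ inj₁ dY₂) e′ inj₂)
                             (invariant-∋ invq (sameType-sym e′∼e) dY₂
                               (contains m (λ a → to (i a))))))))

        absurd : ⊥
        absurd with orthogonal (Defn.formula (def-rearrange dY swap))
        ... | inj₁ (θs , ψs , pθs , qψs , prove) = positive pθs qψs λ x y θ ψ →
          to (Defn.correct (def-rearrange dY swap) (x ∷ y ∷ [])) (prove x y θ ψ)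
        ... | inj₂ (θs , ψs , pθs , qψs , prove) = negative pθs qψs λ x y θ ψ k →
          prove x y θ ψ (from (Defn.correct (def-rearrange dY swap) (x ∷ y ∷ [])) k)

-- Regularity, non-isolation and independent families

module Families
  (em : ExcludedMiddle 0ℓ) (wo : WellOrdering) {L : Language} (N : Structure L)
  (κ : Set) (ℕ≺κ : ≡.setoid ℕ ≺ ≡.setoid κ)
  (sat : ∀ {P} → Tiny κ P → ∀ {C} → Covers.Cover em wo N (Covers.Ix em wo N P) C →
         Covers.SatAt em wo N C) where
  open Structure N
  open Definability em N
  open Covers em wo N
  open Types em wo N
  open Stability em wo N κ ℕ≺κ sat

  open Independence em wo N κ ℕ≺κ sat

  private variable
    s t : Sort L
    C D : Subset N

  regular-extend : ∀ {p : GlobalType N s} {A B x y} → Regular κ A p → Cover ℕ B → A ⊆ B →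
                   x ⊧ p ∣ A → ¬ (x ⊧ p ∣ B) → y ⊧ p ∣ B → y ⊧ p ∣ B ∪ₑ (x ∷ [])
  regular-extend {B = B} (_ , _ , regular) cov i rx ¬rx ry
    with regular _ (countable-small ℕ≺κ cov) i _ (satisfies rx)
  ... | inj₁ h = ⊥-elim (¬rx (realizes h))
  ... | inj₂ h = realizes λ φ (m , o) →
    let φs , ms , k = h φ (m , λ v → ∪-singleton {B = B} (o v))
    in k (_ ∷ []) (All.map (λ {ψ} → satisfies ry ψ) ms)
    where
    ∪-singleton : ∀ {B : Subset N} {x : Carrier s} {y : Elem} → (B ∪ₑ (x ∷ [])) y → (B ∪ ｛ s , x ｝) y
    ∪-singleton (inj₁ b)                  = inj₁ b
    ∪-singleton (inj₂ (here refl , refl)) = inj₂ refl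

  -- If no finite part of `p ↾ C` implied `X`, saturation over `C ∪ D` would realize `p ↾ C` outside
  -- `X`.
  compactness : ∀ {p : GlobalType N s} {X : Tuple (s ∷ []) → Set} → Cover ℕ C → Cover ℕ D → Defn D X →
                (∀ x → x ⊧ p ∣ C → X (x ∷ [])) →
                ∃[ φs ] All (p ↾ C) φs × (∀ a → All (a ⊩_) φs → X a)
  compactness {s} {C} {D} {p} {X} covC covD dX h = dne λ none →
    let a , k = countable-sat (cover-∪ covC covD) (s ∷ []) Z Z-def (satisfiable none)
    in avoid a k
    where
    Z : ∃ (p ↾ C) ⊎ ⊤ → Tuple (s ∷ []) → Set
    Z (inj₁ (φ , _)) a = a ⊩ φ
    Z (inj₂ _)       a = ¬ X a
    Z-def : ∀ j → Defn (C ∪ D) (Z j)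
    Z-def (inj₁ (φ , _ , o)) = def-⊆ inj₁ (def-over φ o)
    Z-def (inj₂ _)           = def-⊆ inj₂ (def-¬ dX)
    avoid : ∀ a → ¬ (∀ j → Z j a)
    avoid (x ∷ []) k = k (inj₂ tt) (h x (realizes λ φ m → k (inj₁ (φ , m))))
    formulasOf : List (∃ (p ↾ C) ⊎ ⊤) → List (∃ (p ↾ C))
    formulasOf []            = []
    formulasOf (inj₁ φ ∷ js) = φ ∷ formulasOf js
    formulasOf (inj₂ _ ∷ js) = formulasOf js
    satisfiable : ¬ (∃[ φs ] All (p ↾ C) φs × (∀ a → All (a ⊩_) φs → X a)) → ∀ js → ∃[ a ] All (λ j → Z j a) js
    satisfiable none js = dne λ k → none (map proj₁ (formulasOf js) , map⁺ (All.universal proj₂ _) ,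
      λ a f → dne λ ¬x → k (a , go js a (map⁻ f) ¬x))
      where
      go : ∀ js a → All (λ φ → a ⊩ proj₁ φ) (formulasOf js) → ¬ X a → All (λ j → Z j a) js
      go []            a f       ¬x = []
      go (inj₁ φ ∷ js) a (k ∷ f) ¬x = k ∷ go js a f ¬x
      go (inj₂ _ ∷ js) a f       ¬x = ¬x ∷ go js a f ¬x

  isolated : ∀ {p : GlobalType N s} {X : Tuple (s ∷ []) → Set} → Defn C X → p ∋ X →
             (∀ x → X (x ∷ []) → x ⊧ p ∣ C) → Isolated (p ↾ C)
  isolated (defn φ o h) d k = φ , (∋-member (λ a → from (h a)) d , o) ,
    λ x y → satisfies (k x (to (h (x ∷ [])) y))

  -- The defining parameters may lie outside `C`: by compactness a finite part of `p ↾ C` already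
  -- implies `X`, and its conjunction is an isolating formula over `C`.
  isolated-by : ∀ {p : GlobalType N s} {X : Tuple (s ∷ []) → Set} → Cover ℕ C → Cover ℕ D → Defn D X →
                (∀ x → x ⊧ p ∣ C → X (x ∷ [])) → (∀ x → X (x ∷ []) → x ⊧ p ∣ C) → Isolated (p ↾ C)
  isolated-by covC covD dX h k =
    let φs , ms , i = compactness covC covD dX h
    in isolated (def-All (λ { (φ , _ , o) → def-over φ o }) (All.toList ms))
         (∋-mono (λ a f → members a ms f) (∋-All (All.map proj₁ ms)))
         (λ x f → k x (i (x ∷ []) (members⁻ (x ∷ []) ms f)))
    where
    members : ∀ {Φ : Pred (ParamFormula N (s ∷ [])) _} {φs} a (ms : All Φ φs) → All (a ⊩_) φs →
              All (λ m → a ⊩ proj₁ m) (All.toList ms)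
    members a []       []       = []
    members a (m ∷ ms) (f ∷ fs) = f ∷ members a ms fs
    members⁻ : ∀ {Φ : Pred (ParamFormula N (s ∷ [])) _} {φs} a (ms : All Φ φs) →
               All (λ m → a ⊩ proj₁ m) (All.toList ms) → All (a ⊩_) φs
    members⁻ a []       []       = []
    members⁻ a (m ∷ ms) (f ∷ fs) = f ∷ members⁻ a ms fs

  -- By weak orthogonality every realization of `p ↾ C` also realizes `p` over `a`, so the isolating
  -- formula over `C` and `a` defines exactly the realizations of `p ↾ C`.
  isolated-orthogonal : ∀ {p : GlobalType N s} {q : GlobalType N t} → GenericallyStable κ p → Orthogonal q p →
    Cover ℕ C → Inv C p → Inv C q → ∀ {a} → a ⊧ q ∣ C → Isolated (p ↾ (C ∪ₑ (a ∷ []))) → Isolated (p ↾ C)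
  isolated-orthogonal {C = C} stable orth cov invp invq {a} ra (φ , (m , o) , h) =
    isolated-by cov (cover-∪ₑ (a ∷ []) cov) (def-over {C = C ∪ₑ (a ∷ [])} φ o)
      (λ x rx → satisfies (weakly-orthogonal stable orth cov invq invp ra rx) φ (m , o))
      (λ x k → realizes-⊆ {D = C ∪ₑ (a ∷ [])} inj₁ (realizes (h x k)))

  -- With a and b independent over C, every realization of p ↾ C is independent of a or of b,
  -- so the disjunction of the isolating formulas over a and over b defines p ↾ C.
  isolated-regular : ∀ {p : GlobalType N s} {A} → GenericallyStable κ p → Regular κ A p → A ⊆ C →
    Cover ℕ C → Inv C p → ∀ {a} → a ⊧ p ∣ C → Isolated (p ↾ (C ∪ₑ (a ∷ []))) → Isolated (p ↾ C)
  isolated-regular {s} {C} {p} stable regular A⊆C cov invp {a} ra (φ , (m , o) , h) =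
    let b , rb = realization-countable p (cover-∪ₑ (a ∷ []) cov)
        Y , dY , e = def-abstract (a ∷ []) (def-over {C = C ∪ₑ (a ∷ [])} φ o)
        a∼b = realizations-∼ invp ra (realizes-⊆ inj₁ rb)
        defY : ∀ c → Defn (C ∪ₑ (c ∷ [])) (λ (x : Tuple (s ∷ [])) → Y (++⁺ x (c ∷ [])))
        defY c = def-inst (def-⊆ inj₁ dY) (c ∷ []) inj₂
        isolates : ∀ x → Y (x ∷ b ∷ []) → x ⊧ p ∣ C
        isolates x y = realizes λ θ (n , oθ) → sameType-def a∼b
          (def-∀ (def-→ dY (def-rearrange (def-over θ oθ) (here refl ∷ []))))
          (λ x y → h x (from (e (x ∷ [])) y) θ (n , λ v → inj₁ (oθ v))) x y
    in isolated-by cov (cover-∪ₑ (b ∷ []) (cover-∪ₑ (a ∷ []) cov))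
         (def-→ (def-¬ (def-⊆ inj₁ (defY a)))
                (def-⊆ (λ { (inj₁ c) → inj₁ (inj₁ c) ; (inj₂ k) → inj₂ k }) (defY b)))
         (λ x rx ¬y →
           -- If `x` depends on `a`, regularity keeps `b` generic over `C`, `a` and `x`. Dropping
           -- `a` and commuting makes `x` generic over `b`.
           let rb′ = regular-extend regular (cover-∪ₑ (a ∷ []) cov) (λ k → inj₁ (A⊆C k)) (realizes-⊆ A⊆C rx)
                       (λ r → ¬y (to (e (x ∷ [])) (satisfies r φ (m , o)))) rb
               rx′ = commute stable cov invp invp rx
                       (realizes-⊆ (λ { (inj₁ c) → inj₁ (inj₁ c) ; (inj₂ k) → inj₂ k }) rb′)
           in realizes-def rx′ (defY b) (invariant-∋ invp a∼b dY (contains m (λ x → to (e x)))))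
         (λ x y → dne λ k → k (isolates x (y λ ya →
           k (realizes-⊆ {D = C ∪ₑ (a ∷ [])} inj₁ (realizes (h x (from (e (x ∷ [])) ya)))))))

  regular-inv : ∀ {p : GlobalType N s} {A C} → Regular κ A p → A ⊆ C → Inv C p
  regular-inv (_ , i , _) A⊆C = invariant-⊆ A⊆C (inv i)

  module Family {A : Subset N} (covA : Cover ℕ A)
    {I : Set} (sortOf : I → Sort L) (p : ∀ i → GlobalType N (sortOf i))
    (orthogonal : ∀ i j → i ≢ j → Orthogonal (p i) (p j))
    (stable : ∀ i → GenericallyStable κ (p i))
    (regular : ∀ i → Regular κ A (p i))
    (Z : Set) (ix : Z → I) (code : Z ↣ ℕ) where

    # : Z → ℕ
    # = Injection.to code

    abstract
      private
        choose : ∀ z {B} → Cover ℕ B → Carrier (sortOf (ix z))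
        choose z cov = proj₁ (realization-countable (p (ix z)) cov)

        New : ∀ (n : ℕ) {B} → Cover ℕ B → Subset N
        New n cov y = Σ Z λ z → # z ≡ n × y ≡ (sortOf (ix z) , choose z cov)

        cover-New : ∀ (n : ℕ) {B} (cov : Cover ℕ B) → Cover ℕ (New n cov)
        cover-New n cov = cover-⊆ (λ (z , e , h) → (z , e) , h)
          (cover-subsingleton {J = Σ Z λ z → # z ≡ n} (λ (z , _) → sortOf (ix z) , choose z cov)
            λ { (z , e) (z′ , e′) → cong (λ z → sortOf (ix z) , choose z cov)
                                         (Injection.injective code (trans e (sym e′))) })

        -- A term is chosen generic over `A` and all terms of smaller code. Codes are injective, so
        -- a stage adds at most one term, and none if its number is not a code. The cover is carried
        -- along because the next realization requires a countable base.
        stage : ℕ → Σ (Subset N) (Cover ℕ)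
        stage zero    = A , covA
        stage (suc n) = let B , cov = stage n in B ∪ New n cov , cover-∪ cov (cover-New n cov)

      Base : ℕ → Subset N
      Base n = proj₁ (stage n)

      cover-Base : ∀ n → Cover ℕ (Base n)
      cover-Base n = proj₂ (stage n)

      term : ∀ z → Carrier (sortOf (ix z))
      term z = choose z (cover-Base (# z))

      term-realizes : ∀ z → term z ⊧ p (ix z) ∣ Base (# z)
      term-realizes z = proj₂ (realization-countable (p (ix z)) (cover-Base (# z)))

    termElem : Z → Elem
    termElem z = sortOf (ix z) , term z

    abstract
      Base-zero : Base zero ≡ A
      Base-zero = refl

      Base-⊆ : ∀ n → Base n ⊆ Base (suc n)
      Base-⊆ n = inj₁

      term-in : ∀ z → Base (suc (# z)) (termElem z)
      term-in z = inj₂ (z , refl , refl)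

      Base-suc : ∀ n {y} → Base (suc n) y → Base n y ⊎ (Σ Z λ z → # z ≡ n × y ≡ termElem z)
      Base-suc n (inj₁ b)                 = inj₁ b
      Base-suc n (inj₂ (z , refl , refl)) = inj₂ (z , refl , refl)

    A⊆Base : ∀ n → A ⊆ Base n
    A⊆Base zero    {y} a = subst (λ B → B y) (sym Base-zero) a
    A⊆Base (suc n) a     = Base-⊆ n (A⊆Base n a)

    term-in-< : ∀ {z n} → # z ℕ.< n → Base n (termElem z)
    term-in-< {z} {n} h = increasing-≤ {C = Base} Base-⊆ h (term-in z)

    Base-elim : ∀ n {y} → Base n y → A y ⊎ (Σ Z λ z → # z ℕ.< n × y ≡ termElem z)
    Base-elim zero {y} b = inj₁ (subst (λ B → B y) Base-zero b)
    Base-elim (suc n) b with Base-suc n b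
    ... | inj₂ (z , h , e) = inj₂ (z , ℕ.≤-reflexive (cong suc h) , e)
    ... | inj₁ b′ with Base-elim n b′
    ... | inj₁ a           = inj₁ a
    ... | inj₂ (z , h , e) = inj₂ (z , ℕ.m≤n⇒m≤1+n h , e)

    Basis : Subset N
    Basis y = ∃[ n ] Base n y

    cover-Basis : Cover ℕ Basis
    cover-Basis = cover-⋃ cover-Base

    isolated-⊆⊇ : ∀ {q : GlobalType N s} → C ⊆ D → D ⊆ C → Isolated (q ↾ C) → Isolated (q ↾ D)
    isolated-⊆⊇ i j (φ , (m , o) , h) = φ , (m , λ v → i (o v)) , λ x k ψ (n , o′) → h x k ψ (n , λ v → j (o′ v))

    -- Isolation descends one stage at a time. If a stage added a term, the term is removed by
    -- regularity when it belongs to `p i` itself and by orthogonality when it belongs to another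
    -- type.
    isolated-Base : ∀ i n → Isolated (p i ↾ Base n) → Isolated (p i ↾ A)
    isolated-Base i zero    iso = subst (λ B → Isolated (p i ↾ B)) Base-zero iso
    isolated-Base i (suc n) iso = isolated-Base i n (descend em)
      where
      descend : Dec (∃[ z ] # z ≡ n) → Isolated (p i ↾ Base n)
      descend (no h) = isolated-⊆⊇ {C = Base (suc n)} {D = Base n} {q = p i}
        (λ b → case (Base-suc n b)) (λ b → Base-⊆ n b) iso
        where
        case : ∀ {y} → Base n y ⊎ (Σ Z λ z → # z ≡ n × y ≡ termElem z) → Base n y
        case (inj₁ b)           = b
        case (inj₂ (z , e , _)) = ⊥-elim (h (z , e))
      descend (yes (z , refl)) = go em
        where
        onNew : ∀ {y} → Base n y ⊎ (Σ Z λ z′ → # z′ ≡ # z × y ≡ termElem z′) → (Base n ∪ₑ (term z ∷ [])) y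
        onNew (inj₁ b) = inj₁ b
        onNew (inj₂ (z′ , e , refl)) with refl ← Injection.injective code e = inj₂ (here refl , refl)
        iso′ : Isolated (p i ↾ (Base n ∪ₑ (term z ∷ [])))
        iso′ = isolated-⊆⊇ {C = Base (suc n)} {D = Base n ∪ₑ (term z ∷ [])} {q = p i} (λ b → onNew (Base-suc n b))
          (λ { (inj₁ b) → Base-⊆ n b ; (inj₂ (here refl , refl)) → term-in z }) iso
        go : Dec (ix z ≡ i) → Isolated (p i ↾ Base n)
        go (yes refl) = isolated-regular (stable i) (regular i) (λ a → A⊆Base n a) (cover-Base n)
          (regular-inv (regular i) (λ a → A⊆Base n a)) (term-realizes z) iso′
        go (no h) = isolated-orthogonal {p = p i} (stable i) (orthogonal (ix z) i h) (cover-Base n)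
          (regular-inv (regular i) (λ a → A⊆Base n a)) (regular-inv (regular (ix z)) (λ a → A⊆Base n a))
          (term-realizes z) iso′

    isolated-Basis : ∀ i → Isolated (p i ↾ Basis) → Isolated (p i ↾ A)
    isolated-Basis i (φ ⟨ b ⟩ , (m , o) , h) =
      let n , k = entries-bound Base-⊆ b (over-entries b o) in
      isolated-Base i n (φ ⟨ b ⟩ , (m , λ v → k (v , refl)) ,
        λ x y ψ (m′ , o′) → h x y ψ (m′ , λ v → n , o′ v))

    Others : Z → Subset N
    Others z y = A y ⊎ (Σ Z λ z′ → z′ ≢ z × y ≡ termElem z′)

    -- The other terms are added to the base in the order of their codes. Those with smaller code
    -- are covered by the choice of `term z`; a later one was chosen generic over `term z` and the
    -- terms before it, and commutation reverses this.
    term-independent : ∀ z → term z ⊧ p (ix z) ∣ Others z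
    term-independent z = realizes-⊆
      (λ { (inj₁ a) → 0 , inj₁ a ; (inj₂ (z′ , ne , e)) → _ , inj₂ (z′ , ne , ℕ.≤-refl , e) })
      (realizes-limit (λ n → λ { (inj₁ a) → inj₁ a ; (inj₂ (z′ , ne , h , e)) → inj₂ (z′ , ne , ℕ.m≤n⇒m≤1+n h , e) }) go)
      where
      F : ℕ → Subset N
      F n y = A y ⊎ (Σ Z λ z′ → z′ ≢ z × # z′ ℕ.< n × y ≡ termElem z′)
      F⊆Base : ∀ n → F n ⊆ Base n
      F⊆Base n (inj₁ a)                    = A⊆Base n a
      F⊆Base n (inj₂ (z′ , _ , h , refl)) = term-in-< h
      inv-F : ∀ n i → Inv (F n) (p i)
      inv-F n i = regular-inv (regular i) inj₁
      go : ∀ n → term z ⊧ p (ix z) ∣ F n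
      go zero    = realizes-⊆ (λ { (inj₁ a) → A⊆Base _ a ; (inj₂ (_ , _ , () , _)) }) (term-realizes z)
      go (suc n) = step n (go n) em
        where
        step : ∀ n → term z ⊧ p (ix z) ∣ F n → Dec (Σ Z λ z′ → z′ ≢ z × # z′ ≡ n) → term z ⊧ p (ix z) ∣ F (suc n)
        step n rn (no h) = realizes-⊆ (λ { (inj₁ a) → inj₁ a ; (inj₂ (z′ , ne , lt , e)) →
                     inj₂ (z′ , ne , ℕ.≤∧≢⇒< (ℕ.≤-pred lt) (λ e → h (z′ , ne , e)) , e) }) rn
        step n rn (yes (z′ , ne , refl)) with ℕ.<-cmp n (# z)
        ... | tri< lt _ _ = realizes-⊆ (λ f → increasing-≤ Base-⊆ lt (F⊆Base (suc n) f)) (term-realizes z)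
        ... | tri≈ _ e _  = ⊥-elim (ne (Injection.injective code e))
        ... | tri> _ _ gt = realizes-⊆
              (λ { (inj₁ a) → inj₁ (inj₁ a) ; (inj₂ (y , ne′ , lt , e)) → case y ne′ lt e })
              (commute (stable (ix z′)) (cover-⊆ (F⊆Base n) (cover-Base n)) (inv-F n _) (inv-F n _) rn
                (realizes-⊆ (λ { (inj₁ f) → F⊆Base n f ; (inj₂ (here refl , refl)) → term-in-< gt })
                  (term-realizes z′)))
          where
          case : ∀ y → y ≢ z → # y ℕ.< suc n → ∀ {x} → x ≡ termElem y → (F n ∪ₑ (term z′ ∷ [])) x
          case y ne′ lt refl with ℕ.m≤n⇒m<n∨m≡n (ℕ.≤-pred lt)
          ... | inj₁ lt′ = inj₁ (inj₂ (y , ne′ , lt′ , refl))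
          ... | inj₂ e with refl ← Injection.injective code e = inj₂ (here refl , refl)

    Own : I → Subset N
    Own i y = A y ⊎ (Σ Z λ z → ix z ≡ i × y ≡ termElem z)

    -- The terms of other types are added to the base one by one. Each is generic over what is
    -- already there, since `term-independent` lets all of `Own i` come first, so weak orthogonality
    -- keeps `c` generic.
    realizes-Basis : ∀ i {c} → c ⊧ p i ∣ Own i → c ⊧ p i ∣ Basis
    realizes-Basis i {c} rc = realizes-⊆ (λ { (n , b) → n , Base⊆G n b })
        (realizes-limit (λ n → λ { (inj₁ a) → inj₁ a ; (inj₂ (z , inj₁ h , e)) → inj₂ (z , inj₁ h , e)
                                 ; (inj₂ (z , inj₂ h , e)) → inj₂ (z , inj₂ (ℕ.m≤n⇒m≤1+n h) , e) }) go)
      where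
      G : ℕ → Subset N
      G n y = A y ⊎ (Σ Z λ z → (ix z ≡ i ⊎ # z ℕ.< n) × y ≡ termElem z)
      Base⊆G : ∀ n → Base n ⊆ G n
      Base⊆G n b with Base-elim n b
      ... | inj₁ a           = inj₁ a
      ... | inj₂ (z , h , e) = inj₂ (z , inj₂ h , e)
      G⊆Basis : ∀ n → G n ⊆ Basis
      G⊆Basis n (inj₁ a)              = 0 , A⊆Base 0 a
      G⊆Basis n (inj₂ (z , _ , refl)) = suc (# z) , term-in z
      inv-G : ∀ n j → Inv (G n) (p j)
      inv-G n j = regular-inv (regular j) inj₁
      go : ∀ n → c ⊧ p i ∣ G n
      go zero    = realizes-⊆ (λ { (inj₁ a) → inj₁ a ; (inj₂ (z , inj₁ h , e)) → inj₂ (z , h , e)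
                                 ; (inj₂ (_ , inj₂ () , _)) }) rc
      go (suc n) = step n (go n) em
        where
        step : ∀ n → c ⊧ p i ∣ G n → Dec (Σ Z λ z → # z ≡ n) → c ⊧ p i ∣ G (suc n)
        step n rn (no h) = realizes-⊆ (λ { (inj₁ a) → inj₁ a ; (inj₂ (z , inj₁ h , e)) → inj₂ (z , inj₁ h , e)
              ; (inj₂ (z , inj₂ lt , e)) → inj₂ (z , inj₂ (ℕ.≤∧≢⇒< (ℕ.≤-pred lt) (λ e → h (z , e))) , e) }) rn
        step n rn (yes (z , refl)) with em {ix z ≡ i}
        ... | yes own = realizes-⊆ (λ { (inj₁ a) → inj₁ a ; (inj₂ (y , inj₁ h , e)) → inj₂ (y , inj₁ h , e)
              ; (inj₂ (y , inj₂ lt , e)) → inj₂ (y , case y lt , e) }) rn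
          where
          case : ∀ y → # y ℕ.< suc n → ix y ≡ i ⊎ # y ℕ.< n
          case y lt with ℕ.m≤n⇒m<n∨m≡n (ℕ.≤-pred lt)
          ... | inj₁ lt′ = inj₂ lt′
          ... | inj₂ e with refl ← Injection.injective code e = inj₁ own
        ... | no foreign = realizes-⊆ (λ { (inj₁ a) → inj₁ (inj₁ a)
              ; (inj₂ (y , inj₁ h , e)) → inj₁ (inj₂ (y , inj₁ h , e)) ; (inj₂ (y , inj₂ lt , e)) → case y lt e })
              (weakly-orthogonal (stable i) (orthogonal (ix z) i foreign) (cover-⊆ (G⊆Basis n) cover-Basis)
                (inv-G n _) (inv-G n _)
                (realizes-⊆ (λ { (inj₁ a) → inj₁ a ; (inj₂ (y , h , e)) → inj₂ (y , distinct y h , e) })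
                  (term-independent z)) rn)
          where
          distinct : ∀ y → ix y ≡ i ⊎ # y ℕ.< n → y ≢ z
          distinct y (inj₁ h)  refl = foreign h
          distinct y (inj₂ lt) refl = ℕ.<-irrefl refl lt
          case : ∀ y → # y ℕ.< suc n → ∀ {x} → x ≡ termElem y → (G n ∪ₑ (term z ∷ [])) x
          case y lt refl with ℕ.m≤n⇒m<n∨m≡n (ℕ.≤-pred lt)
          ... | inj₁ lt′ = inj₁ (inj₂ (y , inj₂ lt′ , refl))
          ... | inj₂ e with refl ← Injection.injective code e = inj₂ (here refl , refl)

  -- Exchange and the Steinitz inequality for a regular type

  module _ {p : GlobalType N s} {A : Subset N} (stable : GenericallyStable κ p) (regular : Regular κ A p) where

    -- Adding `x` to the base costs at most one term. The term dropped is the earliest that ceases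
    -- to be generic; by commutation `x` then depends on the terms up to it, and from there on
    -- regularity keeps all later terms generic. The dependence of `x` is returned because
    -- regularity requires it in the recursion.
    exchange : ∀ {B x k} {e : Tuple (replicate k s)} → Cover ℕ B → A ⊆ B → x ⊧ p ∣ A → Mor {p = p} B {k} e →
      Mor {p = p} (B ∪ₑ (x ∷ [])) {k} e ⊎
      (¬ (x ⊧ p ∣ B ∪ₑ e) × Σ ℕ λ j → Σ (Tuple (replicate j s)) λ f →
        k ≡ suc j × entries f ⊆ entries e × Mor {p = p} (B ∪ₑ (x ∷ [])) {j} f)
    exchange cov i rx [] = inj₁ []
    exchange {B} {x} cov i rx (_∷_ {x = y} {e = e} ry m) with exchange cov i rx m
    ... | inj₂ (nx , j , f , refl , sub , m′) = inj₂
        ((λ r → nx (realizes-⊆ (λ { (inj₁ b) → inj₁ b ; (inj₂ (v , h)) → inj₂ (there v , h) }) r)) ,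
         suc j , y ∷ f , refl , (λ { (here refl , h) → here refl , h
                                   ; (there v , h) → let w , h′ = sub (v , h) in there w , h′ }) ,
         realizes-⊆ (λ { (inj₁ (inj₁ b)) → inj₁ (inj₁ b) ; (inj₁ (inj₂ h)) → inj₂ h ; (inj₂ h) → inj₁ (inj₂ (sub h)) })
           (regular-extend regular (cover-∪ₑ e cov) (λ a → inj₁ (i a)) rx nx ry) ∷ m′)
    ... | inj₁ m′ with em {y ⊧ p ∣ (B ∪ₑ (x ∷ [])) ∪ₑ e}
    ... | yes ry′ = inj₁ (ry′ ∷ m′)
    ... | no ¬ry = inj₂ ((λ r → ¬ry (realizes-⊆
            (λ { (inj₁ (inj₁ b)) → inj₁ (inj₁ b) ; (inj₁ (inj₂ h)) → inj₂ h ; (inj₂ h) → inj₁ (inj₂ h) })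
            (commute stable (cover-∪ₑ e cov) (regular-inv regular (λ a → inj₁ (i a)))
              (regular-inv regular (λ a → inj₁ (i a))) ry
              (realizes-⊆ (λ { (inj₁ (inj₁ b)) → inj₁ b ; (inj₁ (inj₂ (v , h))) → inj₂ (there v , h)
                             ; (inj₂ (here refl , h)) → inj₂ (here refl , h) }) r)))) ,
          _ , e , refl , (λ (v , h) → there v , h) , m′)

    private
      realizes-∷ : ∀ {B : Subset N} {n} {x y : Carrier s} {X : Tuple (replicate n s)} →
                   y ⊧ p ∣ B ∪ₑ (x ∷ []) ∪ₑ X → y ⊧ p ∣ B ∪ₑ (x ∷ X)
      realizes-∷ = realizes-⊆ λ where
        (inj₁ b)               → inj₁ (inj₁ b)
        (inj₂ (here refl , h)) → inj₁ (inj₂ (here refl , h))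
        (inj₂ (there v , h))   → inj₂ (v , h)

    -- The elements of `X` are moved into the base one after the other, each at the cost of at most
    -- one term of `e`. Once `X` is used up, a remaining term would be generic over the base and
    -- dependent on it.
    steinitz : ∀ n (X : Tuple (replicate n s)) → (∀ x → entries X (s , x) → x ⊧ p ∣ A) →
      ∀ {B k} {e : Tuple (replicate k s)} → Cover ℕ B → A ⊆ B → Mor {p = p} B {k} e →
      (∀ y → entries e (s , y) → ¬ (y ⊧ p ∣ B ∪ₑ X)) → k ℕ.≤ n
    steinitz n       X       rX cov i []       dep = ℕ.z≤n
    steinitz zero    []      rX cov i (r ∷ m)  dep =
      ⊥-elim (dep _ (here refl , refl) (realizes-[] (realizes-⊆ inj₁ r)))
    steinitz (suc n) (x ∷ X) rX {B} cov i m@(_ ∷ _) dep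
      with exchange cov i (rX x (here refl , refl)) m
    ... | inj₁ m′ = ℕ.m≤n⇒m≤1+n (steinitz n X (λ y (v , h) → rX y (there v , h)) (cover-∪ₑ (x ∷ []) cov)
                      (λ a → inj₁ (i a)) m′ (λ y h r → dep y h (realizes-∷ {n = n} r)))
    ... | inj₂ (_ , j , f , refl , sub , m′) = ℕ.s≤s (steinitz n X (λ y (v , h) → rX y (there v , h))
                      (cover-∪ₑ (x ∷ []) cov) (λ a → inj₁ (i a)) m′ (λ y h r → dep y (sub h) (realizes-∷ {n = n} r)))

-- Omitting types inside the monster

module Omitting
  (em : ExcludedMiddle 0ℓ) (wo : WellOrdering) {L : Language} (N : Structure L)
  (κ : Set) (ℕ≺κ : ≡.setoid ℕ ≺ ≡.setoid κ)
  (sat : ∀ {P} → Tiny κ P → ∀ {C} → Covers.Cover em wo N (Covers.Ix em wo N P) C →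
         Covers.SatAt em wo N C)
  (formulas : ∀ {C : Subset N} {Γ} → Covers.Cover em wo N ℕ C → ℕ → Maybe (Σ (ParamFormula N Γ) (Over C)))
  (formulas-complete : ∀ {C : Subset N} {Γ} (cov : Covers.Cover em wo N ℕ C) (φ : ParamFormula N Γ) → Over C φ →
     ∃₂ λ n ψ → formulas cov n ≡ just ψ × (∀ a → (a ⊩ φ) ⇔ (a ⊩ proj₁ ψ)))
  where
  open Structure N
  open Definability em N
  open Covers em wo N
  open Types em wo N
  open Stability em wo N κ ℕ≺κ sat
  open Independence em wo N κ ℕ≺κ sat

  module _ {I : Set} (code : I ↣ ℕ) (Γ : I → List (Sort L)) {C : Subset N} (cov : Cover ℕ C) where

    -- Used in two ways: with `I` indexing the types to be omitted, for formulas relating a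
    -- realization to the new element, and with `I` indexing sorts, for formulas to be solved.
    Request : Set
    Request = Σ I λ i → Σ (ParamFormula N (Γ i)) (Over C)

    abstract
      requests : ℕ → Maybe Request
      requests k = enumeration em (Injection.to code) (proj₁ (unpair k)) >>= λ i →
                   Maybe.map (i ,_) (formulas cov (proj₂ (unpair k)))

      requests-complete : ∀ i (φ : ParamFormula N (Γ i)) → Over C φ →
        ∃₂ λ k ψ → requests k ≡ just (i , ψ) × (∀ a → (a ⊩ φ) ⇔ (a ⊩ proj₁ ψ))
      requests-complete i φ o with enumeration-complete em (Injection.to code) i
      ... | m , i′ , e , h with refl ← Injection.injective code h =
        let n , ψ , e′ , k = formulas-complete cov φ o in
        pair m n , ψ , trans (cong (λ u → enumeration em (Injection.to code) (proj₁ u) >>= λ i →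
                                           Maybe.map (i ,_) (formulas cov (proj₂ u))) (unpair-pair m n))
                         (trans (cong (_>>= λ i → Maybe.map (i ,_) (formulas cov n)) e)
                                (cong (Maybe.map (i ,_)) e′)) , k

  module _ {I : Set} (code : I ↣ ℕ) (sortOf : I → Sort L) (p : ∀ i → GlobalType N (sortOf i))
           {B : Subset N} (covB : Cover ℕ B) (nonisolated : ∀ i → ¬ Isolated (p i ↾ B)) where

    -- The invariant of the construction: no consistent formula over `C` has only realizations of
    -- `p i ↾ B` as solutions. For the formula that says x = c it states that `c` omits the type.
    record Good (C : Subset N) : Set where
      field
        base     : B ⊆ C
        omitting : ∀ i (φ : ParamFormula N (sortOf i ∷ [])) → Over C φ → ∀ x → (x ∷ []) ⊩ φ →
                   ∃[ y ] (y ∷ []) ⊩ φ × ¬ (y ⊧ p i ∣ B)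
    open Good

    omitting-def : ∀ {C} → Good C → ∀ i {X : Tuple (sortOf i ∷ []) → Set} → Defn C X → ∀ x → X (x ∷ []) →
                   ∃[ y ] X (y ∷ []) × ¬ (y ⊧ p i ∣ B)
    omitting-def g i (defn φ o h) x k =
      let y , f , r = omitting g i φ o x (from (h _) k) in y , to (h _) f , r

    -- A consistent formula over `B` with only realizations of `p i ↾ B` as solutions belongs to
    -- `p i`, since a solution would otherwise have to satisfy its negation; it then isolates
    -- `p i ↾ B`.
    good-B : Good B
    base     good-B b = b
    omitting good-B i φ o x k = dne λ none →
      let all y f = dne λ r → none (y , f , r)
      in nonisolated i (isolating all)
      where
      isolating : (∀ y → (y ∷ []) ⊩ φ → y ⊧ p i ∣ B) → Isolated (p i ↾ B)
      isolating all with GlobalType.complete (p i) φ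
      ... | inj₁ m = φ , (m , o) , λ y f → satisfies (all y f)
      ... | inj₂ m = ⊥-elim (satisfies (all x k) (neg φ) (m , o) k)

    good-⋃ : ∀ {C : ℕ → Subset N} → (∀ n → C n ⊆ C (suc n)) → (∀ n → Good (C n)) → Good (λ y → ∃[ n ] C n y)
    base     (good-⋃ i g) b = 0 , base (g 0) b
    omitting (good-⋃ {C} i g) j (φ ⟨ b ⟩) o =
      let n , o′ = entries-bound i b (over-entries {C = λ y → ∃[ n ] C n y} b o)
      in omitting (g n) j (φ ⟨ b ⟩) (λ v → o′ (v , refl))

    module Step {C : Subset N} (cov : Cover ℕ C) (good : Good C) (t : Sort L) where

      State : Set
      State = Σ (ParamFormula N (t ∷ [])) λ φ → Over C φ × ∃ (_⊩ φ)

      -- ψ prevents τ(x,y), for every realization y of ψ, from isolating p i ↾ B.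
      data Meets (r : Request code (λ i → sortOf i ∷ t ∷ []) cov) (ψ : State) : Set where
        avoids : (∀ y → (y ∷ []) ⊩ proj₁ ψ → ¬ (∃[ x ] (x ∷ y ∷ []) ⊩ proj₁ (proj₂ r))) → Meets r ψ
        omits  : ∀ θ → (p (proj₁ r) ↾ B) θ →
                 (∀ y → (y ∷ []) ⊩ proj₁ ψ → ∃[ x ] (x ∷ y ∷ []) ⊩ proj₁ (proj₂ r) × ¬ (x ∷ []) ⊩ θ) →
                 Meets r ψ

      Refines : State → Request code (λ i → sortOf i ∷ t ∷ []) cov → Set
      Refines φ r = Σ State λ ψ → (∀ a → a ⊩ proj₁ ψ → a ⊩ proj₁ φ) × Meets r ψ

      refineTo : ∀ φ r {X : Tuple (t ∷ []) → Set} → Defn C X → ∃ X → (∀ a → X a → a ⊩ proj₁ φ) →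
                 (∀ (ψ : State) → (∀ a → a ⊩ proj₁ ψ → X a) → Meets r ψ) → Refines φ r
      refineTo φ r (defn ψ o h) (a , k) i m =
        (ψ , o , a , from (h a) k) , (λ a f → i a (to (h a) f)) , m (ψ , o , a , from (h a) k) (λ a → to (h a))

      counterexample : ∀ i {x} → ¬ (x ⊧ p i ∣ B) → ∃[ θ ] (p i ↾ B) θ × ¬ (x ∷ []) ⊩ θ
      counterexample i {x} r = dne λ none → r (realizes λ θ m → dne λ ¬θ → none (θ , m , ¬θ))

      abstract
        -- Either some solution y of `φ` makes τ(·,y) empty, and this is added to `φ`. Or the set of
        -- all x with τ(x,y) for some such y is nonempty and over `C`; goodness gives an x in it at
        -- which some `θ` of `p i ↾ B` fails, and the existence of such an x is added to `φ`.
        refine : ∀ φ r → Refines φ r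
        refine (φ , o , y₀ ∷ [] , k₀) (i , τ , oτ) = decide em
          where
          dφ : Defn C (_⊩ φ)
          dφ = def-over φ o
          dτ : Defn C (_⊩ τ)
          dτ = def-over τ oτ
          avoiding : ∃[ a ] a ⊩ φ × ¬ (∃[ x ] (x ∷ a) ⊩ τ) → Refines (φ , o , y₀ ∷ [] , k₀) (i , τ , oτ)
          avoiding w = refineTo (φ , o , y₀ ∷ [] , k₀) (i , τ , oτ) (def-× dφ (def-¬ (def-∃ dτ))) w (λ a → proj₁)
            (λ ψ h → avoids λ y f → proj₂ (h (y ∷ []) f))
          omitting-by : ∀ θ → (p i ↾ B) θ → ∃[ a ] a ⊩ φ × (∃[ x ] (x ∷ a) ⊩ τ × ¬ (x ∷ []) ⊩ θ) →
                        Refines (φ , o , y₀ ∷ [] , k₀) (i , τ , oτ)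
          omitting-by θ m w = refineTo (φ , o , y₀ ∷ [] , k₀) (i , τ , oτ)
            (def-× dφ (def-∃ (def-× dτ (def-¬ dθ))))
            w (λ a → proj₁)
            (λ ψ h → omits θ m λ y f → proj₂ (h (y ∷ []) f))
            where
            dθ : Defn C {sortOf i ∷ t ∷ []} (λ a → rearrange (here refl ∷ []) a ⊩ θ)
            dθ = def-rearrange (def-over {C = C} θ (λ v → base good (proj₂ m v))) (here refl ∷ [])
          witness : ∃[ x ] (∃[ y ] (y ∷ []) ⊩ φ × (x ∷ y ∷ []) ⊩ τ) →
                    ∃[ x ] (∃[ y ] (y ∷ []) ⊩ φ × (x ∷ y ∷ []) ⊩ τ) × ¬ (x ⊧ p i ∣ B)
          witness (x , w) = omitting-def good i {X = λ a → ∃[ y ] (y ∷ []) ⊩ φ × (All.lookup a (here refl) ∷ y ∷ []) ⊩ τ}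
            (def-∃ (def-× (def-rearrange dφ (here refl ∷ [])) (def-rearrange dτ swap))) x w
          decide : Dec (∃[ a ] a ⊩ φ × ¬ (∃[ x ] (x ∷ a) ⊩ τ)) → Refines (φ , o , y₀ ∷ [] , k₀) (i , τ , oτ)
          decide (yes w)   = avoiding w
          decide (no none) =
            let x₀ , h₀ = dne λ h → none (y₀ ∷ [] , k₀ , h)
                x , (y , f , g) , r = witness (x₀ , y₀ , k₀ , h₀)
                θ , m , ¬θ = counterexample i r
            in omitting-by θ m (y ∷ [] , f , x , g , ¬θ)

      module _ (φ₀ : State) where

        advance : Maybe (Request code (λ i → sortOf i ∷ t ∷ []) cov) → State → State
        advance nothing  φ = φ
        advance (just r) φ = proj₁ (refine φ r)

        chain : ℕ → State
        chain zero    = φ₀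
        chain (suc k) = advance (requests code (λ i → sortOf i ∷ t ∷ []) cov k) (chain k)

        advance-implies : ∀ r φ a → a ⊩ proj₁ (advance r φ) → a ⊩ proj₁ φ
        advance-implies nothing  φ a f = f
        advance-implies (just r) φ a f = proj₁ (proj₂ (refine φ r)) a f

        chain-implies : ∀ {j k} → j ℕ.≤ k → ∀ a → a ⊩ proj₁ (chain k) → a ⊩ proj₁ (chain j)
        chain-implies h = go (ℕ.≤⇒≤′ h)
          where
          go : ∀ {j k} → j ℕ.≤′ k → ∀ a → a ⊩ proj₁ (chain k) → a ⊩ proj₁ (chain j)
          go (ℕ.≤′-reflexive refl) a f = f
          go (ℕ.≤′-step {k} h)     a f =
            go h a (advance-implies (requests code (λ i → sortOf i ∷ t ∷ []) cov k) (chain k) a f)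

        chain-meets : ∀ {k r} → requests code (λ i → sortOf i ∷ t ∷ []) cov k ≡ just r → Meets r (chain (suc k))
        chain-meets {k} {r} e = subst (λ r′ → Meets r (advance r′ (chain k))) (sym e)
          (proj₂ (proj₂ (refine (chain k) r)))

        -- `c` realizes the whole decreasing chain. A formula over `C` and `c` has the form τ(x,c)
        -- with τ over `C`, so it is a request up to equivalence, and the stage that met this
        -- request supplies a solution omitting `p i ↾ B`.
        generic : ∃[ c ] (c ∷ []) ⊩ proj₁ φ₀ × Good (C ∪ₑ (c ∷ []))
        generic with countable-sat cov (t ∷ []) (λ k a → a ⊩ proj₁ (chain k))
                       (λ k → def-over {C = C} (proj₁ (chain k)) (proj₁ (proj₂ (chain k))))
                       (λ ks → let n , h = maximum id ks ; a , f = proj₂ (proj₂ (chain n)) in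
                         a , All.map (λ h → chain-implies {k = n} (ℕ.<⇒≤ h) a f) h)
        ... | c ∷ [] , holds = c , holds 0 , record { base = λ b → inj₁ (base good b) ; omitting = omitted }
          where
          omitted : ∀ i (φ : ParamFormula N (sortOf i ∷ [])) → Over (C ∪ₑ (c ∷ [])) φ →
                    ∀ x → (x ∷ []) ⊩ φ → ∃[ y ] (y ∷ []) ⊩ φ × ¬ (y ⊧ p i ∣ B)
          omitted i φ o x f with def-abstract {C = C} (c ∷ []) (def-over φ o)
          ... | Y , defn τ oτ hτ , e with requests-complete code (λ i → sortOf i ∷ t ∷ []) cov i τ oτ
          ... | k , (τ′ , _) , q , h with chain-meets {k} q
          ... | avoids none = ⊥-elim (none c (holds (suc k)) (x ,
                  to (h (x ∷ c ∷ [])) (from (hτ (x ∷ c ∷ [])) (to (e (x ∷ [])) f))))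
          ... | omits θ m some =
            let y , g , ¬θ = some c (holds (suc k)) in
            y , from (e (y ∷ [])) (to (hτ (y ∷ c ∷ [])) (from (h (y ∷ c ∷ [])) g)) ,
            λ r → ¬θ (satisfies r θ m)

    record Stage : Set₁ where
      field
        set   : Subset N
        cover : Cover ℕ set
        good  : Good set
    open Stage

    module Closing {T : Set} (codeT : T ↣ ℕ) (tsort : T → Sort L) where

      private
        TRequest : ∀ {C} → Cover ℕ C → Set
        TRequest = Request codeT (λ t → tsort t ∷ [])

      -- The requests are formulas over the fixed `C`, while each solution is added generically over
      -- the current `D`, which keeps it good. The inclusion makes a request over `C` one over `D`.
      Extends : Stage → Set₁
      Extends C = Σ Stage λ D → set C ⊆ set D

      solve : ∀ {C} → TRequest (cover C) → Extends C → Extends C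
      solve {C} (t , φ , o) (D , i) = decide em
        where
        decide : Dec (∃ (_⊩ φ)) → Extends C
        decide (no _)  = D , i
        decide (yes w) =
          let c , _ , g = Step.generic (cover D) (good D) (tsort t) (φ , (λ v → i (o v)) , w) in
          record { set = set D ∪ₑ (c ∷ []) ; cover = cover-∪ₑ (c ∷ []) (cover D) ; good = g } , λ b → inj₁ (i b)

      solve-⊆ : ∀ {C} r (D : Extends C) → set (proj₁ D) ⊆ set (proj₁ (solve {C} r D))
      solve-⊆ (t , φ , o) D d with em {∃ (_⊩ φ)}
      ... | yes _ = inj₁ d
      ... | no _  = d

      solve-solves : ∀ {C} t (φ : ParamFormula N (tsort t ∷ [])) (o : Over (set C) φ) (D : Extends C) → ∃ (_⊩ φ) →
                     ∃[ c ] set (proj₁ (solve {C} (t , φ , o) D)) (tsort t , c) × (c ∷ []) ⊩ φ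
      solve-solves t φ o (D , i) w with em {∃ (_⊩ φ)}
      ... | no h  = ⊥-elim (h w)
      ... | yes w =
        let c , f , _ = Step.generic (cover D) (good D) (tsort t) (φ , (λ v → i (o v)) , w) in
        c , inj₂ (here refl , refl) , f

      module _ (C : Stage) where

        solveMaybe : Maybe (TRequest (cover C)) → Extends C → Extends C
        solveMaybe nothing  D = D
        solveMaybe (just r) D = solve {C} r D

        solved : ℕ → Extends C
        solved zero    = C , id
        solved (suc k) = solveMaybe (requests codeT (λ t → tsort t ∷ []) (cover C) k) (solved k)

        solved-⊆ : ∀ k → set (proj₁ (solved k)) ⊆ set (proj₁ (solved (suc k)))
        solved-⊆ k d with requests codeT (λ t → tsort t ∷ []) (cover C) k
        ... | nothing = d
        ... | just r  = solve-⊆ {C} r (solved k) d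

        closure : Stage
        closure = record
          { set   = λ y → ∃[ k ] set (proj₁ (solved k)) y
          ; cover = cover-⋃ (λ k → cover (proj₁ (solved k)))
          ; good  = good-⋃ (λ k → solved-⊆ k) (λ k → good (proj₁ (solved k))) }

        closure-solves : ∀ t (φ : ParamFormula N (tsort t ∷ [])) → Over (set C) φ → ∃ (_⊩ φ) →
                         ∃[ c ] set closure (tsort t , c) × (c ∷ []) ⊩ φ
        closure-solves t φ o w with requests-complete codeT (λ t → tsort t ∷ []) (cover C) t φ o
        ... | k , (ψ , oψ) , e , h =
          let c , d , f = solution k e in c , (suc k , d) , from (h (c ∷ [])) f
          where
          solution : ∀ k → requests codeT (λ t → tsort t ∷ []) (cover C) k ≡ just (t , ψ , oψ) →
                     ∃[ c ] set (proj₁ (solved (suc k))) (tsort t , c) × (c ∷ []) ⊩ ψ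
          solution k e rewrite e = solve-solves {C} t ψ oψ (solved k) (let a , f = w in a , to (h a) f)

      -- One closure solves the formulas over the set it starts from, but not those over the
      -- elements it adds. In the union of the iterates every formula has its finitely many
      -- parameters in some stage and is solved in the next.
      closures : ℕ → Stage
      closures zero    = record { set = B ; cover = covB ; good = good-B }
      closures (suc n) = closure (closures n)

      closures-⊆ : ∀ n → set (closures n) ⊆ set (closures (suc n))
      closures-⊆ n c = 0 , c

      model : Stage
      model = record
        { set   = λ y → ∃[ n ] set (closures n) y
        ; cover = cover-⋃ (λ n → cover (closures n))
        ; good  = good-⋃ closures-⊆ (λ n → good (closures n)) }

      model-solves : ∀ t {X : Tuple (tsort t ∷ []) → Set} → Defn (set model) X → ∃ X →
                     ∃[ c ] set model (tsort t , c) × X (c ∷ [])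
      model-solves t (defn (φ ⟨ b ⟩) o h) (a , x) =
        let n , o′  = entries-bound closures-⊆ b (over-entries {C = set model} b o)
            c , d , f = closure-solves (closures n) t (φ ⟨ b ⟩) (λ v → o′ (v , refl)) (a , from (h a) x)
        in c , (suc n , d) , to (h (c ∷ [])) f

      model-solves* : ∀ ts {X : Tuple (map tsort ts) → Set} → Defn (set model) X → ∃ X →
                      ∃[ a ] entries a ⊆ set model × X a
      model-solves* []       d ([] , x)    = [] , (λ { (() , _) }) , x
      model-solves* (t ∷ ts) d (x ∷ b , k) =
        let b′ , i , w     = model-solves* ts (def-∃ d) (b , x , k)
            c , j , k′     = model-solves t (def-inst d b′ i) (let x , k = w in x ∷ [] , k)
        in c ∷ b′ , (λ { (here refl , refl) → j ; (there v , e) → i (v , e) }) , k′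

-- Invariance of dimension

lookup-injective : ∀ {X : Set} {xs : List X} → Unique xs → ∀ i j → List.lookup xs i ≡ List.lookup xs j → i ≡ j
lookup-injective (_ ∷ _)   zero    zero    e = refl
lookup-injective (x∉ ∷ _)  zero    (suc j) e = ⊥-elim (All.lookup x∉ (∈-lookup j) e)
lookup-injective (x∉ ∷ _)  (suc i) zero    e = ⊥-elim (All.lookup x∉ (∈-lookup i) (sym e))
lookup-injective (_ ∷ u)   (suc i) (suc j) e = cong suc (lookup-injective u i j e)

module Dimension
  (em : ExcludedMiddle 0ℓ) (wo : WellOrdering) {L : Language} (N : Structure L)
  (κ : Set) (ℕ≺κ : ≡.setoid ℕ ≺ ≡.setoid κ)
  (sat : ∀ {P} → Tiny κ P → ∀ {C} → Covers.Cover em wo N (Covers.Ix em wo N P) C →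
         Covers.SatAt em wo N C) where
  open Structure N
  open Definability em N
  open Covers em wo N
  open Types em wo N
  open Stability em wo N κ ℕ≺κ sat

  open Independence em wo N κ ℕ≺κ sat

  open Families em wo N κ ℕ≺κ sat

  -- Lists a finite initial segment downwards, as the tuples in `Mor` do. The second condition of
  -- `extend` rules out gaps, so that the least index missing from the list lies above all listed
  -- ones.
  data Initial (α : WellOrder) : List (WellOrder.Index α) → Set where
    []     : Initial α []
    extend : ∀ {j js} → (∀ i → i ∈ js → WellOrder._<_ α i j) → (∀ i → WellOrder._<_ α i j → i ∈ js) →
             Initial α js → Initial α (j ∷ js)

  module _ (α : WellOrder) where
    open WellOrder α
    open WellOrdered em isStrictTotalOrder wellFounded using (least)
    open IsStrictTotalOrder isStrictTotalOrder using (compare; irrefl)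

    initial-closed : ∀ {js} → Initial α js → ∀ {i j} → j ∈ js → i < j → i ∈ js
    initial-closed (extend _ h ini) (here refl) lt = there (h _ lt)
    initial-closed (extend _ h ini) (there m)   lt = there (initial-closed ini m lt)

    initial-unique : ∀ {js} → Initial α js → Unique js
    initial-unique []               = []
    initial-unique (extend h _ ini) = All.tabulate (λ {i} m e → irrefl (sym e) (h i m)) ∷ initial-unique ini

    initial-extend : ∀ {js} → Initial α js → (∃[ j ] ¬ j ∈ js) → ∃[ j ] Initial α (j ∷ js)
    initial-extend {js} ini w with least (λ j → ¬ j ∈ js) w
    ... | j , j∉js , min = j , extend below (λ i lt → dne λ i∉js → min i i∉js lt) ini
      where
      below : ∀ i → i ∈ js → i < j
      below i m with compare i j
      ... | tri< lt _ _   = lt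
      ... | tri≈ _ refl _ = ⊥-elim (j∉js m)
      ... | tri> _ _ gt   = ⊥-elim (j∉js (initial-closed ini m gt))

    -- Lets an arbitrary well-order be examined through finite segments: either some segment is
    -- everything, or there is one of the required length `k`.
    initial-lists : ∀ k → (∃[ js ] Initial α js × (∀ j → j ∈ js)) ⊎ (∃[ js ] Initial α js × List.length js ≡ k)
    initial-lists zero    = inj₂ ([] , [] , refl)
    initial-lists (suc k) with initial-lists k
    ... | inj₁ h = inj₁ h
    ... | inj₂ (js , ini , refl) with em {∃[ j ] ¬ j ∈ js}
    ... | yes w = let j , ini′ = initial-extend ini w in inj₂ (j ∷ js , ini′ , refl)
    ... | no h  = inj₁ (js , ini , λ j → dne λ n → h (j , n))

    initial-↔ : ∀ {js} → Initial α js → (∀ j → j ∈ js) → Index ↔ Fin (List.length js)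
    initial-↔ {js} ini all = mk↔ₛ′ (λ j → index (all j)) (List.lookup js)
      (λ i → lookup-injective (initial-unique ini) _ _ (sym (lookup-index (all (List.lookup js i)))))
      (λ j → sym (lookup-index (all j)))

  module _ {s} {p : GlobalType N s} {A U : Subset N} (covA : Cover ℕ A)
           (stable : GenericallyStable κ p) (regular : Regular κ A p) where

    module _ (m : MaximalMorley p A U) where
      open MaximalMorley m

      private
        terms : (js : List Index) → Tuple (replicate (List.length js) s)
        terms []       = []
        terms (j ∷ js) = sequence j ∷ terms js

        entries-terms : ∀ js {x} → entries (terms js) (s , x) → ∃[ j ] j ∈ js × x ≡ sequence j
        entries-terms (j ∷ js) (here refl , refl) = j , here refl , refl
        entries-terms (j ∷ js) (there v , e)      = let i , h , e′ = entries-terms js (v , e) in i , there h , e′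

        sort-terms : ∀ js {y} → entries (terms js) y → proj₁ y ≡ s
        sort-terms (j ∷ js) (here refl , _) = refl
        sort-terms (j ∷ js) (there v , e)   = sort-terms js (v , e)

        terms-entries : ∀ {js j} → j ∈ js → entries (terms js) (s , sequence j)
        terms-entries (here refl) = here refl , refl
        terms-entries (there h)   = let v , e = terms-entries h in there v , e

        initial-mor : ∀ {js} → Initial order js → Mor {p = p} A {List.length js} (terms js)
        initial-mor []                                 = []
        initial-mor (extend {j} {js} h _ ini) = realizes-⊆
          (λ { (inj₁ a) → inj₁ a ; {_ , x} (inj₂ k) → inj₂ (earlier k (sort-terms js k)) })
          (realizes {C = A ∪ range {M = N} sequence (λ i → i < j)} (morley j)) ∷ initial-mor ini
          where
          earlier : ∀ {y} → entries (terms js) y → proj₁ y ≡ s → range {M = N} sequence (λ i → i < j) y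
          earlier k refl = let i , i∈js , e = entries-terms js k in i , h i i∈js , cong (s ,_) e

      -- An initial segment of n+1 terms would violate the Steinitz inequality against the spanning
      -- `X`; this also excludes infinite index sets. So a finite list exhausts the order, and the
      -- inequality in both directions gives its length.
      dimension-unique : ∀ {n} (X : Tuple (replicate n s)) → Mor {p = p} A {n} X →
        (∀ x → entries X (s , x) → U (s , x)) → (∀ x → entries X (s , x) → x ⊧ p ∣ A) →
        (∀ c → U (s , c) → ¬ (c ⊧ p ∣ A ∪ₑ X)) → Index ↔ Fin n
      dimension-unique {n} X mor inU rX spans with initial-lists order (suc n)
      ... | inj₂ (js , ini , e) = ⊥-elim (ℕ.<-irrefl refl (ℕ.≤-trans (ℕ.≤-reflexive (sym e))
              (steinitz stable regular n X rX covA id (initial-mor ini) λ y k →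
                let j , _ , e = entries-terms js k in spans y (subst (λ y → U (s , y)) (sym e) (inside j)))))
      ... | inj₁ (js , ini , all) with ℕ.≤-antisym
              (steinitz stable regular n X rX covA id (initial-mor ini) λ y k →
                let j , _ , e = entries-terms js k in spans y (subst (λ y → U (s , y)) (sym e) (inside j)))
              (steinitz stable regular (List.length js) (terms js)
                (λ x k → let j , _ , e = entries-terms js k in
                  subst (λ x → x ⊧ p ∣ A) (sym e) (realizes-⊆ inj₁
                    (realizes {C = A ∪ range {M = N} sequence (λ i → i < j)} (morley j))))
                covA id mor
                (λ y k r → maximal y (inU y k) (satisfies (realizes-⊆
                  {C = A ∪ range {M = N} sequence (λ _ → ⊤)}
                  (λ { (inj₁ a) → inj₁ a ; (inj₂ (j , _ , refl)) → inj₂ (terms-entries (all j)) }) r))))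
      ... | refl = initial-↔ order ini all

    private
      tuple : ∀ {n} → (Fin n → Carrier s) → Tuple (replicate n s)
      tuple {zero}  g = []
      tuple {suc n} g = g zero ∷ tuple (g ∘ suc)

      entries-tuple : ∀ {n} (g : Fin n → Carrier s) {y} → entries (tuple g) y → ∃[ j ] y ≡ (s , g j)
      entries-tuple {suc n} g (here refl , refl) = zero , refl
      entries-tuple {suc n} g (there v , e)      = let j , h = entries-tuple (g ∘ suc) (v , e) in suc j , h

      tuple-entries : ∀ {n} (g : Fin n → Carrier s) j → entries (tuple g) (s , g j)
      tuple-entries g zero    = here refl , refl
      tuple-entries g (suc j) = let v , e = tuple-entries (g ∘ suc) j in there v , e

    -- Symmetric in the terms because it is read in two orders: `g zero` is the first term of the
    -- sequence indexed by `Fin n`, but the last one of the tuple handed to `Mor`.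
    Independent : ∀ {n} → (Fin n → Carrier s) → Set
    Independent g = ∀ j → g j ⊧ p ∣ A ∪ (λ y → ∃[ i ] i ≢ j × y ≡ (s , g i))

    private
      tuple-mor : ∀ {n} (g : Fin n → Carrier s) → Independent g → Mor {p = p} A {n} (tuple g)
      tuple-mor {zero}  g ind = []
      tuple-mor {suc n} g ind = realizes-⊆ first (ind zero) ∷ tuple-mor (g ∘ suc) (λ j → realizes-⊆
          (λ { (inj₁ a) → inj₁ a ; (inj₂ (i , ne , e)) → inj₂ (suc i , ne ∘ Fin.suc-injective , e) }) (ind (suc j)))
        where
        first : ∀ {y} → (A ∪ₑ tuple (g ∘ suc)) y → (A ∪ (λ y → ∃[ i ] i ≢ zero × y ≡ (s , g i))) y
        first (inj₁ a) = inj₁ a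
        first (inj₂ k) = let j , e = entries-tuple (g ∘ suc) k in inj₂ (suc j , (λ ()) , e)

    hasDimension : ∀ {n} (g : Fin n → Carrier s) → Independent g → (∀ j → U (s , g j)) →
      (∀ c → U (s , c) → ¬ (c ⊧ p ∣ A ∪ (λ y → ∃[ j ] y ≡ (s , g j)))) → HasDimension p U A n
    hasDimension {n} g ind inU spans = record
      { order    = record
        { Index = Fin n ; _<_ = Fin._<_
        ; isStrictTotalOrder = Fin.<-isStrictTotalOrder ; wellFounded = Fin.<-wellFounded }
      ; sequence = g
      ; inside   = inU
      ; morley   = λ j → satisfies (realizes-⊆ {C = A ∪ range {M = N} g (λ i → i Fin.< j)}
          (λ { (inj₁ a) → inj₁ a ; (inj₂ (i , lt , e)) → inj₂ (i , Fin.<⇒≢ lt , e) }) (ind j))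
      ; maximal  = λ c u r → spans c u (realizes-⊆ {D = A ∪ range {M = N} g (λ _ → ⊤)}
          (λ { (inj₁ a) → inj₁ a ; (inj₂ (j , e)) → inj₂ (j , _ , e) }) (realizes r))
      } , λ m → dimension-unique m (tuple g) (tuple-mor g ind) inside-tuple
        (λ x k → real-tuple k)
        (λ c u r → spans c u (realizes-⊆ {C = A ∪ (λ y → ∃[ j ] y ≡ (s , g j))}
          (λ { (inj₁ a) → inj₁ a ; (inj₂ (j , refl)) → inj₂ (tuple-entries g j) }) r))
      where
      inside-tuple : ∀ x → entries (tuple g) (s , x) → U (s , x)
      inside-tuple x k = let j , e = entries-tuple g k in subst U (sym e) (inU j)
      real-tuple : ∀ {x} → entries (tuple g) (s , x) → x ⊧ p ∣ A
      real-tuple k with entries-tuple g k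
      ... | j , refl = realizes-⊆ inj₁ (ind j)

-- From a subset of M^eq that solves formulas to an elementary submodel

module Models (em : ExcludedMiddle 0ℓ) (wo : WellOrdering) {L : Language} (M : Structure L) where
  open Structure M
  open Translation M
  private
    module C  = Covers em wo M
    module C* = Covers em wo (M ^eq)
    module D* = Definability em (M ^eq)
    module T* = Types em wo (M ^eq)
    dne : ∀ {P : Set} → ¬ ¬ P → P
    dne = Definability.dne em M

  cover-real : ∀ {J A} → C.Cover J A → C*.Cover J (real M A)
  cover-real cov = record
    { enum   = λ j → Maybe.map (λ (s , x) → home s , x) (C.Cover.enum cov j)
    ; covers = λ { (real-elem a) → go (C.Cover.covers cov a) } }
    where
    go : ∀ {s x} → (∃₂ λ j y → C.Cover.enum cov j ≡ just y × ElemEq setoid (s , x) y) →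
         ∃₂ λ j y → Maybe.map (λ (s , x) → home s , x) (C.Cover.enum cov j) ≡ just y ×
                    ElemEq (eqSetoid M) (home s , x) y
    go (j , _ , e , elemEq h) = j , _ , cong (Maybe.map _) e , elemEq h

  realizes-≈ : ∀ {s C x y} {p : GlobalType (M ^eq) s} → Setoid._≈_ (eqSetoid M s) x y → x T*.⊧ p ∣ C → y T*.⊧ p ∣ C
  realizes-≈ h r = T*.realizes λ { (φ ⟨ b ⟩) m →
    ⊨-resp (M ^eq) φ (h ∷ ≈*-refl (M ^eq)) (T*.satisfies r (φ ⟨ b ⟩) m) }

  module _ (E : Subset (M ^eq))
    (solve : ∀ ss {X : N.Tuple (homes ss) → Set} → D*.Defn E X → ∃ X → ∃[ a ] D*.entries a ⊆ E × X a) where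

    -- Saturated under `≈`: values of functions are found in `E` only up to `≈`, while a submodel
    -- has to contain the values themselves.
    HomePart : Subset M
    HomePart (s , x) = Σ (Carrier s) λ c → E (home s , c) × c ≈ x

    cover-HomePart : ∀ {J} → C*.Cover J E → C.Cover J HomePart
    cover-HomePart cov = record
      { enum   = λ j → C*.Cover.enum cov j >>= homeElem
      ; covers = λ (c , e , c≈x) → go c≈x (C*.Cover.covers cov e) }
      where
      homeElem : N.Elem → Maybe Elem
      homeElem (home s , x)   = just (s , x)
      homeElem (imag _ _ , _) = nothing
      go : ∀ {s c x} → c ≈ x → (∃₂ λ j y → C*.Cover.enum cov j ≡ just y × ElemEq (eqSetoid M) (home s , c) y) →
           ∃₂ λ j y → (C*.Cover.enum cov j >>= homeElem) ≡ just y × ElemEq setoid (s , x) y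
      go {s} c≈x (j , (_ , y) , e , elemEq c≈y) = j , (s , y) , cong (_>>= homeElem) e ,
        elemEq (Setoid.trans (setoid s) (Setoid.sym (setoid s) c≈x) c≈y)

    HomePart-≈ : ∀ {s x y} → x ≈ y → HomePart (s , x) → HomePart (s , y)
    HomePart-≈ {s} h (c , e , k) = c , e , Setoid.trans (setoid s) k h

    representatives : ∀ {Γ} (a : Tuple Γ) → (∀ {s} (v : s ∈ Γ) → HomePart (s , All.lookup a v)) →
                      Σ (N.Tuple (homes Γ)) λ b → D*.entries b ⊆ E × map⁻ b ≈* a
    representatives []      h = [] , (λ { (() , _) }) , []
    representatives (x ∷ a) h =
      let c , e , k = h (here refl) ; b , i , l = representatives a (h ∘ there)
      in c ∷ b , (λ { (here refl , refl) → e ; (there v , q) → i (v , q) }) , k ∷ l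

    forget-HomePart : ∀ {Γ} (a : All (CarrierIn M HomePart) Γ) {s} (v : s ∈ Γ) →
                      HomePart (s , All.lookup (forget M HomePart a) v)
    forget-HomePart (x ∷ a) (here refl) = proj₂ x
    forget-HomePart (x ∷ a) (there v)   = forget-HomePart a v

    tarskiVaught : ∀ {s Γ} (φ : Formula L (s ∷ Γ)) (a : All (CarrierIn M HomePart) Γ) →
                   (∃[ x ] M ⊨ φ [ x ∷ forget M HomePart a ]) →
                   Σ (CarrierIn M HomePart s) λ y → M ⊨ φ [ proj₁ y ∷ forget M HomePart a ]
    tarskiVaught {s} {Γ} φ a (x , h) =
      let b , i , b≈a = representatives (forget M HomePart a) (forget-HomePart a)
          c , j , k   = solve (s ∷ []) {λ c → M ⊨ φ [ map⁻ (++⁺ c b) ]}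
            (D*.def-inst (D*.def-⇔ (⊨-embF φ) (D*.def-formula (embF φ))) b i)
            (x ∷ [] , ⊨-resp M φ (Setoid.refl (setoid s) ∷ ≈*-sym M b≈a) h)
      in single b≈a c j k
      where
      single : ∀ {b : N.Tuple (homes Γ)} → map⁻ b ≈* forget M HomePart a → ∀ (c : N.Tuple (home s ∷ [])) →
               D*.entries c ⊆ E → M ⊨ φ [ map⁻ {xs = s ∷ Γ} (++⁺ c b) ] →
               Σ (CarrierIn M HomePart s) λ y → M ⊨ φ [ proj₁ y ∷ forget M HomePart a ]
      single b≈a (c ∷ []) j k = (c , c , j (here refl , refl) , Setoid.refl (setoid s)) ,
        ⊨-resp M φ (Setoid.refl (setoid s) ∷ b≈a) k

    -- The Tarski-Vaught property for the formula y = f(a) gives an element of the home part that is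
    -- `≈` to the value.
    HomePart-closed : Closed M HomePart
    HomePart-closed {Δ} {s} f a =
      let (y , u) , h = tarskiVaught (var (here refl) ≐ app f (All.map var (All.map there allVars)))
            a (func f (forget M HomePart a) , subst (λ b → func f (forget M HomePart a) ≈ func f b) (sym (eq _))
                                                (Setoid.refl (setoid s)))
      in HomePart-≈ (subst (λ b → y ≈ func f b) (eq y) h) u
      where
      open Definability em M using (allVars; ⟦vars⟧*; rearrange-map)
      eq : ∀ y → ⟦_⟧* M (All.map var (All.map there allVars)) (y ∷ forget M HomePart a) ≡ forget M HomePart a
      eq y = trans (⟦vars⟧* (All.map there allVars) (y ∷ forget M HomePart a))
                   (rearrange-map there (y ∷ forget M HomePart a) (λ _ → refl))

    private
      S : Structure L
      S = substructure M HomePart HomePart-closed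

    forget-⟦⟧  : ∀ {Γ s} (t : Term L Γ s) (a : All (CarrierIn M HomePart) Γ) →
                 proj₁ (⟦_⟧ S t a) ≡ ⟦_⟧ M t (forget M HomePart a)
    forget-⟦⟧* : ∀ {Γ Δ} (ts : All (Term L Γ) Δ) (a : All (CarrierIn M HomePart) Γ) →
                 forget M HomePart (⟦_⟧* S ts a) ≡ ⟦_⟧* M ts (forget M HomePart a)
    forget-⟦⟧ (var v)    a = sym (lookup-map a v)
    forget-⟦⟧ (app f ts) a = cong (func f) (forget-⟦⟧* ts a)
    forget-⟦⟧* []        a = refl
    forget-⟦⟧* (t ∷ ts)  a = cong₂ _∷_ (forget-⟦⟧ t a) (forget-⟦⟧* ts a)

    elementary : ∀ {Γ} (φ : Formula L Γ) (a : All (CarrierIn M HomePart) Γ) →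
                 (S ⊨ φ [ a ]) ⇔ (M ⊨ φ [ forget M HomePart a ])
    elementary (t ≐ u)    a = ≡⇒⇔ (cong₂ _≈_ (forget-⟦⟧ t a) (forget-⟦⟧ u a))
    elementary (rel r ts) a = ≡⇒⇔ (cong (relation r) (forget-⟦⟧* ts a))
    elementary ⊥′         a = ⇔-refl
    elementary (φ ⇒ ψ)    a = mk⇔ (λ f x → to (elementary ψ a) (f (from (elementary φ a) x)))
                                   (λ f x → from (elementary ψ a) (f (to (elementary φ a) x)))
    elementary (∀′ s φ)   a = mk⇔
      (λ f x → dne λ ¬k → let y , k = tarskiVaught (¬′ φ) a (x , ¬k) in k (to (elementary φ (y ∷ a)) (f y)))
      (λ f x → from (elementary φ (x ∷ a)) (f (proj₁ x)))

    isElementary : IsElementarySubmodel M HomePart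
    isElementary = record { closed = HomePart-closed ; elementary = elementary }

    private
      classOf : ∀ {Γ} (G : DefinableEquivalence M Γ) → Formula (L^eq M) (imag Γ G ∷ homes Γ)
      classOf G = var (here refl) ≐ app (cls G) (All.map var (All.map there (Definability.allVars em (M ^eq))))

      ⊨-classOf : ∀ {Γ} (G : DefinableEquivalence M Γ) c b →
                  ((M ^eq) ⊨ classOf G [ c ∷ b ]) ⇔ DefinableEquivalence._∼_ G c (map⁻ b)
      ⊨-classOf G c b = ≡⇒⇔ (cong (λ b → DefinableEquivalence._∼_ G c (map⁻ b))
        (trans (D*.⟦vars⟧* (All.map there D*.allVars) (c ∷ b)) (D*.rearrange-map there (c ∷ b) (λ _ → refl))))

      equals : ∀ {s} → Formula (L^eq M) (s ∷ s ∷ [])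
      equals = var (here refl) ≐ var (there (here refl))

      map⁻-lookup : ∀ {Γ} (b : N.Tuple (homes Γ)) → D*.entries b ⊆ E →
                    ∀ {s} (v : s ∈ Γ) → HomePart (s , All.lookup (map⁻ {xs = Γ} b) v)
      map⁻-lookup {s ∷ _} (x ∷ b) i (here refl) = x , i (here refl , refl) , Setoid.refl (setoid s)
      map⁻-lookup         (x ∷ b) i (there v)   = map⁻-lookup b (λ (w , e) → i (there w , e)) v

      homeTuple : ∀ {Γ} → Tuple Γ → N.Tuple (homes Γ)
      homeTuple = map⁺ {P = N.Carrier} {f = home}

      map⁻-map⁺ : ∀ {Γ} (a : Tuple Γ) → map⁻ {xs = Γ} (homeTuple a) ≡ a
      map⁻-map⁺ []      = refl
      map⁻-map⁺ (x ∷ a) = cong (x ∷_) (map⁻-map⁺ a)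

    -- For an imaginary `c` in `E`, the formula saying that a home tuple has class `c` is over `E`
    -- and consistent. A solution in `E` is a representative of `c` in the submodel.
    E⊆eqClosure : ∀ {s c} → E (s , c) → eqClosure M HomePart (s , c)
    E⊆eqClosure {home s}   {c} e = home-elem (c , e , Setoid.refl (setoid s))
    E⊆eqClosure {imag Γ G} {c} e =
      let b , i , h = solve Γ {λ b → DefinableEquivalence._∼_ G c (map⁻ b)}
            (D*.def-⇔ (λ b → ⊨-classOf G c b)
              (simplify (D*.def-plug (D*.def-formula (classOf G)) (D*.constant c e ∷ D*.variables D*.allVars))))
            (homeTuple c , subst (DefinableEquivalence._∼_ G c) (sym (map⁻-map⁺ c))
                             (Setoid.refl (eqSetoid M (imag Γ G)) {c}))
      in imag-elem (map⁻-lookup b i) h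
      where
      simplify : D*.Defn E (λ b → (M ^eq) ⊨ classOf G [ c ∷ D*.values {E} b (D*.variables D*.allVars) ]) →
               D*.Defn E (λ b → (M ^eq) ⊨ classOf G [ c ∷ b ])
      simplify d = D*.def-⇔ (λ b → ≡⇒⇔ (cong (λ b → (M ^eq) ⊨ classOf G [ c ∷ b ])
        (trans (D*.values-variables {E} b D*.allVars) (D*.rearrange-allVars b)))) d

    -- An element of the eq-closure need not lie in `E`, but its class is definable over `E` from a
    -- representative. This is how goodness of `E` reaches the whole eq-closure.
    def-≈ : ∀ {s c} → eqClosure M HomePart (s , c) →
            D*.Defn E (λ (a : N.Tuple (s ∷ [])) → Setoid._≈_ (eqSetoid M s) (All.head a) c)
    def-≈ {home s} (home-elem (c , e , h)) = D*.def-⇔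
      (λ { (x ∷ []) → mk⇔ (λ k → Setoid.trans (setoid s) k h)
                           (λ k → Setoid.trans (setoid s) k (Setoid.sym (setoid s) h)) })
      (D*.def-inst {Γ = home s ∷ []} (D*.def-formula equals) (c ∷ []) λ { (here refl , refl) → e })
    def-≈ {imag Γ G} (imag-elem {a = c} {b} u c∼b) =
      let b′ , i , b′≈b = representatives b u
          e = map⁻ {xs = Γ} b′
          b∼b′ : DefinableEquivalence._∼_ G b e
          b∼b′ = ⊨-resp M (DefinableEquivalence.formula G) (++⁺-cong M (≈*-refl M) (≈*-sym M b′≈b))
                   (IsEq.refl {b})
          c∼b′ = IsEq.trans {c} {b} {e} c∼b b∼b′
      in D*.def-⇔ (λ { (x ∷ []) → mk⇔
             (λ k → IsEq.trans {x} {e} {c} (to (⊨-classOf G x b′) k) (IsEq.sym {c} {e} c∼b′))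
             (λ k → from (⊨-classOf G x b′) (IsEq.trans {x} {c} {e} k c∼b′)) })
           (D*.def-inst {Γ = imag Γ G ∷ []} (D*.def-formula (classOf G)) b′ i)
      where
      module IsEq = Setoid (eqSetoid M (imag Γ G))

-- Assembly of the model

module Construction
  (em : ExcludedMiddle 0ℓ) (wo : WellOrdering) {L : Language} (countable : CountableLanguage L)
  (κ : Set) (M : Structure L) (ℕ≺κ : ≡.setoid ℕ ≺ ≡.setoid κ) (saturated : Saturated κ M)
  (A : Subset M) (countableA : Countable M A) (I : Set) (codeI : I ↣ ℕ)
  (s : I → Sort (L^eq M)) (p : (i : I) → GlobalType (M ^eq) (s i))
  (orthogonal : ∀ i j → i ≢ j → Orthogonal (p i) (p j))
  (stable : ∀ i → GenericallyStable κ (p i))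
  (regular : ∀ i → Regular κ (real M A) (p i))
  (nonisolated : ∀ i → ¬ Isolated (p i ↾ real M A))
  (f : I → ℕ) where

  private
    module C   = Covers em wo M
    module C*  = Covers em wo (M ^eq)
    module Im  = Imaginaries em wo M
    module Mod = Models em wo M
    module T*  = Types em wo (M ^eq)

    Z : Set
    Z = Σ I (Fin ∘ f)

    abstract
      sat : ∀ {P} → Tiny κ P → ∀ {C} → C*.Cover (C*.Ix P) C → C*.SatAt C
      sat tiny = Im.saturated-eq ℕ≺κ tiny saturated

      covA : C*.Cover ℕ (real M A)
      covA = Mod.cover-real (C.countable-cover countableA)

      codeZ : Z ↣ ℕ
      codeZ = mk↣ {to = λ (i , j) → pair (Injection.to codeI i) (toℕ j)} injective
        where
        injective : ∀ {x y : Z} → pair (Injection.to codeI (proj₁ x)) (toℕ (proj₂ x)) ≡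
                                  pair (Injection.to codeI (proj₁ y)) (toℕ (proj₂ y)) → x ≡ y
        injective e with e₁ , e₂ ← pair-injective e
                    with refl ← Injection.injective codeI e₁ = cong (_ ,_) (Fin.toℕ-injective e₂)

    module F = Families.Family em wo (M ^eq) κ ℕ≺κ sat covA s p orthogonal stable regular Z proj₁ codeZ
    module Om = Omitting em wo (M ^eq) κ ℕ≺κ sat (Im.formulas countable) (Im.formulas-complete countable)

    abstract
      nonisolated-Basis : ∀ i → ¬ Isolated (p i ↾ F.Basis)
      nonisolated-Basis i iso = nonisolated i (F.isolated-Basis i iso)

    -- Only formulas in home sorts are solved. These sorts are countably many by hypothesis on the
    -- language, and representatives of imaginary elements are tuples of home elements.
    module Cl = Om.Closing codeI s p F.cover-Basis nonisolated-Basis (proj₁ countable) home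

    abstract
      E : Subset (M ^eq)
      E = Om.Stage.set Cl.model

      E-cover : C*.Cover ℕ E
      E-cover = Om.Stage.cover Cl.model

      E-good : Om.Good codeI s p F.cover-Basis nonisolated-Basis E
      E-good = Om.Stage.good Cl.model

      E-solves : ∀ ss {X : Structure.Tuple (M ^eq) (map home ss) → Set} →
                 Definability.Defn em (M ^eq) E X → ∃ X → ∃[ a ] Definability.entries em (M ^eq) a ⊆ E × X a
      E-solves = Cl.model-solves*

    basis⊆E : F.Basis ⊆ E
    basis⊆E = Om.Good.base E-good

  U : Subset M
  U = Mod.HomePart E E-solves

  A⊆U : A ⊆ U
  A⊆U {_ , x} a = x , basis⊆E (0 , F.A⊆Base 0 (real-elem a)) , Setoid.refl (Structure.setoid M _)

  countable-U : Countable M U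
  countable-U = C.cover-countable (Mod.cover-HomePart E E-solves E-cover)

  elementary-U : IsElementarySubmodel M U
  elementary-U = Mod.isElementary E E-solves

  -- Goodness is applied to the class of `c`, a nonempty set definable over `E`: it contains some
  -- `y` that does not realize the type, and then neither does `c`, as `y` and `c` satisfy the same
  -- formulas.
  U-omits : ∀ i c → eqClosure M U (s i , c) → ¬ (c T*.⊧ p i ∣ F.Basis)
  U-omits i c u r =
    let y , y≈c , ¬ry = Om.omitting-def codeI s p F.cover-Basis nonisolated-Basis E-good i
                          (Mod.def-≈ E E-solves u) c (Setoid.refl (eqSetoid M (s i)))
    in ¬ry (Mod.realizes-≈ (Setoid.sym (eqSetoid M (s i)) y≈c) r)

  dimension-U : ∀ i → HasDimension (p i) (eqClosure M U) (real M A) (f i)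
  dimension-U i = Dimension.hasDimension em wo (M ^eq) κ ℕ≺κ sat covA (stable i) (regular i)
    (λ j → F.term (i , j))
    (λ j → T*.realizes-⊆ (λ { (inj₁ a) → inj₁ a
                            ; (inj₂ (k , ne , e)) → inj₂ ((i , k) , (λ { refl → ne refl }) , e) })
             (F.term-independent (i , j)))
    (λ j → Mod.E⊆eqClosure E E-solves (basis⊆E (_ , F.term-in (i , j))))
    (λ c u r → U-omits i c u (F.realizes-Basis i
      (T*.realizes-⊆ (λ { (inj₁ a) → inj₁ a ; (inj₂ ((i , j) , refl , e)) → inj₂ (j , e) }) r)))

theorem4 : Classical →
    (L : Language) → CountableLanguage L →
    (T : Theory L) → Complete T →
    (κ : Set) (M̄ : Structure L) → IsMonster κ T M̄ →
    (A : Subset M̄) → Countable M̄ A →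
    (I : Set) → (I ↣ ℕ) →
    (s : I → Sort (L^eq M̄)) (p : (i : I) → GlobalType (M̄ ^eq) (s i)) →
    (∀ i j → i ≢ j → Orthogonal (p i) (p j)) →
    (∀ i → GenericallyStable κ (p i)) →
    (∀ i → Regular κ (real M̄ A) (p i)) →
    (∀ i → ¬ Isolated (p i ↾ real M̄ A)) →
    (f : I → ℕ) →
    ∃[ U ] (A ⊆ U × Countable M̄ U × IsElementarySubmodel M̄ U ×
    (∀ i → HasDimension (p i) (eqClosure M̄ U) (real M̄ A) (f i)))
theorem4 classical L countable T complete κ M̄ monster A countableA I codeI s p orthogonal stable regular
         nonisolated f = U , A⊆U , countable-U , elementary-U , dimension-U
  where
  open Construction (λ {P} → Classical.excludedMiddle classical 0ℓ {P}) (Classical.wellOrdering classical)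
    countable κ M̄ (IsMonster.uncountable monster) (IsMonster.saturated monster) A countableA I codeI s p
    orthogonal stable regular nonisolated f
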